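{- Let $q=2^n$ with $n\ge 3$, let $h$ be a positive integer with $\gcd(n,h)=1$, let $q\equiv\xi\pmod 3$ with $\xi\in\{1,-1\}$, and let the point classes $\mathcal O_i$ and the plane classes $\mathcal O_d^{\mathfrak s}$ of $\mathrm{PG}(3,q)$ be as defined in the context. Through every point of $\mathcal O_1$ there pass exactly $r_{1,d}$ planes of $\mathcal O_d^{\mathfrak s}$, and through every point of $\mathcal O_2$ there pass exactly $r_{2,d}$ planes of $\mathcal O_d^{\mathfrak s}$, where $$r_{1,d}=\begin{cases}1&\text{if } d=q+1,\\ \frac{q(q-\xi)}3&\text{if } d=0,\\ \frac{q(q+\xi)}2&\text{if } d=1,\\ q&\text{if } d=2,\\ \frac{q(q-\xi)}6&\text{if } d=3,\end{cases}\qquad r_{2,d}=\begin{cases}2&\text{if } d=q+1,\\ \frac{q^2-1}3&\text{if } d=0,\\ \frac{q(q-1)}2&\text{if } d=1,\\ 2q-1&\text{if } d=2,\\ \frac{q^2-3q+2}6&\text{if } d=3.\end{cases}$$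
   Context: Points of $\mathrm{PG}(3,q)$ have homogeneous coordinates $(X_1,X_2,X_3,X_4)$; $U_i$ is the point with $1$ in position $i$ and $0$ elsewhere. $\mathcal A=\{P_t=(1,t,t^{2^h},t^{2^h+1})\mid t\in\mathbb F_q\}\cup\{U_4\}$. $\mathfrak s$ is the symplectic polarity of $\mathrm{PG}(3,q)$ defined by the alternating form $x_1y_4+x_2y_3+x_3y_2+x_4y_1$. The osculating planes are the $q+1$ planes $P^{\mathfrak s}$, $P\in\mathcal A$. Put $\mathcal O_{q+1}=\mathcal A$; for $i\in\{0,1,2,3\}$, $\mathcal O_i$ is the set of points of $\mathrm{PG}(3,q)\setminus\mathcal A$ lying on exactly $i$ osculating planes. For $i\in\{0,1,2,3,q+1\}$, $\mathcal O_i^{\mathfrak s}=\{P^{\mathfrak s}\mid P\in\mathcal O_i\}$ (so $\mathcal O_{q+1}^{\mathfrak s}$ is the set of osculating planes). -}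

module Defs where

open import Algebra.Bundles using (CommutativeRing; Semiring)
open import Algebra.Definitions using (Invertible)
import Algebra.Definitions.RawSemiring as RawSemiringDefinitions
open import Data.Bool using (if_then_else_)
open import Data.Fin using (Fin; toℕ; opposite; _≟_)
open import Data.Fin.Patterns using (0F; 1F; 2F; 3F)
open import Data.Integer using (ℤ; +_)
open import Data.Nat using (ℕ)
import Data.Nat as ℕ
open import Data.Product using (Σ; Σ-syntax; ∃-syntax; _×_; _,_; proj₁)
open import Data.Rational.Unnormalised using (ℚᵘ; _/_; _≃_)
open import Data.Sum using (_⊎_)
open import Data.Vec.Functional using (Vector; []; _∷_)
open import Function.Bundles using (Inverse)
open import Level using (Level; _⊔_; suc)
open import Relation.Binary.Bundles using (Setoid)
import Relation.Binary.Construct.On as On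
import Relation.Binary.PropositionalEquality as ≡
import Relation.Binary.Reasoning.Setoid as SetoidReasoning
open import Relation.Nullary using (¬_; does)

record Field c ℓ : Set (suc (c ⊔ ℓ)) where
  field
    commutativeRing : CommutativeRing c ℓ

  open CommutativeRing commutativeRing public

  field
    1≉0        : ¬ (1# ≈ 0#)
    invertible : ∀ x → ¬ (x ≈ 0#) → Invertible _≈_ 1# _*_ x

HasCardinality : ∀ {a ℓ} → Setoid a ℓ → ℕ → Set (a ⊔ ℓ)
HasCardinality S k = Inverse (≡.setoid (Fin k)) S

HasOrder : ∀ {c ℓ} → Field c ℓ → ℕ → Set (c ⊔ ℓ)
HasOrder F = HasCardinality (Field.setoid F)

-- Equality of Σ S P is that of S: witnesses of P are ignored, so that
-- cardinalities count elements of S.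
subsetoid : ∀ {a ℓ p} (S : Setoid a ℓ) → (Setoid.Carrier S → Set p) →
            Setoid (a ⊔ p) ℓ
subsetoid S P = On.setoid {B = Σ (Setoid.Carrier S) P} S proj₁

-- The indices d of the classes 𝒪_d: ⟨ i ⟩ for d = i ∈ {0, 1, 2, 3}, and q+1.
data ClassIndex : Set where
  ⟨_⟩ : Fin 4 → ClassIndex
  q+1 : ClassIndex

module PG3 {c ℓ : Level} (F : Field c ℓ) where

  open Field F
  open RawSemiringDefinitions (Semiring.rawSemiring semiring) using (_^_; sum)

  -- The homogeneous coordinates X₁, …, X₄ are indexed by 0F, …, 3F.
  record Homogeneous : Set (c ⊔ ℓ) where
    field
      coord   : Vector Carrier 4
      nonzero : ¬ (∀ i → coord i ≈ 0#)

  open Homogeneous public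

  Point : Set (c ⊔ ℓ)
  Point = Homogeneous

  -- The plane a₁X₁ + a₂X₂ + a₃X₃ + a₄X₄ = 0 is given by its coefficients
  -- (a₁, a₂, a₃, a₄), which are determined up to a nonzero scalar.
  Plane : Set (c ⊔ ℓ)
  Plane = Homogeneous

  infix 4 _∼_ _on_

  _∼_ : Homogeneous → Homogeneous → Set (c ⊔ ℓ)
  x ∼ y = ∃[ k ] ¬ (k ≈ 0#) × (∀ i → coord x i ≈ k * coord y i)

  _on_ : Point → Plane → Set ℓ
  P on π = sum (λ i → coord π i * coord P i) ≈ 0#

  private
    ∼-refl : ∀ {x} → x ∼ x
    ∼-refl = 1# , 1≉0 , λ i → sym (*-identityˡ _)

    ∼-sym : ∀ {x y} → x ∼ y → y ∼ x
    ∼-sym {x} {y} (k , k≉0 , x≈ky) with invertible k k≉0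
    ... | k⁻¹ , k⁻¹k≈1 , _ = k⁻¹ , k⁻¹≉0 , y≈k⁻¹x
      where
      k⁻¹≉0 : ¬ (k⁻¹ ≈ 0#)
      k⁻¹≉0 k⁻¹≈0 = 1≉0 (trans (sym k⁻¹k≈1) (trans (*-congʳ k⁻¹≈0) (zeroˡ k)))

      y≈k⁻¹x : ∀ i → coord y i ≈ k⁻¹ * coord x i
      y≈k⁻¹x i = begin
        coord y i              ≈⟨ *-identityˡ _ ⟨
        1# * coord y i         ≈⟨ *-congʳ k⁻¹k≈1 ⟨
        k⁻¹ * k * coord y i    ≈⟨ *-assoc _ _ _ ⟩
        k⁻¹ * (k * coord y i)  ≈⟨ *-congˡ (x≈ky i) ⟨
        k⁻¹ * coord x i        ∎
        where open SetoidReasoning setoid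

    ∼-trans : ∀ {x y z} → x ∼ y → y ∼ z → x ∼ z
    ∼-trans {x} {y} {z} (k , k≉0 , x≈ky) (l , l≉0 , y≈lz) =
      k * l , kl≉0 ,
      λ i → trans (x≈ky i) (trans (*-congˡ (y≈lz i)) (sym (*-assoc _ _ _)))
      where
      kl≉0 : ¬ (k * l ≈ 0#)
      kl≉0 kl≈0 with invertible k k≉0
      ... | k⁻¹ , k⁻¹k≈1 , _ = l≉0 (begin
        l              ≈⟨ *-identityˡ l ⟨
        1# * l         ≈⟨ *-congʳ k⁻¹k≈1 ⟨
        k⁻¹ * k * l    ≈⟨ *-assoc _ _ _ ⟩
        k⁻¹ * (k * l)  ≈⟨ *-congˡ kl≈0 ⟩
        k⁻¹ * 0#       ≈⟨ zeroʳ _ ⟩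
        0#             ∎)
        where open SetoidReasoning setoid

  homogeneousSetoid : Setoid (c ⊔ ℓ) (c ⊔ ℓ)
  homogeneousSetoid = record
    { Carrier       = Homogeneous
    ; _≈_           = _∼_
    ; isEquivalence = record
      { refl  = λ {x} → ∼-refl {x}
      ; sym   = λ {x} {y} → ∼-sym {x} {y}
      ; trans = λ {x} {y} {z} → ∼-trans {x} {y} {z}
      }
    }

  pointSetoid planeSetoid : Setoid (c ⊔ ℓ) (c ⊔ ℓ)
  pointSetoid = homogeneousSetoid
  planeSetoid = homogeneousSetoid

  unit : Fin 4 → Vector Carrier 4
  unit i j = if does (i ≟ j) then 1# else 0#

  -- Alternating only in characteristic 2.
  β : Vector Carrier 4 → Vector Carrier 4 → Carrier
  β x y = x 0F * y 3F + x 1F * y 2F + x 2F * y 1F + x 3F * y 0F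

  β-unit : ∀ x i → β x (unit i) ≈ x (opposite i)
  β-unit x 0F = begin
    x 0F * 0# + x 1F * 0# + x 2F * 0# + x 3F * 1#
      ≈⟨ +-cong (+-cong (+-cong (zeroʳ _) (zeroʳ _)) (zeroʳ _)) (*-identityʳ _) ⟩
    0# + 0# + 0# + x 3F
      ≈⟨ +-congʳ (trans (+-identityʳ _) (+-identityʳ _)) ⟩
    0# + x 3F
      ≈⟨ +-identityˡ _ ⟩
    x 3F ∎
    where open SetoidReasoning setoid
  β-unit x 1F = begin
    x 0F * 0# + x 1F * 0# + x 2F * 1# + x 3F * 0#
      ≈⟨ +-cong (+-cong (+-cong (zeroʳ _) (zeroʳ _)) (*-identityʳ _)) (zeroʳ _) ⟩
    0# + 0# + x 2F + 0#
      ≈⟨ trans (+-identityʳ _) (+-congʳ (+-identityʳ _)) ⟩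
    0# + x 2F
      ≈⟨ +-identityˡ _ ⟩
    x 2F ∎
    where open SetoidReasoning setoid
  β-unit x 2F = begin
    x 0F * 0# + x 1F * 1# + x 2F * 0# + x 3F * 0#
      ≈⟨ +-cong (+-cong (+-cong (zeroʳ _) (*-identityʳ _)) (zeroʳ _)) (zeroʳ _) ⟩
    0# + x 1F + 0# + 0#
      ≈⟨ trans (+-identityʳ _) (+-identityʳ _) ⟩
    0# + x 1F
      ≈⟨ +-identityˡ _ ⟩
    x 1F ∎
    where open SetoidReasoning setoid
  β-unit x 3F = begin
    x 0F * 1# + x 1F * 0# + x 2F * 0# + x 3F * 0#
      ≈⟨ +-cong (+-cong (+-cong (*-identityʳ _) (zeroʳ _)) (zeroʳ _)) (zeroʳ _) ⟩
    x 0F + 0# + 0# + 0#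
      ≈⟨ trans (+-identityʳ _) (trans (+-identityʳ _) (+-identityʳ _)) ⟩
    x 0F ∎
    where open SetoidReasoning setoid

  -- P^𝔰 is the plane β(P, Y) = 0; the coefficient of Yᵢ is β(P, Uᵢ).
  infix 10 _^𝔰

  _^𝔰 : Point → Plane
  P ^𝔰 = record
    { coord   = λ i → β (coord P) (unit i)
    ; nonzero = λ β≈0 → nonzero P λ
        { 0F → trans (sym (β-unit (coord P) 3F)) (β≈0 3F)
        ; 1F → trans (sym (β-unit (coord P) 2F)) (β≈0 2F)
        ; 2F → trans (sym (β-unit (coord P) 1F)) (β≈0 1F)
        ; 3F → trans (sym (β-unit (coord P) 0F)) (β≈0 0F)
        }
    }

  U₄ : Point
  U₄ = record { coord = unit 3F ; nonzero = λ u≈0 → 1≉0 (u≈0 3F) }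

  module _ (h : ℕ) where

    P[_] : Carrier → Point
    P[ t ] = record
      { coord   = 1# ∷ t ∷ t ^ (2 ℕ.^ h) ∷ t ^ (2 ℕ.^ h ℕ.+ 1) ∷ []
      ; nonzero = λ x≈0 → 1≉0 (x≈0 0F)
      }

    𝒜 : Point → Set (c ⊔ ℓ)
    𝒜 P = (∃[ t ] P ∼ P[ t ]) ⊎ P ∼ U₄

    Osculating : Plane → Set (c ⊔ ℓ)
    Osculating π = ∃[ P ] 𝒜 P × π ∼ P ^𝔰

    𝒪 : ClassIndex → Point → Set (c ⊔ ℓ)
    𝒪 q+1   P = 𝒜 P
    𝒪 ⟨ i ⟩ P =
      ¬ 𝒜 P ×
      HasCardinality (subsetoid planeSetoid λ π → Osculating π × P on π) (toℕ i)

    𝒪^𝔰 : ClassIndex → Plane → Set (c ⊔ ℓ)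
    𝒪^𝔰 d π = ∃[ P ] 𝒪 d P × π ∼ P ^𝔰

    -- The rational number r is an integer N ≥ 0, and exactly N planes of 𝒪_d^𝔰
    -- pass through P.
    ExactlyPlanesThrough : Point → ClassIndex → ℚᵘ → Set (c ⊔ ℓ)
    ExactlyPlanesThrough P d r =
      Σ[ N ∈ ℕ ] + N / 1 ≃ r ×
      HasCardinality (subsetoid planeSetoid λ π → 𝒪^𝔰 d π × P on π) N

module _ where
  open import Data.Integer using (_*_; _+_; _-_)

  r₁ : ℤ → ℤ → ClassIndex → ℚᵘ
  r₁ q ξ q+1    = + 1 / 1
  r₁ q ξ ⟨ 0F ⟩ = q * (q - ξ) / 3
  r₁ q ξ ⟨ 1F ⟩ = q * (q + ξ) / 2
  r₁ q ξ ⟨ 2F ⟩ = q / 1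
  r₁ q ξ ⟨ 3F ⟩ = q * (q - ξ) / 6

  r₂ : ℤ → ClassIndex → ℚᵘ
  r₂ q q+1    = + 2 / 1
  r₂ q ⟨ 0F ⟩ = (q * q - + 1) / 3
  r₂ q ⟨ 1F ⟩ = q * (q - + 1) / 2
  r₂ q ⟨ 2F ⟩ = (+ 2 * q - + 1) / 1
  r₂ q ⟨ 3F ⟩ = (q * q - + 3 * q + + 2) / 6

{-# OPTIONS --safe #-}

-- A plane R^𝔰 passes through P exactly when R lies in P^𝔰, so the task is to count
-- the points of each class in the plane P^𝔰 for a point P outside 𝒜.  The form β is
-- the polar form of Q = X₁X₄ + X₂X₃, and 𝒜 lies on the quadric Q = 0.  A point outside
-- 𝒜 lies on exactly two osculating planes if it is on the quadric; otherwise, with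
-- one osculating plane moved to t = ∞, the others are the zeros of g t^(2^h) + e t + k
-- with g, e ≠ 0, and their number is 0 or 2 because t ↦ t^(2^h - 1) is a bijection.
--
-- For a point Y of P^𝔰 let z(Y) be the number of osculating planes on Y.  Intersecting
-- P^𝔰 with one or two osculating planes gives the sums of z and z² over P^𝔰;
-- together with the number of points of P^𝔰, of points of the quadric in P^𝔰, and of
-- points of 𝒜 in P^𝔰, they determine the number n_d of points of every class d.  Two
-- osculating planes meet P^𝔰 in one point unless P is on the corresponding chord of 𝒜;
-- a point of the quadric is on no chord, and any other point on at most one since no
-- four points of 𝒜 are coplanar.  For P in 𝒪₁ the equation for 6 n_3, read modulo 3,
-- decides whether there is a chord through P.

module Submission where

open import Defs
open import Algebra.Bundles using (CommutativeRing; RawRing; Semiring)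
open import Algebra.Core using (Op₁; Op₂)
import Algebra.Definitions.RawSemiring as RawSemiringDefinitions
import Algebra.Morphism.RingMonomorphism as RingMonomorphism
open import Algebra.Morphism.Structures using (IsRingMonomorphism)
import Algebra.Properties.CommutativeMonoid.Sum as CommutativeMonoidSum
import Algebra.Properties.CommutativeSemiring.Exp as Exp
import Algebra.Properties.Ring as RingProperties
import Algebra.Properties.Semiring.Mult as SemiringMult
import Algebra.Solver.Ring
open import Algebra.Solver.Ring.AlmostCommutativeRing
  using (_-Raw-AlmostCommutative⟶_; fromCommutativeSemiring)
open import Algebra.Structures using (IsCommutativeRing)
open import Data.Bool using (Bool; true; false; _xor_; _∧_)
import Data.Fin as Fin
open Fin using (Fin; toℕ)
open import Data.Fin.Patterns using (0F; 1F; 2F; 3F)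
open import Data.Fin.Permutation using (permutation; ↔⇒≡)
import Data.Fin.Properties as Fin
open import Data.List using (List; []; _∷_; map; length; filter; lookup; allFin; cartesianProduct)
open import Data.List.Membership.Propositional using (_∈_)
open import Data.List.Membership.Propositional.Properties
  using (∈-filter⁺; ∈-lookup; ∈-allFin; ∈-map⁺; ∈-cartesianProduct⁺)
open import Data.List.Properties using (map-∘; map-++; length-tabulate)
import Data.List.Relation.Unary.All as All
open All using (All; []; _∷_)
import Data.List.Relation.Unary.All.Properties as All
open import Data.List.Relation.Unary.AllPairs using ([]; _∷_)
import Data.List.Relation.Unary.Any as Any
open Any using (here; there)
open import Data.List.Relation.Unary.Any.Properties using (lookup-index)
open import Data.List.Relation.Unary.Unique.Propositional using (Unique)
import Data.List.Relation.Unary.Unique.Propositional.Properties as Unique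
import Data.Maybe as Maybe
open Maybe using (Maybe; just; nothing)
import Data.Maybe.Properties as Maybe
open import Data.Nat as ℕ using (ℕ; suc; z≤n; s≤s)
import Data.Nat.Divisibility as ℕ
open import Data.Nat.GCD using (gcd; gcd-GCD; module Bézout)
open import Data.Nat.ListAction using (sum)
open import Data.Nat.ListAction.Properties using (sum-++)
import Data.Nat.Properties as ℕ
open import Data.Nat.Tactic.RingSolver using (solve-∀)
open import Data.Product using (Σ; _×_; _,_; ∃; ∃₂; proj₁; proj₂)
import Data.Product.Properties as Product
open import Data.Sum as Sum using (_⊎_; inj₁; inj₂; [_,_]′)
open import Data.Unit using (tt)
open import Function using (_∘_; id; case_of_)
open import Function.Bundles using (Inverse)
import Function.Construct.Composition as Composition
import Function.Construct.Symmetry as Symmetry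
open import Level using (0ℓ)
open import Relation.Binary.Bundles using (Setoid)
open import Relation.Binary.Definitions using (DecidableEquality)
open import Relation.Binary.PropositionalEquality
import Relation.Binary.Reasoning.Setoid as SetoidReasoning
open import Relation.Nullary using (¬_; Dec; yes; no; contradiction)
open import Relation.Nullary.Decidable using (_×-dec_; _⊎-dec_; ¬?; from-no)
open import Relation.Unary using (Pred; Decidable)

-- Counting in finite types

-- All that is known about P is its number of osculating planes: no orbit representative is fixed,
-- so the class sizes in P^𝔰 must follow from counts. The number `n_2` comes from the quadric, which
-- P^𝔰 cuts in a conic with nucleus P when P is off it and in two lines through P when P is on it.
-- The weights z(z-1), (z-1)(z-3) and z(3-z) then isolate `n_3`, `n_0` and `n_1`. For P in 𝒪₁ the
-- counts leave one thing open: a chord through P adds 2q to the sum of z² and changes 6 n_3 from q²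
-- - q to q² + q. Only one of these is divisible by 3, and that is where ξ enters the formulas.
--
-- Sizes of subspaces come from slicing: a set of vectors closed under translation by multiples of w
-- is a union of lines, and a condition met once on every line divides its size by q. Points are
-- counted afterwards, from the vectors. The given field is replaced by its copy on `Fin q`, where
-- equality is decidable and propositional.

record Finite (X : Set) : Set where
  field
    elements : List X
    unique   : Unique elements
    complete : ∀ x → x ∈ elements
    _≟_      : DecidableEquality X

  card : ℕ
  card = length elements

open Finite using (elements; unique; complete; card)

module _ {X : Set} where

  sum-cong : {f g : X → ℕ} (xs : List X) → (∀ x → f x ≡ g x) → sum (map f xs) ≡ sum (map g xs)
  sum-cong []       f≗g = refl
  sum-cong (x ∷ xs) f≗g = cong₂ ℕ._+_ (f≗g x) (sum-cong xs f≗g)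

  sum-+ : (f g : X → ℕ) (xs : List X) →
          sum (map (λ x → f x ℕ.+ g x) xs) ≡ sum (map f xs) ℕ.+ sum (map g xs)
  sum-+ f g []       = refl
  sum-+ f g (x ∷ xs) rewrite sum-+ f g xs = lemma (f x) (g x) _ _
    where
    lemma : ∀ a b c d → a ℕ.+ b ℕ.+ (c ℕ.+ d) ≡ a ℕ.+ c ℕ.+ (b ℕ.+ d)
    lemma = solve-∀

  sum-* : (c : ℕ) (f : X → ℕ) (xs : List X) → sum (map (λ x → c ℕ.* f x) xs) ≡ c ℕ.* sum (map f xs)
  sum-* c f []       = sym (ℕ.*-zeroʳ c)
  sum-* c f (x ∷ xs) rewrite sum-* c f xs = sym (ℕ.*-distribˡ-+ c (f x) _)

  sum-const : (c : ℕ) (xs : List X) → sum (map (λ _ → c) xs) ≡ length xs ℕ.* c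
  sum-const c []       = refl
  sum-const c (x ∷ xs) = cong (c ℕ.+_) (sum-const c xs)

  sum-mono : {f g : X → ℕ} (xs : List X) → (∀ x → f x ℕ.≤ g x) → sum (map f xs) ℕ.≤ sum (map g xs)
  sum-mono []       f≤g = z≤n
  sum-mono (x ∷ xs) f≤g = ℕ.+-mono-≤ (f≤g x) (sum-mono xs f≤g)

  -- A strict inequality in one term would leave a deficit that the other terms, each at most its
  -- partner, cannot make up.
  sum-tight : {f g : X → ℕ} (xs : List X) → (∀ x → f x ℕ.≤ g x) →
              sum (map f xs) ≡ sum (map g xs) → ∀ {x} → x ∈ xs → f x ≡ g x
  sum-tight {f} {g} (y ∷ xs) f≤g eq = λ
    { (here refl)  → fy≡gy
    ; (there x∈xs) → sum-tight xs f≤g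
        (ℕ.+-cancelˡ-≡ (f y) _ _ (trans eq (cong (ℕ._+ _) (sym fy≡gy)))) x∈xs }
    where
    fy≡gy : f y ≡ g y
    fy≡gy = ℕ.≤-antisym (f≤g y)
      (ℕ.+-cancelʳ-≤ _ _ _ (ℕ.≤-trans (ℕ.≤-reflexive (sym eq)) (ℕ.+-monoʳ-≤ (f y) (sum-mono xs f≤g))))

-- The Iverson bracket: cardinalities become sums, and double counting becomes an exchange of two
-- sums.
⟦_⟧ : ∀ {p} {P : Set p} → Dec P → ℕ
⟦ yes _ ⟧ = 1
⟦ no  _ ⟧ = 0

module _ {p} {P : Set p} where

  ⟦⟧-yes : (P? : Dec P) → P → ⟦ P? ⟧ ≡ 1
  ⟦⟧-yes (yes _) p = refl
  ⟦⟧-yes (no ¬p) p = contradiction p ¬p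

  ⟦⟧-no : (P? : Dec P) → ¬ P → ⟦ P? ⟧ ≡ 0
  ⟦⟧-no (yes p) ¬p = contradiction p ¬p
  ⟦⟧-no (no _)  ¬p = refl

  ⟦⟧≡1 : (P? : Dec P) → ⟦ P? ⟧ ≡ 1 → P
  ⟦⟧≡1 (yes p) _ = p

  ⟦⟧-cong : ∀ {q} {Q : Set q} (P? : Dec P) (Q? : Dec Q) → (P → Q) → (Q → P) → ⟦ P? ⟧ ≡ ⟦ Q? ⟧
  ⟦⟧-cong P? (yes q) f g = ⟦⟧-yes P? (g q)
  ⟦⟧-cong P? (no ¬q) f g = ⟦⟧-no P? (¬q ∘ f)

  ⟦⟧-× : ∀ {q} {Q : Set q} (P? : Dec P) (Q? : Dec Q) → ⟦ P? ×-dec Q? ⟧ ≡ ⟦ P? ⟧ ℕ.* ⟦ Q? ⟧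
  ⟦⟧-× (yes _) (yes _) = refl
  ⟦⟧-× (yes _) (no _)  = refl
  ⟦⟧-× (no _)  (yes _) = refl
  ⟦⟧-× (no _)  (no _)  = refl

  ⟦⟧-⊎ : ∀ {q} {Q : Set q} (P? : Dec P) (Q? : Dec Q) →
         ⟦ P? ⊎-dec Q? ⟧ ℕ.+ ⟦ P? ×-dec Q? ⟧ ≡ ⟦ P? ⟧ ℕ.+ ⟦ Q? ⟧
  ⟦⟧-⊎ (yes _) (yes _) = refl
  ⟦⟧-⊎ (yes _) (no _)  = refl
  ⟦⟧-⊎ (no _)  (yes _) = refl
  ⟦⟧-⊎ (no _)  (no _)  = refl

⟦⟧-≤ : ∀ {p q} {P : Set p} {Q : Set q} (P? : Dec P) (Q? : Dec Q) → (P → Q) → ⟦ P? ⟧ ℕ.≤ ⟦ Q? ⟧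
⟦⟧-≤ (yes p) Q? f = ℕ.≤-reflexive (sym (⟦⟧-yes Q? (f p)))
⟦⟧-≤ (no _)  Q? f = z≤n

module _ {X : Set} (E : Finite X) where

  open Finite E using (_≟_)

  ∑ : (X → ℕ) → ℕ
  ∑ f = sum (map f (elements E))

  # : ∀ {p} {P : Pred X p} → Decidable P → ℕ
  # P? = ∑ λ x → ⟦ P? x ⟧

  any? : ∀ {p} {P : Pred X p} → Decidable P → Dec (∃ P)
  any? P? with Any.any? P? (elements E)
  ... | yes p = yes (Any.satisfied p)
  ... | no ¬p = no λ (x , px) → ¬p (Any.map (λ { refl → px }) (complete E x))

  #-length : ∀ {p} {P : Pred X p} (P? : Decidable P) → # P? ≡ length (filter P? (elements E))
  #-length P? = go (elements E)
    where
    go : ∀ xs → sum (map (λ x → ⟦ P? x ⟧) xs) ≡ length (filter P? xs)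
    go []       = refl
    go (x ∷ xs) with P? x
    ... | yes _ = cong suc (go xs)
    ... | no  _ = go xs

  ∑-cong : {f g : X → ℕ} → (∀ x → f x ≡ g x) → ∑ f ≡ ∑ g
  ∑-cong = sum-cong (elements E)

  ∑-zero : {f : X → ℕ} → (∀ x → f x ≡ 0) → ∑ f ≡ 0
  ∑-zero f≡0 = trans (∑-cong f≡0) (trans (sum-const 0 (elements E)) (ℕ.*-zeroʳ (card E)))

  #-cong : ∀ {p q} {P : Pred X p} {Q : Pred X q} (P? : Decidable P) (Q? : Decidable Q) →
           (∀ x → P x → Q x) → (∀ x → Q x → P x) → # P? ≡ # Q?
  #-cong P? Q? f g = ∑-cong λ x → ⟦⟧-cong (P? x) (Q? x) (f x) (g x)

  #-empty : ∀ {p} {P : Pred X p} (P? : Decidable P) → (∀ x → ¬ P x) → # P? ≡ 0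
  #-empty P? ¬P = ∑-zero λ x → ⟦⟧-no (P? x) (¬P x)

  #-∃ : ∀ {p} {P : Pred X p} (P? : Decidable P) → # P? ≢ 0 → ∃ P
  #-∃ P? ≢0 with any? P?
  ... | yes p = p
  ... | no ¬p = contradiction (#-empty P? (λ x px → ¬p (x , px))) ≢0

  ∑-δ : (g : X → ℕ) (a : X) → ∑ (λ x → ⟦ a ≟ x ⟧ ℕ.* g x) ≡ g a
  ∑-δ g a = go (elements E) (unique E) (complete E a)
    where
    δ : X → ℕ
    δ x = ⟦ a ≟ x ⟧ ℕ.* g x

    absent : ∀ xs → All (a ≢_) xs → sum (map δ xs) ≡ 0
    absent []       []           = refl
    absent (x ∷ xs) (a≢x ∷ a∉xs) rewrite ⟦⟧-no (a ≟ x) a≢x = absent xs a∉xs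

    go : ∀ xs → Unique xs → a ∈ xs → sum (map δ xs) ≡ g a
    go (x ∷ xs) (x∉xs ∷ _) (here refl) rewrite ⟦⟧-yes (a ≟ a) refl | absent xs x∉xs =
      trans (ℕ.+-identityʳ _) (ℕ.+-identityʳ _)
    go (x ∷ xs) (x∉xs ∷ xs!) (there a∈xs)
      rewrite ⟦⟧-no (a ≟ x) (λ a≡x → All.lookup x∉xs a∈xs (sym a≡x)) = go xs xs! a∈xs

  #-unique : ∀ {p} {P : Pred X p} (P? : Decidable P) {a} → P a → (∀ x → P x → a ≡ x) → # P? ≡ 1
  #-unique P? {a} pa P⇒≡ = trans
    (∑-cong λ x → trans (⟦⟧-cong (P? x) (a ≟ x) (P⇒≡ x) (λ { refl → pa })) (sym (ℕ.*-identityʳ _)))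
    (∑-δ (λ _ → 1) a)

  #≡ : ∀ a → # (a ≟_) ≡ 1
  #≡ a = #-unique (a ≟_) refl (λ _ → id)

  module _ (f g : X → ℕ) where

    ∑-+ : ∑ (λ x → f x ℕ.+ g x) ≡ ∑ f ℕ.+ ∑ g
    ∑-+ = sum-+ f g (elements E)

    ∑-tight : (∀ x → f x ℕ.≤ g x) → ∑ f ≡ ∑ g → ∀ x → f x ≡ g x
    ∑-tight f≤g eq x = sum-tight (elements E) f≤g eq (complete E x)

  ∑-≤ : {f g : X → ℕ} → (∀ x → f x ℕ.≤ g x) → ∑ f ℕ.≤ ∑ g
  ∑-≤ = sum-mono (elements E)

  ∑-* : (c : ℕ) (f : X → ℕ) → ∑ (λ x → c ℕ.* f x) ≡ c ℕ.* ∑ f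
  ∑-* c f = sum-* c f (elements E)

  ∑-const : (c : ℕ) → ∑ (λ _ → c) ≡ card E ℕ.* c
  ∑-const c = sum-const c (elements E)

  #-⊎ : ∀ {p q} {P : Pred X p} {Q : Pred X q} (P? : Decidable P) (Q? : Decidable Q) →
        # (λ x → P? x ⊎-dec Q? x) ℕ.+ # (λ x → P? x ×-dec Q? x) ≡ # P? ℕ.+ # Q?
  #-⊎ P? Q? = trans (sym (∑-+ _ _)) (trans (∑-cong λ x → ⟦⟧-⊎ (P? x) (Q? x)) (∑-+ _ _))

  -- Indicators with one below the other and equal totals agree everywhere. This reverses an
  -- inclusion when only the sizes are known.
  #-⊆ : ∀ {p q} {P : Pred X p} {Q : Pred X q} (P? : Decidable P) (Q? : Decidable Q) →
        (∀ x → P x → Q x) → # P? ≡ # Q? → ∀ x → Q x → P x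
  #-⊆ P? Q? P⇒Q eq x qx = ⟦⟧≡1 (P? x)
    (trans (∑-tight _ _ (λ y → ⟦⟧-≤ (P? y) (Q? y) (P⇒Q y)) eq x) (⟦⟧-yes (Q? x) qx))

  -- The passage from counting in a finite type to `HasCardinality` in a setoid. Since `subsetoid`
  -- ignores witnesses, the preimage may be chosen from any witness; injectivity of `f` on `P` makes
  -- the choice respect `_≈_`.
  #-hasCardinality :
    ∀ {c ℓ p r} {P : Pred X p} (P? : Decidable P)
    (S : Setoid c ℓ) (let open Setoid S using (Carrier; _≈_)) (R : Carrier → Set r) (f : X → Carrier) →
    (∀ x → P x → R (f x)) →
    (∀ x y → P x → P y → f x ≈ f y → x ≡ y) →
    (∀ s → R s → ∃ λ x → P x × s ≈ f x) →
    HasCardinality (subsetoid S R) (# P?)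
  #-hasCardinality {P = P} P? S R f P⇒R injective surjective =
    subst (HasCardinality (subsetoid S R)) (sym (#-length P?)) record
      { to        = to
      ; from      = from
      ; to-cong   = λ { refl → refl-≈ }
      ; from-cong = λ {s} {t} s≈t → lookup-injective _ _ (injective _ _ (holds (from s)) (holds (from t))
                      (trans-≈ (sym-≈ (from-spec s)) (trans-≈ s≈t (from-spec t))))
      ; inverse   = (λ {s} {i} → λ { refl → sym-≈ (from-spec s) })
                  , (λ {i} {s} s≈ → lookup-injective _ _ (injective _ _ (holds (from s)) (holds i)
                      (trans-≈ (sym-≈ (from-spec s)) s≈)))
      }
    where
    open Setoid S using (Carrier; _≈_) renaming (refl to refl-≈; sym to sym-≈; trans to trans-≈)

    xs : List X
    xs = filter P? (elements E)

    holds : ∀ i → P (lookup xs i)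
    holds i = All.lookup (All.all-filter P? (elements E)) (∈-lookup i)

    lookup-injective : ∀ i j → lookup xs i ≡ lookup xs j → i ≡ j
    lookup-injective i j = go (Unique.filter⁺ P? (unique E)) i j
      where
      go : ∀ {ys : List X} → Unique ys → ∀ i j → lookup ys i ≡ lookup ys j → i ≡ j
      go (_ ∷ _)     Fin.zero    Fin.zero    _  = refl
      go (y∉ys ∷ _)  Fin.zero    (Fin.suc j) eq = contradiction eq (All.lookup y∉ys (∈-lookup j))
      go (y∉ys ∷ _)  (Fin.suc i) Fin.zero    eq = contradiction (sym eq) (All.lookup y∉ys (∈-lookup i))
      go (_ ∷ ys!)   (Fin.suc i) (Fin.suc j) eq = cong Fin.suc (go ys! i j eq)

    to : Fin (length xs) → Σ Carrier R
    to i = f (lookup xs i) , P⇒R _ (holds i)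

    from : Σ Carrier R → Fin (length xs)
    from (s , rs) = Any.index (∈-filter⁺ P? (complete E (proj₁ (surjective s rs))) (proj₁ (proj₂ (surjective s rs))))

    from-spec : ∀ s → proj₁ s ≈ f (lookup xs (from s))
    from-spec (s , rs) with surjective s rs
    ... | x , px , s≈fx = subst (λ z → s ≈ f z) (lookup-index (∈-filter⁺ P? (complete E x) px)) s≈fx

∑-comm : ∀ {X Y : Set} (E : Finite X) (D : Finite Y) (f : X → Y → ℕ) →
         ∑ E (λ x → ∑ D (f x)) ≡ ∑ D (λ y → ∑ E λ x → f x y)
∑-comm E D f = go (elements E)
  where
  go : ∀ xs → sum (map (λ x → ∑ D (f x)) xs) ≡ ∑ D (λ y → sum (map (λ x → f x y) xs))
  go []       = sym (∑-zero D λ _ → refl)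
  go (x ∷ xs) = trans (cong (∑ D (f x) ℕ.+_) (go xs)) (sym (∑-+ D (f x) _))

-- Each `g (f x)` is spread over `Y` by the indicator of `f x ≡ y`; after the exchange of sums every
-- `y` is met by exactly one `x`.
∑-reindex : ∀ {X Y : Set} (E : Finite X) (D : Finite Y) (f : X → Y) (f⁻¹ : Y → X) →
            (∀ y → f (f⁻¹ y) ≡ y) → (∀ x → f⁻¹ (f x) ≡ x) →
            (g : Y → ℕ) → ∑ E (g ∘ f) ≡ ∑ D g
∑-reindex E D f f⁻¹ ff⁻¹ f⁻¹f g = begin
  ∑ E (λ x → g (f x))                           ≡⟨ ∑-cong E (λ x → ∑-δ D g (f x)) ⟨
  ∑ E (λ x → ∑ D (λ y → ⟦ f x ≟ y ⟧ ℕ.* g y))     ≡⟨ ∑-comm E D _ ⟩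
  ∑ D (λ y → ∑ E (λ x → ⟦ f x ≟ y ⟧ ℕ.* g y))     ≡⟨ ∑-cong D (λ y → trans (∑-cong E λ x → ℕ.*-comm _ (g y)) (∑-* E (g y) _)) ⟩
  ∑ D (λ y → g y ℕ.* # E (λ x → f x ≟ y))         ≡⟨ ∑-cong D (λ y → cong (g y ℕ.*_) (#-unique E (λ x → f x ≟ y) (ff⁻¹ y)
                                                     λ { x refl → f⁻¹f x })) ⟩
  ∑ D (λ y → g y ℕ.* 1)                           ≡⟨ ∑-cong D (λ y → ℕ.*-identityʳ (g y)) ⟩
  ∑ D g                                         ∎
  where
  open ≡-Reasoning
  open Finite D using (_≟_)

hasCardinality-unique : ∀ {c ℓ} (S : Setoid c ℓ) {m n} → HasCardinality S m → HasCardinality S n → m ≡ n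
hasCardinality-unique S Fm≃S Fn≃S = ↔⇒≡ (Composition.inverse Fm≃S (Symmetry.inverse Fn≃S))

finiteFin : ∀ n → Finite (Fin n)
finiteFin n = record
  { elements = allFin n
  ; unique   = Unique.allFin⁺ n
  ; complete = ∈-allFin
  ; _≟_      = Fin._≟_
  }

module _ {X : Set} (E : Finite X) where

  open Finite E using (_≟_)

  -- Counting the pairs `(x , f x)` by either entry shows that the image has as many elements as
  -- `X`.
  injective⇒surjective : (f : X → X) → (∀ x y → f x ≡ f y → x ≡ y) → ∀ y → ∃ λ x → f x ≡ y
  injective⇒surjective f injective y = #-⊆ E image? (λ _ → yes tt) _ #image≡card y tt
    where
    image? : Decidable (λ y → ∃ λ x → f x ≡ y)
    image? y = any? E λ x → f x ≟ y

    fibre : ∀ y → ⟦ image? y ⟧ ≡ # E (λ x → f x ≟ y)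
    fibre y with image? y
    ... | yes (x , refl) = sym (#-unique E _ refl λ x′ eq → injective x x′ (sym eq))
    ... | no  ¬image     = sym (#-empty E _ λ x eq → ¬image (x , eq))

    #image≡card : # E image? ≡ # E (λ _ → yes tt)
    #image≡card = begin
      # E image?                               ≡⟨ ∑-cong E fibre ⟩
      ∑ E (λ y → ∑ E λ x → ⟦ f x ≟ y ⟧)        ≡⟨ ∑-comm E E _ ⟩
      ∑ E (λ x → ∑ E λ y → ⟦ f x ≟ y ⟧)        ≡⟨ ∑-cong E (λ x → #≡ E (f x)) ⟩
      ∑ E (λ x → 1)                            ∎
      where open ≡-Reasoning

module _ {X : Set} (E : Finite X) where

  open Finite E using (_≟_)

  #-two : ∀ {p} {P : Pred X p} (P? : Decidable P) {a b} → a ≢ b → P a → P b →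
          (∀ x → P x → a ≡ x ⊎ b ≡ x) → # E P? ≡ 2
  #-two P? {a} {b} a≢b pa pb P⇒ = begin
    # E P?                                             ≡⟨ #-cong E P? (λ x → (a ≟ x) ⊎-dec (b ≟ x)) P⇒
                                                            (λ { x (inj₁ refl) → pa ; x (inj₂ refl) → pb }) ⟩
    # E (λ x → (a ≟ x) ⊎-dec (b ≟ x))                  ≡⟨ ℕ.+-identityʳ _ ⟨
    # E (λ x → (a ≟ x) ⊎-dec (b ≟ x)) ℕ.+ 0            ≡⟨ cong (# E (λ x → (a ≟ x) ⊎-dec (b ≟ x)) ℕ.+_)
                                                            (#-empty E _ λ { x (refl , b≡a) → a≢b (sym b≡a) }) ⟨
    _                                                  ≡⟨ #-⊎ E (a ≟_) (b ≟_) ⟩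
    # E (a ≟_) ℕ.+ # E (b ≟_)                          ≡⟨ cong₂ ℕ._+_ (#≡ E a) (#≡ E b) ⟩
    2                                                  ∎
    where open ≡-Reasoning

  #-two⁻ : ∀ {p} {P : Pred X p} (P? : Decidable P) → # E P? ≡ 2 → ∃₂ λ x y → x ≢ y × P x × P y
  #-two⁻ P? ≡2 = let
      x , px = #-∃ E P? (λ ≡0 → contradiction (trans (sym ≡2) ≡0) λ ())
    in case any? E (λ y → ¬? (x ≟ y) ×-dec P? y) of λ
      { (yes (y , x≢y , py)) → x , y , x≢y , px , py
      ; (no ¬∃) → contradiction (trans (sym ≡2) (#-unique E P? px λ y py → case x ≟ y of λ
          { (yes x≡y) → x≡y ; (no x≢y) → contradiction (y , x≢y , py) ¬∃ })) λ () }

finiteMaybe : ∀ {X} → Finite X → Finite (Maybe X)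
finiteMaybe E = record
  { elements = nothing ∷ map just E.elements
  ; unique   = All.map⁺ (All.universal (λ _ ()) _) ∷ Unique.map⁺ Maybe.just-injective E.unique
  ; complete = λ { nothing → here refl ; (just x) → there (∈-map⁺ just (E.complete x)) }
  ; _≟_      = Maybe.≡-dec E._≟_
  }
  where module E = Finite E

finite× : ∀ {X Y} → Finite X → Finite Y → Finite (X × Y)
finite× E D = record
  { elements = cartesianProduct E.elements D.elements
  ; unique   = Unique.cartesianProduct⁺ E.unique D.unique
  ; complete = λ (x , y) → ∈-cartesianProduct⁺ (E.complete x) (D.complete y)
  ; _≟_      = Product.≡-dec E._≟_ D._≟_
  }
  where
  module E = Finite E
  module D = Finite D

∑-Maybe : ∀ {X} (E : Finite X) (f : Maybe X → ℕ) → ∑ (finiteMaybe E) f ≡ f nothing ℕ.+ ∑ E (f ∘ just)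
∑-Maybe E f = cong (λ xs → f nothing ℕ.+ sum xs) (sym (map-∘ (Finite.elements E)))

module _ {X Y : Set} (E : Finite X) (D : Finite Y) where

  ∑-× : (f : X × Y → ℕ) → ∑ (finite× E D) f ≡ ∑ E (λ x → ∑ D λ y → f (x , y))
  ∑-× f = go (Finite.elements E)
    where
    ys = Finite.elements D
    go : ∀ xs → sum (map f (cartesianProduct xs ys)) ≡ sum (map (λ x → sum (map (λ y → f (x , y)) ys)) xs)
    go []       = refl
    go (x ∷ xs) = trans (cong sum (map-++ f (map (x ,_) ys) _))
      (trans (sum-++ (map f (map (x ,_) ys)) _)
        (cong₂ ℕ._+_ (cong sum (sym (map-∘ ys))) (go xs)))

  ∑-*-# : ∀ {p r} {P : Pred X p} {R : X → Pred Y r} (P? : Decidable P) (R? : ∀ x → Decidable (R x)) →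
          ∑ E (λ x → ⟦ P? x ⟧ ℕ.* # D (R? x)) ≡ ∑ D (λ y → # E λ x → P? x ×-dec R? x y)
  ∑-*-# P? R? = trans
    (∑-cong E λ x → trans (sym (∑-* D ⟦ P? x ⟧ _)) (∑-cong D λ y → sym (⟦⟧-× (P? x) (R? x y))))
    (∑-comm E D _)

module _ {X : Set} (E : Finite X) where

  #-⊎-disjoint : ∀ {p q} {P : Pred X p} {Q : Pred X q} (P? : Decidable P) (Q? : Decidable Q) →
                 (∀ x → P x → ¬ Q x) → # E (λ x → P? x ⊎-dec Q? x) ≡ # E P? ℕ.+ # E Q?
  #-⊎-disjoint P? Q? disjoint = trans (sym (ℕ.+-identityʳ _)) (trans
    (cong (# E (λ x → P? x ⊎-dec Q? x) ℕ.+_) (sym (#-empty E _ λ x (px , qx) → disjoint x px qx)))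
    (#-⊎ E P? Q?))

  #-≤ : ∀ {p q} {P : Pred X p} {Q : Pred X q} (P? : Decidable P) (Q? : Decidable Q) →
        (∀ x → P x → Q x) → # E P? ℕ.≤ # E Q?
  #-≤ P? Q? P⇒Q = ∑-≤ E λ x → ⟦⟧-≤ (P? x) (Q? x) (P⇒Q x)

-- Finite fields of characteristic 2

-- With coefficients in 𝔽₂ = (Bool, xor, ∧) the solver knows that x + x = 0.
module Characteristic2 {c ℓ} (R : CommutativeRing c ℓ)
  (x+x≈0 : ∀ x → CommutativeRing._≈_ R (CommutativeRing._+_ R x x) (CommutativeRing.0# R)) where

  open CommutativeRing R

  private
    𝔽₂ : RawRing 0ℓ 0ℓ
    𝔽₂ = record { Carrier = Bool ; _≈_ = _≡_ ; _+_ = _xor_ ; _*_ = _∧_ ; -_ = id ; 0# = false ; 1# = true }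

    ⟦_⟧₂ : Bool → Carrier
    ⟦ false ⟧₂ = 0#
    ⟦ true  ⟧₂ = 1#

    morphism : 𝔽₂ -Raw-AlmostCommutative⟶ fromCommutativeSemiring commutativeSemiring
    morphism = record
      { ⟦_⟧    = ⟦_⟧₂
      ; +-homo = λ { false false → Eq.sym (+-identityˡ 0#)
                   ; false true  → Eq.sym (+-identityˡ 1#)
                   ; true  false → Eq.sym (+-identityʳ 1#)
                   ; true  true  → Eq.sym (x+x≈0 1#) }
      ; *-homo = λ { false y     → Eq.sym (zeroˡ ⟦ y ⟧₂)
                   ; true  y     → Eq.sym (*-identityˡ ⟦ y ⟧₂) }
      ; -‿homo = λ _ → Eq.refl
      ; 0-homo = Eq.refl
      ; 1-homo = Eq.refl
      }
      where
      module Eq = CommutativeRing R using (refl; sym)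

    coefficient≟ : ∀ x y → Maybe (⟦ x ⟧₂ ≈ ⟦ y ⟧₂)
    coefficient≟ false false = just (CommutativeRing.refl R)
    coefficient≟ true  true  = just (CommutativeRing.refl R)
    coefficient≟ _     _     = nothing

  open Algebra.Solver.Ring 𝔽₂ (fromCommutativeSemiring commutativeSemiring) morphism coefficient≟ public
    using (solve; _:+_; _:*_; _:=_; con)

  x+y≈0⇒x≈y : ∀ {x y} → x + y ≈ 0# → x ≈ y
  x+y≈0⇒x≈y {x} {y} x+y≈0 = begin
    x            ≈⟨ solve 2 (λ x y → x := x :+ y :+ y) (CommutativeRing.refl R) x y ⟩
    x + y + y    ≈⟨ +-congʳ x+y≈0 ⟩
    0# + y       ≈⟨ +-identityˡ y ⟩
    y            ∎
    where open SetoidReasoning (CommutativeRing.setoid R)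

module IntegralDomain {K : Set} {add mul : Op₂ K} {neg : Op₁ K} {0# 1# : K}
  (isCommutativeRing : IsCommutativeRing _≡_ add mul neg 0# 1#)
  (inverse : ∀ x → x ≢ 0# → ∃ λ y → mul y x ≡ 1#)
  where

  ring : CommutativeRing 0ℓ 0ℓ
  ring = record { isCommutativeRing = isCommutativeRing }

  open CommutativeRing ring using (_*_; *-assoc; *-comm; *-identityˡ; *-identityʳ; zeroʳ; zeroˡ)

  *-cancelˡ : ∀ {x y z} → x ≢ 0# → x * y ≡ x * z → y ≡ z
  *-cancelˡ {x} {y} {z} x≢0 xy≡xz with inverse x x≢0
  ... | x⁻¹ , x⁻¹x≡1 = begin
    y               ≡⟨ *-identityˡ y ⟨
    1# * y         ≡⟨ cong (_* y) x⁻¹x≡1 ⟨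
    x⁻¹ * x * y   ≡⟨ *-assoc x⁻¹ x y ⟩
    x⁻¹ * (x * y) ≡⟨ cong (x⁻¹ *_) xy≡xz ⟩
    x⁻¹ * (x * z) ≡⟨ *-assoc x⁻¹ x z ⟨
    x⁻¹ * x * z   ≡⟨ cong (_* z) x⁻¹x≡1 ⟩
    1# * z         ≡⟨ *-identityˡ z ⟩
    z               ∎
    where open ≡-Reasoning

  x*y≡0⇒y≡0 : ∀ {x y} → x ≢ 0# → x * y ≡ 0# → y ≡ 0#
  x*y≡0⇒y≡0 {x} x≢0 xy≡0 = *-cancelˡ x≢0 (trans xy≡0 (sym (zeroʳ x)))

  x*y≢0 : ∀ {x y} → x ≢ 0# → y ≢ 0# → x * y ≢ 0#
  x*y≢0 x≢0 y≢0 = y≢0 ∘ x*y≡0⇒y≡0 x≢0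

module FiniteField {q : ℕ} {add mul : Op₂ (Fin q)} {neg : Op₁ (Fin q)} {0# 1# : Fin q}
  (isCommutativeRing : IsCommutativeRing _≡_ add mul neg 0# 1#)
  (1≢0 : 1# ≢ 0#)
  (inverse : ∀ x → x ≢ 0# → ∃ λ y → mul y x ≡ 1#)
  where

  private
    K = Fin q

  open IntegralDomain isCommutativeRing inverse
  open CommutativeRing ring hiding (0#; 1#; isCommutativeRing; sym; trans; refl; Carrier; ring; zero)
  open Exp commutativeSemiring
  open SemiringMult semiring using (×1-homo-*) renaming (_×_ to _⋆_)
  module +Sum = CommutativeMonoidSum +-commutativeMonoid
  module *Sum = CommutativeMonoidSum *-commutativeMonoid

  private
    ∏ : ∀ {n} → (Fin n → K) → K
    ∏ = *Sum.sum

    ∏-nonzero : ∀ {n} (f : Fin n → K) → (∀ i → f i ≢ 0#) → ∏ f ≢ 0#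
    ∏-nonzero {ℕ.zero}  f f≢0 = 1≢0
    ∏-nonzero {ℕ.suc n} f f≢0 = x*y≢0 (f≢0 Fin.zero) (∏-nonzero (f ∘ Fin.suc) (f≢0 ∘ Fin.suc))

    ∏-one : ∀ {n} (f : Fin n → K) → (∀ i → f i ≡ 1#) → ∏ f ≡ 1#
    ∏-one {ℕ.zero}  f f≡1 = refl
    ∏-one {ℕ.suc n} f f≡1 = trans (cong₂ _*_ (f≡1 Fin.zero) (∏-one (f ∘ Fin.suc) (f≡1 ∘ Fin.suc))) (*-identityˡ 1#)

    ∏-single : ∀ {n} (f : Fin n → K) i → (∀ j → i ≢ j → f j ≡ 1#) → ∏ f ≡ f i
    ∏-single f Fin.zero    f≡1 = trans (cong (f Fin.zero *_) (∏-one (f ∘ Fin.suc) λ j → f≡1 (Fin.suc j) λ ())) (*-identityʳ _)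
    ∏-single f (Fin.suc i) f≡1 = trans (cong₂ _*_ (f≡1 Fin.zero λ ()) (∏-single (f ∘ Fin.suc) i λ j i≢j → f≡1 (Fin.suc j) (i≢j ∘ Fin.suc-injective)))
                               (*-identityˡ _)

    -- Products over the nonzero elements are taken over all of `Fin q`, with the factor at 0
    -- replaced by 1.
    if0 : K → K → K → K
    if0 t x y with t Fin.≟ 0#
    ... | yes _ = x
    ... | no _  = y

    if0-yes : ∀ x y → if0 0# x y ≡ x
    if0-yes x y with 0# Fin.≟ 0#
    ... | yes _   = refl
    ... | no 0≢0  = contradiction refl 0≢0

    if0-no : ∀ {t} x y → t ≢ 0# → if0 t x y ≡ y
    if0-no {t} x y t≢0 with t Fin.≟ 0#
    ... | yes t≡0 = contradiction t≡0 t≢0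
    ... | no _    = refl

  -- Translation by 1 permutes the field, so the sum of all elements equals itself plus `q` ones.
  q⋆1≡0 : q ⋆ 1# ≡ 0#
  q⋆1≡0 = +-cancelˡ (+Sum.sum id) _ _ (begin
    +Sum.sum {q} id + (q ⋆ 1#)              ≡⟨ cong (+Sum.sum {q} id +_) (+Sum.sum-replicate q) ⟨
    +Sum.sum {q} id + +Sum.sum {q} (λ _ → 1#)  ≡⟨ +Sum.∑-distrib-+ {q} id (λ _ → 1#) ⟨
    +Sum.sum {q} (λ i → i + 1#)             ≡⟨ +Sum.sum-permute id translation ⟨
    +Sum.sum {q} id                         ≡⟨ +-identityʳ _ ⟨
    +Sum.sum {q} id + 0#                    ∎)
    where
    open ≡-Reasoning
    open RingProperties (CommutativeRing.ring ring) using (+-cancelˡ)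
    translation = permutation (_+ 1#) (_+ (- 1#))
      (λ x → trans (+-assoc x _ _) (trans (cong (x +_) (-‿inverseˡ 1#)) (+-identityʳ x)))
      (λ x → trans (+-assoc x _ _) (trans (cong (x +_) (-‿inverseʳ 1#)) (+-identityʳ x)))

  -- Of the `q` equal factors, the one at index 0 supplies `x`. The others multiply to 1, because
  -- multiplication by `x` permutes the nonzero elements and so preserves their product.
  x^q≡x : ∀ x → x ^ q ≡ x
  x^q≡x x with x Fin.≟ 0#
  ... | yes refl = 0^q q (λ q≡0 → Fin.¬Fin0 (subst Fin q≡0 0#))
    where
    0^q : ∀ m → (m ≢ 0) → 0# ^ m ≡ 0#
    0^q ℕ.zero    m≢0 = contradiction refl m≢0
    0^q (ℕ.suc m) _   = zeroˡ _
  ... | no x≢0 = begin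
    x ^ q                               ≡⟨ *Sum.sum-replicate q ⟨
    ∏ {q} (λ _ → x)                     ≡⟨ *Sum.sum-cong-≗ split ⟩
    ∏ {q} (λ i → if0 i 1# x * if0 i x 1#)   ≡⟨ *Sum.∑-distrib-+ {q} _ _ ⟩
    ∏ {q} (λ i → if0 i 1# x) * ∏ {q} (λ i → if0 i x 1#)  ≡⟨ cong₂ _*_ units
                                              (trans (∏-single _ 0# (λ j 0≢j → if0-no x 1# (0≢j ∘ sym))) (if0-yes x 1#)) ⟩
    1# * x                              ≡⟨ *-identityˡ x ⟩
    x                                   ∎
    where
    open ≡-Reasoning
    split : ∀ i → x ≡ if0 i 1# x * if0 i x 1#
    split i with i Fin.≟ 0#
    ... | yes _ = sym (*-identityˡ x)
    ... | no _  = sym (*-identityʳ x)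

    u : K → K
    u i = if0 i 1# i

    u≢0 : ∀ i → u i ≢ 0#
    u≢0 i with i Fin.≟ 0#
    ... | yes _  = 1≢0
    ... | no i≢0 = i≢0

    u-* : ∀ i → u (x * i) ≡ if0 i 1# x * u i
    u-* i with i Fin.≟ 0#
    ... | yes refl = trans (cong u (zeroʳ x)) (trans (if0-yes 1# 0#) (sym (*-identityˡ 1#)))
    ... | no i≢0   = if0-no 1# (x * i) (x*y≢0 x≢0 i≢0)

    scaling = λ y yx≡1 xy≡1 → permutation (x *_) (y *_)
      (λ i → trans (sym (*-assoc x y i)) (trans (cong (_* i) xy≡1) (*-identityˡ i)))
      (λ i → trans (sym (*-assoc y x i)) (trans (cong (_* i) yx≡1) (*-identityˡ i)))

    units : ∏ {q} (λ i → if0 i 1# x) ≡ 1#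
    units with inverse x x≢0
    ... | y , yx≡1 = *-cancelˡ (∏-nonzero u u≢0) (begin
      ∏ u * ∏ {q} (λ i → if0 i 1# x)    ≡⟨ *-comm _ _ ⟩
      ∏ {q} (λ i → if0 i 1# x) * ∏ u    ≡⟨ *Sum.∑-distrib-+ {q} _ _ ⟨
      ∏ {q} (λ i → if0 i 1# x * u i)    ≡⟨ *Sum.sum-cong-≗ u-* ⟨
      ∏ {q} (λ i → u (x * i))           ≡⟨ *Sum.sum-permute u (scaling y yx≡1 (trans (*-comm x y) yx≡1)) ⟨
      ∏ u                               ≡⟨ *-identityʳ _ ⟨
      ∏ u * 1#                          ∎)

  module _ (n : ℕ) (q≡2^n : q ≡ 2 ℕ.^ n) where

    private
      2⋆1≡0 : ∀ n → (2 ℕ.^ n) ⋆ 1# ≡ 0# → 2 ⋆ 1# ≡ 0#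
      2⋆1≡0 ℕ.zero    eq = contradiction (trans (sym (+-identityʳ 1#)) eq) 1≢0
      2⋆1≡0 (ℕ.suc n) eq with (2 ⋆ 1#) Fin.≟ 0#
      ... | yes 2≡0 = 2≡0
      ... | no 2≢0  = 2⋆1≡0 n (x*y≡0⇒y≡0 2≢0 (trans (sym (×1-homo-* 2 (2 ℕ.^ n))) eq))

    x+x≡0 : ∀ x → x + x ≡ 0#
    x+x≡0 x = begin
      x + x             ≡⟨ cong₂ _+_ (*-identityʳ x) (*-identityʳ x) ⟨
      x * 1# + x * 1#   ≡⟨ distribˡ x 1# 1# ⟨
      x * (1# + 1#)     ≡⟨ cong (λ y → x * (1# + y)) (+-identityʳ 1#) ⟨
      x * (2 ⋆ 1#)      ≡⟨ cong (x *_) (2⋆1≡0 n (trans (cong (_⋆ 1#) (sym q≡2^n)) q⋆1≡0)) ⟩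
      x * 0#            ≡⟨ zeroʳ x ⟩
      0#                ∎
      where open ≡-Reasoning

    open Characteristic2 ring x+x≡0 renaming (x+y≈0⇒x≈y to x+y≡0⇒x≡y)

    frobenius-suc : ∀ x h → x ^ (2 ℕ.^ ℕ.suc h) ≡ x ^ (2 ℕ.^ h) * x ^ (2 ℕ.^ h)
    frobenius-suc x h = trans (^-homo-* x (2 ℕ.^ h) _)
      (cong (λ k → x ^ (2 ℕ.^ h) * x ^ k) (ℕ.+-identityʳ (2 ℕ.^ h)))

    frobenius-+ : ∀ h x y → (x + y) ^ (2 ℕ.^ h) ≡ x ^ (2 ℕ.^ h) + y ^ (2 ℕ.^ h)
    frobenius-+ ℕ.zero    x y = solve 3 (λ x y o → (x :+ y) :* o := x :* o :+ y :* o) refl x y 1#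
    frobenius-+ (ℕ.suc h) x y = begin
      (x + y) ^ (2 ℕ.^ ℕ.suc h)     ≡⟨ frobenius-suc (x + y) h ⟩
      (x + y) ^ σ * (x + y) ^ σ     ≡⟨ cong (λ z → z * z) (frobenius-+ h x y) ⟩
      (x ^ σ + y ^ σ) * (x ^ σ + y ^ σ)
        ≡⟨ solve 2 (λ x y → (x :+ y) :* (x :+ y) := x :* x :+ y :* y) refl (x ^ σ) (y ^ σ) ⟩
      x ^ σ * x ^ σ + y ^ σ * y ^ σ ≡⟨ cong₂ _+_ (frobenius-suc x h) (frobenius-suc y h) ⟨
      x ^ (2 ℕ.^ ℕ.suc h) + y ^ (2 ℕ.^ ℕ.suc h) ∎
      where
      open ≡-Reasoning
      σ = 2 ℕ.^ h

    frobenius-0 : ∀ h x → x ^ (2 ℕ.^ h) ≡ 0# → x ≡ 0#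
    frobenius-0 ℕ.zero    x eq = trans (sym (*-identityʳ x)) eq
    frobenius-0 (ℕ.suc h) x eq with x ^ (2 ℕ.^ h) Fin.≟ 0#
    ... | yes x^σ≡0 = frobenius-0 h x x^σ≡0
    ... | no x^σ≢0  = contradiction (trans (sym (frobenius-suc x h)) eq) (x*y≢0 x^σ≢0 x^σ≢0)

    -- An additive map with trivial kernel is injective, hence onto by finiteness.
    frobenius-surjective : ∀ h y → ∃ λ x → x ^ (2 ℕ.^ h) ≡ y
    frobenius-surjective h = injective⇒surjective (finiteFin q) (_^ (2 ℕ.^ h)) λ x y eq →
      x+y≡0⇒x≡y (frobenius-0 h (x + y) (trans (frobenius-+ h x y)
        (trans (cong (_+ y ^ (2 ℕ.^ h)) eq) (x+x≡0 _))))

    private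
      frobenius-compose : ∀ x a b → x ^ (2 ℕ.^ (a ℕ.+ b)) ≡ (x ^ (2 ℕ.^ a)) ^ (2 ℕ.^ b)
      frobenius-compose x a b = trans (cong (x ^_) (ℕ.^-distribˡ-+-* 2 a b)) (sym (^-assocʳ x (2 ℕ.^ a) (2 ℕ.^ b)))

      frobenius-multiple : ∀ x a k → x ^ (2 ℕ.^ a) ≡ x → x ^ (2 ℕ.^ (k ℕ.* a)) ≡ x
      frobenius-multiple x a ℕ.zero    eq = *-identityʳ x
      frobenius-multiple x a (ℕ.suc k) eq = trans (frobenius-compose x a (k ℕ.* a))
        (trans (cong (_^ (2 ℕ.^ (k ℕ.* a))) eq) (frobenius-multiple x a k eq))

      -- Raising to the power `2 ^ (k * a)` fixes `x ^ 2`; since `1 + k * a` equals `l * b`, the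
      -- result is also `x ^ (2 ^ (l * b))`, which is `x`.
      x²≡x : ∀ x a b → x ^ (2 ℕ.^ a) ≡ x → x ^ (2 ℕ.^ b) ≡ x → ∀ k l → 1 ℕ.+ k ℕ.* a ≡ l ℕ.* b → x * x ≡ x
      x²≡x x a b x^a x^b k l eq = begin
        x * x                               ≡⟨ cong (λ z → x * z) (*-identityʳ x) ⟨
        x ^ 2                               ≡⟨ frobenius-multiple (x ^ 2) a k x²^a ⟨
        (x ^ 2) ^ (2 ℕ.^ (k ℕ.* a))         ≡⟨ frobenius-compose x 1 (k ℕ.* a) ⟨
        x ^ (2 ℕ.^ (1 ℕ.+ k ℕ.* a))         ≡⟨ cong (λ m → x ^ (2 ℕ.^ m)) eq ⟩
        x ^ (2 ℕ.^ (l ℕ.* b))               ≡⟨ frobenius-multiple x b l x^b ⟩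
        x                                   ∎
        where
        open ≡-Reasoning
        x²^a : (x ^ 2) ^ (2 ℕ.^ a) ≡ x ^ 2
        x²^a = trans (^-assocʳ x 2 (2 ℕ.^ a)) (trans (cong (x ^_) (ℕ.*-comm 2 (2 ℕ.^ a)))
                 (trans (sym (^-assocʳ x (2 ℕ.^ a) 2)) (cong (_^ 2) x^a)))

    -- The exponents `2 ^ n` and `2 ^ h` both fix `x`, so Bézout coefficients of `n` and `h` give
    -- `x * x ≡ x`.
    frobenius-fixed : ∀ h → gcd n h ≡ 1 → ∀ x → x ^ (2 ℕ.^ h) ≡ x → x ≡ 0# ⊎ x ≡ 1#
    frobenius-fixed h gcd≡1 x x^σ≡x with x Fin.≟ 0#
    ... | yes x≡0 = inj₁ x≡0
    ... | no x≢0  = inj₂ (*-cancelˡ x≢0 (trans square (sym (*-identityʳ x))))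
      where
      x^2^n≡x : x ^ (2 ℕ.^ n) ≡ x
      x^2^n≡x = trans (cong (x ^_) (sym q≡2^n)) (x^q≡x x)

      square : x * x ≡ x
      square with Bézout.identity (gcd-GCD n h)
      ... | Bézout.+- k l eq = x²≡x x h n x^σ≡x x^2^n≡x l k (trans (cong (ℕ._+ l ℕ.* h) (sym gcd≡1)) eq)
      ... | Bézout.-+ k l eq = x²≡x x n h x^2^n≡x x^σ≡x k l (trans (cong (ℕ._+ k ℕ.* n) (sym gcd≡1)) eq)

-- The curve and its osculating planes

-- σ is the automorphism t ↦ t^(2^h), which fixes only 𝔽₂ when gcd(n, h) = 1.
record FieldWithAutomorphism : Set₁ where
  infixl 6 _+_
  infixl 7 _*_
  field
    K                 : Set
    finite            : Finite K
    _+_ _*_           : Op₂ K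
    neg               : Op₁ K
    0# 1#             : K
    isCommutativeRing : IsCommutativeRing _≡_ _+_ _*_ neg 0# 1#
    1≢0               : 1# ≢ 0#
    inverse           : ∀ x → x ≢ 0# → ∃ λ y → y * x ≡ 1#
    x+x≡0             : ∀ x → x + x ≡ 0#
    √                 : ∀ x → ∃ λ y → y * y ≡ x
    σ                 : K → K
    σ-+               : ∀ x y → σ (x + y) ≡ σ x + σ y
    σ-*               : ∀ x y → σ (x * y) ≡ σ x * σ y
    σ-1               : σ 1# ≡ 1#
    σ-surjective      : ∀ y → ∃ λ x → σ x ≡ y
    σ-fixed           : ∀ x → σ x ≡ x → x ≡ 0# ⊎ x ≡ 1#

module Geometry (S : FieldWithAutomorphism) where

  open FieldWithAutomorphism S public hiding (isCommutativeRing; inverse)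
  open FieldWithAutomorphism S using (isCommutativeRing; inverse)
  open IntegralDomain isCommutativeRing inverse public
  open CommutativeRing ring public using (+-identityˡ; +-identityʳ; +-comm; *-assoc; *-comm; *-identityˡ; *-identityʳ; zeroˡ; zeroʳ; distribˡ)
  open Characteristic2 ring x+x≡0 public renaming (x+y≈0⇒x≈y to x+y≡0⇒x≡y)
  open Finite finite public using () renaming (_≟_ to _≟ᴷ_)
  open ≡-Reasoning

  x≡y⇒x+y≡0 : ∀ {x y} → x ≡ y → x + y ≡ 0#
  x≡y⇒x+y≡0 {x} refl = x+x≡0 x

  x*y≡0 : ∀ {x y} → x * y ≡ 0# → x ≡ 0# ⊎ y ≡ 0#
  x*y≡0 {x} xy≡0 with x ≟ᴷ 0#
  ... | yes x≡0 = inj₁ x≡0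
  ... | no x≢0  = inj₂ (x*y≡0⇒y≡0 x≢0 xy≡0)

  *0 : ∀ x {y} → y ≡ 0# → x * y ≡ 0#
  *0 x refl = zeroʳ x

  abstract
    -- Total, with value 0 at 0, so that `φ` below is a self-map of all of `K` to which the
    -- pigeonhole argument applies.
    inv : K → K
    inv x with x ≟ᴷ 0#
    ... | yes _  = 0#
    ... | no x≢0 = proj₁ (inverse x x≢0)

    inv-0 : inv 0# ≡ 0#
    inv-0 with 0# ≟ᴷ 0#
    ... | yes _  = refl
    ... | no 0≢0 = contradiction refl 0≢0

    inv-* : ∀ {x} → x ≢ 0# → inv x * x ≡ 1#
    inv-* {x} x≢0 with x ≟ᴷ 0#
    ... | yes x≡0 = contradiction x≡0 x≢0
    ... | no x≢0  = proj₂ (inverse x x≢0)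

  inv≢0 : ∀ {x} → x ≢ 0# → inv x ≢ 0#
  inv≢0 {x} x≢0 x⁻¹≡0 = 1≢0 (trans (sym (inv-* x≢0)) (trans (cong (_* x) x⁻¹≡0) (zeroˡ x)))

  inv-inv : ∀ {x} → x ≢ 0# → inv (inv x) ≡ x
  inv-inv {x} x≢0 = *-cancelˡ (inv≢0 x≢0)
    (trans (*-comm (inv x) _) (trans (inv-* (inv≢0 x≢0)) (sym (inv-* x≢0))))

  inv-*-* : ∀ {x} y → x ≢ 0# → inv x * (x * y) ≡ y
  inv-*-* {x} y x≢0 = trans (sym (*-assoc (inv x) x y)) (trans (cong (_* y) (inv-* x≢0)) (*-identityˡ y))

  *-inv-* : ∀ {x} y → x ≢ 0# → x * (inv x * y) ≡ y
  *-inv-* {x} y x≢0 = trans (solve 3 (λ x z y → x :* (z :* y) := z :* (x :* y)) refl x (inv x) y) (inv-*-* y x≢0)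

  σ-0 : σ 0# ≡ 0#
  σ-0 = trans (cong σ (sym (x+x≡0 0#))) (trans (σ-+ 0# 0#) (x+x≡0 _))

  σ≢0 : ∀ {x} → x ≢ 0# → σ x ≢ 0#
  σ≢0 {x} x≢0 σx≡0 = 1≢0 (begin
    1#                   ≡⟨ σ-1 ⟨
    σ 1#                 ≡⟨ cong σ (inv-* x≢0) ⟨
    σ (inv x * x)        ≡⟨ σ-* (inv x) x ⟩
    σ (inv x) * σ x      ≡⟨ *0 _ σx≡0 ⟩
    0#                   ∎)

  σ-injective : ∀ {x y} → σ x ≡ σ y → x ≡ y
  σ-injective {x} {y} eq with (x + y) ≟ᴷ 0#
  ... | yes x+y≡0 = x+y≡0⇒x≡y x+y≡0
  ... | no x+y≢0  = contradiction (trans (σ-+ x y) (x≡y⇒x+y≡0 eq)) (σ≢0 x+y≢0)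

  private
    φ : K → K
    φ v = σ v * inv v

    φ≡ : ∀ {v e} → v ≢ 0# → φ v ≡ e → σ v ≡ e * v
    φ≡ {v} v≢0 refl = sym (begin
      σ v * inv v * v    ≡⟨ *-assoc (σ v) (inv v) v ⟩
      σ v * (inv v * v)  ≡⟨ cong (σ v *_) (inv-* v≢0) ⟩
      σ v * 1#           ≡⟨ *-identityʳ (σ v) ⟩
      σ v                ∎)

    φ-0 : φ 0# ≡ 0#
    φ-0 = *0 (σ 0#) inv-0

    φ≢0 : ∀ {v} → v ≢ 0# → φ v ≢ 0#
    φ≢0 v≢0 = x*y≢0 (σ≢0 v≢0) (inv≢0 v≢0)

    -- For nonzero arguments, equal quotients `σ v / v` and `σ w / w` make `v / w` a fixed element
    -- of `σ`, hence equal to 1.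
    φ-injective : ∀ v w → φ v ≡ φ w → v ≡ w
    φ-injective v w eq with v ≟ᴷ 0# | w ≟ᴷ 0#
    ... | yes refl | yes refl = refl
    ... | yes refl | no w≢0   = contradiction (trans (sym eq) φ-0) (φ≢0 w≢0)
    ... | no v≢0   | yes refl = contradiction (trans eq φ-0) (φ≢0 v≢0)
    ... | no v≢0   | no w≢0   = [ (λ w⁻¹v≡0 → contradiction w⁻¹v≡0 (x*y≢0 (inv≢0 w≢0) v≢0))
                                , (λ w⁻¹v≡1 → trans (sym (*-inv-* v w≢0)) (trans (cong (w *_) w⁻¹v≡1) (*-identityʳ w))) ]′
                                (σ-fixed (inv w * v) fixed)
      where
      fixed : σ (inv w * v) ≡ inv w * v
      fixed = *-cancelˡ (σ≢0 w≢0) (begin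
        σ w * σ (inv w * v)   ≡⟨ σ-* w _ ⟨
        σ (w * (inv w * v))   ≡⟨ cong σ (*-inv-* v w≢0) ⟩
        σ v                   ≡⟨ φ≡ v≢0 eq ⟩
        φ w * v               ≡⟨ *-assoc (σ w) (inv w) v ⟩
        σ w * (inv w * v)     ∎)

  affine : K → K → K → K → K
  affine g e k v = g * σ v + e * v + k

  -- v ↦ g σ(v) + e v is additive, and its kernel {0, w} has two elements
  -- because v ↦ σ(v) / v is a bijection of the nonzero elements.
  affine-roots : ∀ {g e} k → g ≢ 0# → e ≢ 0# →
                 let z = # finite (λ v → affine g e k v ≟ᴷ 0#) in z ≡ 0 ⊎ z ≡ 2
  affine-roots {g} {e} k g≢0 e≢0 with any? finite (λ v → affine g e k v ≟ᴷ 0#)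
  ... | no ¬root = inj₁ (#-empty finite _ λ v root → ¬root (v , root))
  -- `φ` takes the value `e / g` at some `w`, that is `g σ(w) = e w`; the two roots are then `v₀`
  -- and `v₀ + w`.
  ... | yes (v₀ , root₀) with injective⇒surjective finite φ φ-injective (inv g * e)
  ... | w , φw≡ = inj₂ (#-two finite _ v₀≢v₀+w root₀ root₁ roots)
    where
    w≢0 : w ≢ 0#
    w≢0 refl = x*y≢0 (inv≢0 g≢0) e≢0 (trans (sym φw≡) φ-0)

    gσw≡ew : g * σ w ≡ e * w
    gσw≡ew = begin
      g * σ w              ≡⟨ cong (g *_) (φ≡ w≢0 φw≡) ⟩
      g * (inv g * e * w)  ≡⟨ cong (g *_) (*-assoc (inv g) e w) ⟩
      g * (inv g * (e * w)) ≡⟨ *-inv-* (e * w) g≢0 ⟩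
      e * w                ∎

    kernel : ∀ v → g * σ v + e * v ≡ 0# → v ≡ 0# ⊎ v ≡ w
    kernel v eq with v ≟ᴷ 0#
    ... | yes v≡0 = inj₁ v≡0
    ... | no v≢0  = inj₂ (φ-injective v w (trans (begin
      σ v * inv v               ≡⟨ cong (_* inv v) (inv-*-* (σ v) g≢0) ⟨
      inv g * (g * σ v) * inv v ≡⟨ cong (λ x → inv g * x * inv v) (x+y≡0⇒x≡y eq) ⟩
      inv g * (e * v) * inv v   ≡⟨ solve 4 (λ a b c d → a :* (b :* c) :* d := d :* (c :* (a :* b))) refl (inv g) e v (inv v) ⟩
      inv v * (v * (inv g * e)) ≡⟨ inv-*-* (inv g * e) v≢0 ⟩
      inv g * e                 ∎) (sym φw≡)))

    v₀≢v₀+w : v₀ ≢ v₀ + w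
    v₀≢v₀+w eq = w≢0 (begin
      w             ≡⟨ solve 2 (λ v w → w := v :+ (v :+ w)) refl v₀ w ⟩
      v₀ + (v₀ + w) ≡⟨ x≡y⇒x+y≡0 eq ⟩
      0#            ∎)

    root₁ : affine g e k (v₀ + w) ≡ 0#
    root₁ = begin
      g * σ (v₀ + w) + e * (v₀ + w) + k    ≡⟨ cong (λ x → g * x + e * (v₀ + w) + k) (σ-+ v₀ w) ⟩
      g * (σ v₀ + σ w) + e * (v₀ + w) + k
        ≡⟨ solve 7 (λ g x y e v w k → g :* (x :+ y) :+ e :* (v :+ w) :+ k := (g :* x :+ e :* v :+ k) :+ (g :* y :+ e :* w))
             refl g (σ v₀) (σ w) e v₀ w k ⟩
      affine g e k v₀ + (g * σ w + e * w)  ≡⟨ cong₂ _+_ root₀ (x≡y⇒x+y≡0 gσw≡ew) ⟩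
      0# + 0#                              ≡⟨ x+x≡0 0# ⟩
      0#                                   ∎

    difference : ∀ v → affine g e k v ≡ 0# → g * σ (v₀ + v) + e * (v₀ + v) ≡ 0#
    difference v root = begin
      g * σ (v₀ + v) + e * (v₀ + v)        ≡⟨ cong (λ x → g * x + e * (v₀ + v)) (σ-+ v₀ v) ⟩
      g * (σ v₀ + σ v) + e * (v₀ + v)
        ≡⟨ solve 7 (λ g x y e v w k → g :* (x :+ y) :+ e :* (v :+ w) := (g :* x :+ e :* v :+ k) :+ (g :* y :+ e :* w :+ k))
             refl g (σ v₀) (σ v) e v₀ v k ⟩
      affine g e k v₀ + affine g e k v     ≡⟨ cong₂ _+_ root₀ root ⟩
      0# + 0#                              ≡⟨ x+x≡0 0# ⟩
      0#                                   ∎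

    roots : ∀ v → affine g e k v ≡ 0# → v₀ ≡ v ⊎ v₀ + w ≡ v
    roots v root = Sum.map x+y≡0⇒x≡y
      (λ v₀+v≡w → trans (cong (v₀ +_) (sym v₀+v≡w)) (solve 2 (λ v w → v :+ (v :+ w) := w) refl v₀ v))
      (kernel (v₀ + v) (difference v root))

  -- Coordinates, the form, the quadric and the parametrised curve

  V : Set
  V = K × K × K × K

  I : Set
  I = Maybe K

  finiteI : Finite I
  finiteI = finiteMaybe finite

  finiteV : Finite V
  finiteV = finite× finite (finite× finite (finite× finite finite))

  open Finite finiteI public using () renaming (_≟_ to _≟ᴵ_)
  open Finite finiteV public using () renaming (_≟_ to _≟ⱽ_)

  infixl 6 _⊕_
  infixr 7 _·_

  _⊕_ : V → V → V
  (a , b , c , d) ⊕ (a′ , b′ , c′ , d′) = a + a′ , b + b′ , c + c′ , d + d′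

  _·_ : K → V → V
  k · (a , b , c , d) = k * a , k * b , k * c , k * d

  𝟎 : V
  𝟎 = 0# , 0# , 0# , 0#

  β : V → V → K
  β (a , b , c , d) (a′ , b′ , c′ , d′) = a * d′ + b * c′ + c * b′ + d * a′

  Q : V → K
  Q (a , b , c , d) = a * d + b * c

  -- `nothing` is the parameter ∞, whose point is `U₄`; `σ t * t` is the coordinate
  -- `t ^ (2 ^ h + 1)`.
  A : I → V
  A nothing  = 0# , 0# , 0# , 1#
  A (just t) = 1# , t , σ t , σ t * t

  tuple≡ : ∀ {a b c d a′ b′ c′ d′ : K} → a ≡ a′ → b ≡ b′ → c ≡ c′ → d ≡ d′ →
           (a , b , c , d) ≡ (a′ , b′ , c′ , d′)
  tuple≡ refl refl refl refl = refl

  β-comm : ∀ x y → β x y ≡ β y x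
  β-comm (a , b , c , d) (a′ , b′ , c′ , d′) =
    solve 8 (λ a b c d a′ b′ c′ d′ → a :* d′ :+ b :* c′ :+ c :* b′ :+ d :* a′ := a′ :* d :+ b′ :* c :+ c′ :* b :+ d′ :* a)
      refl a b c d a′ b′ c′ d′

  β-self : ∀ x → β x x ≡ 0#
  β-self (a , b , c , d) = solve 4 (λ a b c d → a :* d :+ b :* c :+ c :* b :+ d :* a := con false) refl a b c d

  β-⊕ : ∀ u x y → β u (x ⊕ y) ≡ β u x + β u y
  β-⊕ (a , b , c , d) (x₁ , x₂ , x₃ , x₄) (y₁ , y₂ , y₃ , y₄) =
    solve 12 (λ a b c d x₁ x₂ x₃ x₄ y₁ y₂ y₃ y₄ →
        a :* (x₄ :+ y₄) :+ b :* (x₃ :+ y₃) :+ c :* (x₂ :+ y₂) :+ d :* (x₁ :+ y₁)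
        := (a :* x₄ :+ b :* x₃ :+ c :* x₂ :+ d :* x₁) :+ (a :* y₄ :+ b :* y₃ :+ c :* y₂ :+ d :* y₁))
      refl a b c d x₁ x₂ x₃ x₄ y₁ y₂ y₃ y₄

  β-· : ∀ u k x → β u (k · x) ≡ k * β u x
  β-· (a , b , c , d) k (x₁ , x₂ , x₃ , x₄) =
    solve 9 (λ a b c d k x₁ x₂ x₃ x₄ →
        a :* (k :* x₄) :+ b :* (k :* x₃) :+ c :* (k :* x₂) :+ d :* (k :* x₁)
        := k :* (a :* x₄ :+ b :* x₃ :+ c :* x₂ :+ d :* x₁))
      refl a b c d k x₁ x₂ x₃ x₄

  Q-⊕ : ∀ x y → Q (x ⊕ y) ≡ Q x + Q y + β x y
  Q-⊕ (a , b , c , d) (a′ , b′ , c′ , d′) =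
    solve 8 (λ a b c d a′ b′ c′ d′ → (a :+ a′) :* (d :+ d′) :+ (b :+ b′) :* (c :+ c′)
        := (a :* d :+ b :* c) :+ (a′ :* d′ :+ b′ :* c′) :+ (a :* d′ :+ b :* c′ :+ c :* b′ :+ d :* a′))
      refl a b c d a′ b′ c′ d′

  Q-· : ∀ k x → Q (k · x) ≡ k * k * Q x
  Q-· k (a , b , c , d) =
    solve 5 (λ k a b c d → (k :* a) :* (k :* d) :+ (k :* b) :* (k :* c) := k :* k :* (a :* d :+ b :* c)) refl k a b c d

  ·-assoc : ∀ k l x → k · l · x ≡ (k * l) · x
  ·-assoc k l (a , b , c , d) = sym (tuple≡ (*-assoc k l a) (*-assoc k l b) (*-assoc k l c) (*-assoc k l d))

  1· : ∀ x → 1# · x ≡ x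
  1· (a , b , c , d) = tuple≡ (*-identityˡ a) (*-identityˡ b) (*-identityˡ c) (*-identityˡ d)

  0· : ∀ x → 0# · x ≡ 𝟎
  0· (a , b , c , d) = tuple≡ (zeroˡ a) (zeroˡ b) (zeroˡ c) (zeroˡ d)

  ·𝟎 : ∀ k → k · 𝟎 ≡ 𝟎
  ·𝟎 k = tuple≡ (zeroʳ k) (zeroʳ k) (zeroʳ k) (zeroʳ k)

  inv-·-· : ∀ {k} x → k ≢ 0# → inv k · k · x ≡ x
  inv-·-· {k} x k≢0 = trans (·-assoc (inv k) k x) (trans (cong (_· x) (inv-* k≢0)) (1· x))

  ⊕-cancel : ∀ x y → x ⊕ y ⊕ y ≡ x
  ⊕-cancel (a , b , c , d) (a′ , b′ , c′ , d′) = tuple≡ (lemma a a′) (lemma b b′) (lemma c c′) (lemma d d′)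
    where
    lemma : ∀ x y → x + y + y ≡ x
    lemma = solve 2 (λ x y → x :+ y :+ y := x) refl

  ⊕-identityˡ : ∀ x → 𝟎 ⊕ x ≡ x
  ⊕-identityˡ (a , b , c , d) = tuple≡ (+-identityˡ a) (+-identityˡ b) (+-identityˡ c) (+-identityˡ d)

  x⊕y≡𝟎⇒x≡y : ∀ {x y} → x ⊕ y ≡ 𝟎 → x ≡ y
  x⊕y≡𝟎⇒x≡y {x} {y} eq = trans (sym (⊕-cancel x y)) (trans (cong (_⊕ y) eq) (⊕-identityˡ y))

  β-𝟎 : ∀ x → β x 𝟎 ≡ 0#
  β-𝟎 x = trans (cong (β x) (sym (0· 𝟎))) (trans (β-· x 0# 𝟎) (zeroˡ _))

  Q-A : ∀ i → Q (A i) ≡ 0#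
  Q-A nothing  = solve 1 (λ o → con false :* o :+ con false :* con false := con false) refl 1#
  Q-A (just t) = solve 2 (λ t s → con true :* (s :* t) :+ t :* s := con false) refl t (σ t)

  A≢𝟎 : ∀ i → A i ≢ 𝟎
  A≢𝟎 nothing  eq = 1≢0 (cong (λ (a , b , c , d) → d) eq)
  A≢𝟎 (just t) eq = 1≢0 (cong proj₁ eq)

  β-A∞ : ∀ y → β (A nothing) y ≡ proj₁ y
  β-A∞ (a , b , c , d) = solve 4 (λ a b c d → con false :* d :+ con false :* c :+ con false :* b :+ con true :* a := a) refl a b c d

  β-A : ∀ t (y : V) → let (a , b , c , d) = y in β (A (just t)) y ≡ a * (σ t * t) + b * σ t + c * t + d
  β-A t (a , b , c , d) =
    solve 6 (λ t s a b c d → con true :* d :+ t :* c :+ s :* b :+ (s :* t) :* a := a :* (s :* t) :+ b :* s :+ c :* t :+ d)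
      refl t (σ t) a b c d

  -- At finite parameters the value factors as `(t + u) (σ t + σ u)`, and it is 1 if exactly one
  -- parameter is ∞. Thus an osculating plane meets the curve in its own point alone.
  β-AA : ∀ i j → β (A i) (A j) ≡ 0# → i ≡ j
  β-AA nothing  nothing  _  = refl
  β-AA nothing  (just t) eq = contradiction (trans (sym (β-A∞ (A (just t)))) eq) 1≢0
  β-AA (just t) nothing  eq = contradiction (trans (sym (β-A∞ (A (just t)))) (trans (β-comm (A nothing) (A (just t))) eq)) 1≢0
  β-AA (just t) (just u) eq = cong just ([ x+y≡0⇒x≡y , (λ e → σ-injective (x+y≡0⇒x≡y e)) ]′ (x*y≡0 (trans (solve 4
    (λ t s u r → (t :+ u) :* (s :+ r) := con true :* (r :* u) :+ t :* r :+ s :* u :+ (s :* t) :* con true)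
    refl t (σ t) u (σ u)) eq)))

  β-A≢ : ∀ {i j} → i ≢ j → β (A i) (A j) ≢ 0#
  β-A≢ i≢j = i≢j ∘ β-AA _ _

  Root : V → I → Set
  Root y i = β (A i) y ≡ 0#

  root? : ∀ y i → Dec (Root y i)
  root? y i = β (A i) y ≟ᴷ 0#

  -- The number of osculating planes on y.
  z : V → ℕ
  z y = # finiteI (root? y)

  -- The scalar `c` may be 0, so this also says that `y` is nonzero.
  Off : V → Set
  Off y = ∀ i c → y ≢ c · A i

  off-or-on : ∀ y → Off y ⊎ ∃₂ λ i c → y ≡ c · A i
  off-or-on y with any? finiteI (λ i → any? finite (λ c → y ≟ⱽ (c · A i)))
  ... | yes (i , c , eq) = inj₂ (i , c , eq)
  ... | no ¬on           = inj₁ λ i c eq → ¬on (i , c , eq)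

  Off⇒≢𝟎 : ∀ {y} → Off y → y ≢ 𝟎
  Off⇒≢𝟎 off refl = off nothing 0# (sym (0· _))

  z-A : ∀ i → z (A i) ≡ 1
  z-A i = #-unique finiteI (root? (A i)) (β-self (A i)) λ j root → sym (β-AA j i root)

  root-· : ∀ {k} y i → k ≢ 0# → Root (k · y) i → Root y i
  root-· {k} y i k≢0 root = x*y≡0⇒y≡0 k≢0 (trans (sym (β-· (A i) k y)) root)

  z-· : ∀ {k} y → k ≢ 0# → z (k · y) ≡ z y
  z-· {k} y k≢0 = #-cong finiteI (root? (k · y)) (root? y) (λ i → root-· y i k≢0)
    (λ i root → trans (β-· (A i) k y) (*0 k root))

  -- If the first coordinate `a` is nonzero, `a` times the equation for `t` splits on the quadric as
  -- `(a t + b) (a σ(t) + c)`. Its two roots coincide only if `y` is a multiple of a curve vector.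
  z-quadric : ∀ {y} → Q y ≡ 0# → Off y → z y ≡ 2
  z-quadric {y@(a , b , c , d)} Qy≡0 off with a ≟ᴷ 0#
  ... | no a≢0 with σ-surjective (inv a * c)
  ...   | t₂ , σt₂≡ = #-two finiteI (root? y) t₁≢t₂ (root t₁ (inj₁ at₁≡b)) (root t₂ (inj₂ aσt₂≡c)) roots
    where
    t₁ : K
    t₁ = inv a * b

    at₁≡b : a * t₁ ≡ b
    at₁≡b = *-inv-* b a≢0

    aσt₂≡c : a * σ t₂ ≡ c
    aσt₂≡c = trans (cong (a *_) σt₂≡) (*-inv-* c a≢0)

    factor : ∀ t → a * β (A (just t)) y ≡ (a * t + b) * (a * σ t + c)
    factor t = begin
      a * β (A (just t)) y                          ≡⟨ cong (a *_) (β-A t y) ⟩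
      a * (a * (σ t * t) + b * σ t + c * t + d)
        ≡⟨ solve 6 (λ a b c d t s → a :* (a :* (s :* t) :+ b :* s :+ c :* t :+ d)
             := (a :* t :+ b) :* (a :* s :+ c) :+ (a :* d :+ b :* c)) refl a b c d t (σ t) ⟩
      (a * t + b) * (a * σ t + c) + Q y             ≡⟨ cong ((a * t + b) * (a * σ t + c) +_) Qy≡0 ⟩
      (a * t + b) * (a * σ t + c) + 0#              ≡⟨ +-identityʳ _ ⟩
      (a * t + b) * (a * σ t + c)                   ∎

    root : ∀ t → a * t ≡ b ⊎ a * σ t ≡ c → Root y (just t)
    root t (inj₁ eq) = x*y≡0⇒y≡0 a≢0 (trans (factor t) (trans (cong (_* (a * σ t + c)) (x≡y⇒x+y≡0 eq)) (zeroˡ _)))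
    root t (inj₂ eq) = x*y≡0⇒y≡0 a≢0 (trans (factor t) (*0 _ (x≡y⇒x+y≡0 eq)))

    t₁≢t₂ : just t₁ ≢ just t₂
    t₁≢t₂ refl = off (just t₁) a (tuple≡ (sym (*-identityʳ a)) (sym at₁≡b) (sym aσt₂≡c) (*-cancelˡ a≢0 (begin
      a * d                 ≡⟨ x+y≡0⇒x≡y Qy≡0 ⟩
      b * c                 ≡⟨ cong₂ _*_ at₁≡b aσt₂≡c ⟨
      a * t₁ * (a * σ t₁)   ≡⟨ solve 3 (λ a t s → a :* t :* (a :* s) := a :* (a :* (s :* t))) refl a t₁ (σ t₁) ⟩
      a * (a * (σ t₁ * t₁)) ∎)))

    roots : ∀ i → Root y i → just t₁ ≡ i ⊎ just t₂ ≡ i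
    roots nothing  eq = contradiction (trans (sym (β-A∞ y)) eq) a≢0
    roots (just t) eq = Sum.map
      (λ at+b≡0 → cong just (*-cancelˡ a≢0 (trans at₁≡b (sym (x+y≡0⇒x≡y at+b≡0)))))
      (λ aσt+c≡0 → cong just (σ-injective (*-cancelˡ a≢0 (trans aσt₂≡c (sym (x+y≡0⇒x≡y aσt+c≡0))))))
      (x*y≡0 (trans (sym (factor t)) (*0 a eq)))
  -- Now ∞ is a root and `b c = 0`. If exactly one of `b`, `c` vanishes, the equation is `c t = d`
  -- or `b σ(t) = d`, with one finite root; if both do, `y` is a multiple of `U₄`.
  z-quadric {y@(a , b , c , d)} Qy≡0 off | yes refl with b ≟ᴷ 0# | c ≟ᴷ 0#
  ... | yes refl | yes refl = contradiction (tuple≡ (sym (zeroʳ d)) (sym (zeroʳ d)) (sym (zeroʳ d)) (sym (*-identityʳ d))) (off nothing d)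
  ... | no b≢0   | no c≢0   = contradiction
    (trans (solve 3 (λ b c d → b :* c := con false :* d :+ b :* c) refl b c d) Qy≡0) (x*y≢0 b≢0 c≢0)
  ... | yes refl | no c≢0 = #-two finiteI (root? y) (λ ()) (β-A∞ y) root roots
    where
    value : ∀ t → β (A (just t)) y ≡ c * t + d
    value t = trans (β-A t y) (solve 4 (λ t s c d → con false :* (s :* t) :+ con false :* s :+ c :* t :+ d := c :* t :+ d) refl t (σ t) c d)
    root : Root y (just (inv c * d))
    root = trans (value _) (x≡y⇒x+y≡0 (*-inv-* d c≢0))
    roots : ∀ i → Root y i → nothing ≡ i ⊎ just (inv c * d) ≡ i
    roots nothing  _  = inj₁ refl
    roots (just t) eq = inj₂ (cong just (*-cancelˡ c≢0 (trans (*-inv-* d c≢0) (sym (x+y≡0⇒x≡y (trans (sym (value t)) eq))))))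
  ... | no b≢0   | yes refl with σ-surjective (inv b * d)
  ...   | t₀ , σt₀≡ = #-two finiteI (root? y) (λ ()) (β-A∞ y) root roots
    where
    value : ∀ t → β (A (just t)) y ≡ b * σ t + d
    value t = trans (β-A t y) (solve 4 (λ t s b d → con false :* (s :* t) :+ b :* s :+ con false :* t :+ d := b :* s :+ d) refl t (σ t) b d)
    bσt₀≡d : b * σ t₀ ≡ d
    bσt₀≡d = trans (cong (b *_) σt₀≡) (*-inv-* d b≢0)
    root : Root y (just t₀)
    root = trans (value _) (x≡y⇒x+y≡0 bσt₀≡d)
    roots : ∀ i → Root y i → nothing ≡ i ⊎ just t₀ ≡ i
    roots nothing  _  = inj₁ refl
    roots (just t) eq = inj₂ (cong just (σ-injective (*-cancelˡ b≢0 (trans bσt₀≡d (sym (x+y≡0⇒x≡y (trans (sym (value t)) eq)))))))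

  private
    swap : I → I
    swap nothing  = just 0#
    swap (just v) with v ≟ᴷ 0#
    ... | yes _ = nothing
    ... | no _  = just (inv v)

    swap-0 : swap (just 0#) ≡ nothing
    swap-0 with 0# ≟ᴷ 0#
    ... | yes _  = refl
    ... | no 0≢0 = contradiction refl 0≢0

    swap-≢0 : ∀ {v} → v ≢ 0# → swap (just v) ≡ just (inv v)
    swap-≢0 {v} v≢0 with v ≟ᴷ 0#
    ... | yes v≡0 = contradiction v≡0 v≢0
    ... | no _    = refl

    swap-swap : ∀ i → swap (swap i) ≡ i
    swap-swap nothing  = swap-0
    swap-swap (just v) with v ≟ᴷ 0#
    ... | yes refl = refl
    ... | no v≢0   = trans (swap-≢0 (inv≢0 v≢0)) (cong just (inv-inv v≢0))

    -- v ↦ t + 1/v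
    move : K → I → I
    move t = Maybe.map (t +_) ∘ swap

    ∑-move : ∀ t (f : I → ℕ) → ∑ finiteI (f ∘ move t) ≡ ∑ finiteI f
    ∑-move t f = trans
      (∑-reindex finiteI finiteI swap swap swap-swap swap-swap (f ∘ Maybe.map (t +_)))
      (∑-reindex finiteI finiteI (Maybe.map (t +_)) (Maybe.map (t +_)) involutive involutive f)
      where
      involutive : ∀ i → Maybe.map (t +_) (Maybe.map (t +_) i) ≡ i
      involutive nothing  = refl
      involutive (just u) = cong just (solve 2 (λ t u → t :+ (t :+ u) := u) refl t u)

  -- With a root moved to ∞ the remaining ones are the roots of an affine map.
  z-nonquadric : ∀ {y} → Q y ≢ 0# → z y ≡ 0 ⊎ z y ≡ 1 ⊎ z y ≡ 3
  z-nonquadric {y@(a , b , c , d)} Qy≢0 with any? finiteI (root? y)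
  ... | no ¬root = inj₁ (#-empty finiteI (root? y) λ i root → ¬root (i , root))
  ... | yes (nothing , root∞) = finish (affine-roots d b≢0 c≢0)
    where
    a≡0 : a ≡ 0#
    a≡0 = trans (sym (β-A∞ y)) root∞

    Q≡bc : Q y ≡ b * c
    Q≡bc = trans (cong (λ a → a * d + b * c) a≡0) (trans (cong (_+ b * c) (zeroˡ d)) (+-identityˡ _))

    b≢0 : b ≢ 0#
    b≢0 b≡0 = Qy≢0 (trans Q≡bc (trans (cong (_* c) b≡0) (zeroˡ c)))

    c≢0 : c ≢ 0#
    c≢0 c≡0 = Qy≢0 (trans Q≡bc (*0 b c≡0))

    value : ∀ t → β (A (just t)) y ≡ affine b c d t
    value t = trans (β-A t y) (trans (cong (λ a → a * (σ t * t) + b * σ t + c * t + d) a≡0)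
      (solve 5 (λ t s b c d → con false :* (s :* t) :+ b :* s :+ c :* t :+ d := b :* s :+ c :* t :+ d) refl t (σ t) b c d))

    count : z y ≡ 1 ℕ.+ # finite (λ v → affine b c d v ≟ᴷ 0#)
    count = trans (∑-Maybe finite _) (cong₂ ℕ._+_ (⟦⟧-yes (root? y nothing) root∞)
      (#-cong finite _ _ (λ t → trans (sym (value t))) (λ t → trans (value t))))

    finish : _ → z y ≡ 0 ⊎ z y ≡ 1 ⊎ z y ≡ 3
    finish (inj₁ eq) = inj₂ (inj₁ (trans count (cong ℕ.suc eq)))
    finish (inj₂ eq) = inj₂ (inj₂ (trans count (cong ℕ.suc eq)))
  ... | yes (just t₀ , root₀) = finish (affine-roots a g≢0 e≢0)
    where
    g e : K
    g = a * σ t₀ + c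
    e = a * t₀ + b

    -- `g` and `e` arise from the substitution `t = t₀ + 1/v` after multiplication by `v σ(v)`.
    -- Their product is `Q y` because `t₀` is a root, so neither vanishes.
    Q≡eg : Q y ≡ e * g
    Q≡eg = begin
      Q y                                                     ≡⟨ +-identityʳ _ ⟨
      Q y + 0#                                                ≡⟨ cong (Q y +_) (*0 a (trans (sym (β-A t₀ y)) root₀)) ⟨
      Q y + a * (a * (σ t₀ * t₀) + b * σ t₀ + c * t₀ + d)
        ≡⟨ solve 6 (λ a b c d t s → (a :* d :+ b :* c) :+ a :* (a :* (s :* t) :+ b :* s :+ c :* t :+ d)
             := (a :* t :+ b) :* (a :* s :+ c)) refl a b c d t₀ (σ t₀) ⟩
      e * g                                                   ∎

    g≢0 : g ≢ 0#
    g≢0 g≡0 = Qy≢0 (trans Q≡eg (*0 e g≡0))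

    e≢0 : e ≢ 0#
    e≢0 e≡0 = Qy≢0 (trans Q≡eg (trans (cong (_* g) e≡0) (zeroˡ g)))

    value : ∀ {v} → v ≢ 0# → v * (σ v * β (A (just (t₀ + inv v))) y) ≡ affine g e a v
    value {v} v≢0 = begin
      v * (σ v * β (A (just (t₀ + w))) y)
        ≡⟨ cong (λ x → v * (σ v * x)) (β-A (t₀ + w) y) ⟩
      v * (σ v * (a * (σ (t₀ + w) * (t₀ + w)) + b * σ (t₀ + w) + c * (t₀ + w) + d))
        ≡⟨ cong (λ x → v * (σ v * (a * (x * (t₀ + w)) + b * x + c * (t₀ + w) + d))) (σ-+ t₀ w) ⟩
      v * (σ v * (a * ((s₀ + σ w) * (t₀ + w)) + b * (s₀ + σ w) + c * (t₀ + w) + d))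
        ≡⟨ solve 10 (λ a b c d t s v r w u →
             v :* (r :* (a :* ((s :+ u) :* (t :+ w)) :+ b :* (s :+ u) :+ c :* (t :+ w) :+ d))
             := (a :* s :+ c) :* r :* (w :* v) :+ (a :* t :+ b) :* v :* (u :* r) :+ a :* ((w :* v) :* (u :* r))
                :+ v :* r :* (a :* (s :* t) :+ b :* s :+ c :* t :+ d))
             refl a b c d t₀ s₀ v (σ v) w (σ w) ⟩
      g * σ v * (w * v) + e * v * (σ w * σ v) + a * ((w * v) * (σ w * σ v))
        + v * σ v * (a * (s₀ * t₀) + b * s₀ + c * t₀ + d)
        ≡⟨ cong₂ _+_ (cong₂ (λ x x′ → g * σ v * x + e * v * x′ + a * (x * x′)) wv≡1 σwσv≡1)
             (*0 (v * σ v) (trans (sym (β-A t₀ y)) root₀)) ⟩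
      g * σ v * 1# + e * v * 1# + a * (1# * 1#) + 0#
        ≡⟨ trans (+-identityʳ _) (cong₂ _+_ (cong₂ _+_ (*-identityʳ _) (*-identityʳ _)) (trans (cong (a *_) (*-identityˡ 1#)) (*-identityʳ a))) ⟩
      affine g e a v ∎
      where
      w s₀ : K
      w  = inv v
      s₀ = σ t₀
      wv≡1 : w * v ≡ 1#
      wv≡1 = inv-* v≢0
      σwσv≡1 : σ w * σ v ≡ 1#
      σwσv≡1 = trans (sym (σ-* w v)) (trans (cong σ wv≡1) σ-1)

    -- `v = 0` stands for the parameter ∞, where the form takes the value `a`, the constant term of
    -- the affine map.
    affine-0 : affine g e a 0# ≡ a
    affine-0 = trans (cong (_+ a) (trans (cong₂ _+_ (*0 g σ-0) (zeroʳ e)) (x+x≡0 0#))) (+-identityˡ a)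

    to : ∀ v → Root y (move t₀ (just v)) → affine g e a v ≡ 0#
    to v root with v ≟ᴷ 0#
    ... | yes refl = trans affine-0 (trans (sym (β-A∞ y)) root)
    ... | no v≢0   = trans (sym (value v≢0)) (*0 v (*0 (σ v) root))

    from : ∀ v → affine g e a v ≡ 0# → Root y (move t₀ (just v))
    from v root with v ≟ᴷ 0#
    ... | yes refl = trans (β-A∞ y) (trans (sym affine-0) root)
    ... | no v≢0   = x*y≡0⇒y≡0 (σ≢0 v≢0) (x*y≡0⇒y≡0 v≢0 (trans (value v≢0) root))

    count : z y ≡ 1 ℕ.+ # finite (λ v → affine g e a v ≟ᴷ 0#)
    count = begin
      z y                                          ≡⟨ ∑-move t₀ (λ i → ⟦ root? y i ⟧) ⟨
      ∑ finiteI (λ i → ⟦ root? y (move t₀ i) ⟧)    ≡⟨ ∑-Maybe finite _ ⟩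
      -- `move t₀` sends ∞ to `t₀`, so the separate term is the known root.
      ⟦ root? y (just (t₀ + 0#)) ⟧ ℕ.+ # finite (λ v → root? y (move t₀ (just v)))
        ≡⟨ cong₂ ℕ._+_ (⟦⟧-yes (root? y (just (t₀ + 0#))) (subst (Root y ∘ just) (sym (+-identityʳ t₀)) root₀))
             (#-cong finite _ _ to from) ⟩
      1 ℕ.+ # finite (λ v → affine g e a v ≟ᴷ 0#)  ∎

    finish : _ → z y ≡ 0 ⊎ z y ≡ 1 ⊎ z y ≡ 3
    finish (inj₁ eq) = inj₂ (inj₁ (trans count (cong ℕ.suc eq)))
    finish (inj₂ eq) = inj₂ (inj₂ (trans count (cong ℕ.suc eq)))

-- Numbers of vectors

module Counts (S : FieldWithAutomorphism) (3≤q : 3 ℕ.≤ Finite.card (FieldWithAutomorphism.finite S)) where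

  open Geometry S

  q : ℕ
  q = Finite.card finite

  q≡3+ : ∃ λ r → q ≡ 3 ℕ.+ r
  q≡3+ = q ℕ.∸ 3 , sym (ℕ.m+[n∸m]≡n 3≤q)

  private instance
    q-nonZero : ℕ.NonZero q
    q-nonZero = ℕ.>-nonZero (ℕ.≤-trans (s≤s z≤n) 3≤q)

  ∑ᴷ-const : ∀ c → ∑ finite (λ _ → c) ≡ q ℕ.* c
  ∑ᴷ-const = ∑-const finite

  ∑ᴵ-const : ∀ c → ∑ finiteI (λ _ → c) ≡ suc q ℕ.* c
  ∑ᴵ-const c = trans (∑-Maybe finite (λ _ → c)) (cong (c ℕ.+_) (∑ᴷ-const c))

  #V : # finiteV (λ _ → yes tt) ≡ q ℕ.* (q ℕ.* (q ℕ.* q))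
  #V = trans (∑-× finite (finite× finite (finite× finite finite)) _) (trans (∑-cong finite λ _ →
         trans (∑-× finite (finite× finite finite) _) (trans (∑-cong finite λ _ →
           trans (∑-× finite finite _) (trans (∑-cong finite λ _ →
             trans (∑ᴷ-const 1) (ℕ.*-identityʳ q))
           (∑ᴷ-const q)))
         (∑ᴷ-const _)))
       (∑ᴷ-const _))

  _⊥?_ : ∀ u y → Dec (β u y ≡ 0#)
  u ⊥? y = β u y ≟ᴷ 0#

  -- `W` is a union of lines in direction `w`, and `g` vanishes exactly once on each. Hence the `q`
  -- translates of the cut cover every vector of `W` once.
  #-cut : ∀ {W : V → Set} (W? : Decidable W) (g : V → K) (w : V) →
          (∀ k y → W y → W (y ⊕ k · w)) →
          (∀ y → W y → ∃ λ k → g (y ⊕ k · w) ≡ 0# × (∀ l → g (y ⊕ l · w) ≡ 0# → k ≡ l)) →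
          # finiteV W? ≡ q ℕ.* # finiteV (λ y → W? y ×-dec (g y ≟ᴷ 0#))
  #-cut {W} W? g w shift cut = begin
    # finiteV W?                                         ≡⟨ ∑-cong finiteV fibre ⟩
    ∑ finiteV (λ y → # finite λ k → cut? (y ⊕ k · w))    ≡⟨ ∑-comm finiteV finite _ ⟩
    ∑ finite (λ k → # finiteV λ y → cut? (y ⊕ k · w))    ≡⟨ ∑-cong finite (λ k → ∑-reindex finiteV finiteV
                                                             (_⊕ k · w) (_⊕ k · w) (λ y → ⊕-cancel y (k · w)) (λ y → ⊕-cancel y (k · w)) _) ⟩
    ∑ finite (λ k → # finiteV cut?)                      ≡⟨ ∑ᴷ-const _ ⟩
    q ℕ.* # finiteV cut?                                 ∎
    where
    open ≡-Reasoning
    cut? : Decidable (λ y → W y × g y ≡ 0#)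
    cut? y = W? y ×-dec (g y ≟ᴷ 0#)

    fibre : ∀ y → ⟦ W? y ⟧ ≡ # finite λ k → cut? (y ⊕ k · w)
    fibre y with W? y
    ... | no ¬Wy = sym (#-empty finite _ λ k (Wy+kw , _) → ¬Wy (subst W (⊕-cancel y (k · w)) (shift k _ Wy+kw)))
    ... | yes Wy with cut y Wy
    ...   | k , gk≡0 , unique = sym (#-unique finite _ (shift k y Wy , gk≡0) λ l (_ , gl≡0) → unique l gl≡0)

  β-shift : ∀ u y k w → β u (y ⊕ k · w) ≡ β u y + k * β u w
  β-shift u y k w = trans (β-⊕ u y (k · w)) (cong (β u y +_) (β-· u k w))

  ⊥-shift : ∀ {u w} → β u w ≡ 0# → ∀ k y → β u y ≡ 0# → β u (y ⊕ k · w) ≡ 0#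
  ⊥-shift {u} {w} u⊥w k y u⊥y = trans (β-shift u y k w) (trans (cong₂ _+_ u⊥y (*0 k u⊥w)) (x+x≡0 0#))

  -- On a line in direction `w` the form is affine with slope `β u w`, so its only zero is at
  -- `k = β u y / β u w`; in characteristic 2 there is no sign.
  #-cut-⊥ : ∀ {W : V → Set} (W? : Decidable W) {u w} → β u w ≢ 0# →
            (∀ k y → W y → W (y ⊕ k · w)) →
            # finiteV W? ≡ q ℕ.* # finiteV (λ y → W? y ×-dec (u ⊥? y))
  #-cut-⊥ W? {u} {w} βuw≢0 shift = #-cut W? (β u) w shift λ y Wy →
    inv (β u w) * β u y ,
    trans (β-shift u y _ w) (x≡y⇒x+y≡0 (trans (sym (*-inv-* (β u y) βuw≢0))
      (solve 3 (λ a b c → a :* (b :* c) := (b :* c) :* a) refl (β u w) (inv (β u w)) (β u y)))) ,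
    λ l root → *-cancelˡ βuw≢0 (trans (*-inv-* (β u y) βuw≢0)
      (trans (x+y≡0⇒x≡y (trans (sym (β-shift u y l w)) root)) (*-comm l _)))

  nondegenerate : ∀ {y} → y ≢ 𝟎 → ∃ λ w → β y w ≢ 0#
  nondegenerate {y@(a , b , c , d)} y≢𝟎 with a ≟ᴷ 0# | b ≟ᴷ 0# | c ≟ᴷ 0# | d ≟ᴷ 0#
  ... | no a≢0 | _ | _ | _ = (0# , 0# , 0# , 1#) , a≢0 ∘ trans
    (solve 4 (λ a b c d → a := a :* con true :+ b :* con false :+ c :* con false :+ d :* con false) refl a b c d)
  ... | _ | no b≢0 | _ | _ = (0# , 0# , 1# , 0#) , b≢0 ∘ trans
    (solve 4 (λ a b c d → b := a :* con false :+ b :* con true :+ c :* con false :+ d :* con false) refl a b c d)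
  ... | _ | _ | no c≢0 | _ = (0# , 1# , 0# , 0#) , c≢0 ∘ trans
    (solve 4 (λ a b c d → c := a :* con false :+ b :* con false :+ c :* con true :+ d :* con false) refl a b c d)
  ... | _ | _ | _ | no d≢0 = (1# , 0# , 0# , 0#) , d≢0 ∘ trans
    (solve 4 (λ a b c d → d := a :* con false :+ b :* con false :+ c :* con false :+ d :* con true) refl a b c d)
  ... | yes a≡0 | yes b≡0 | yes c≡0 | yes d≡0 = contradiction (tuple≡ a≡0 b≡0 c≡0 d≡0) y≢𝟎

  -- β(Aᵢ, Aⱼ) times the projection of y to ⟨Aᵢ, Aⱼ⟩^⊥.
  π : I → I → V → V
  π i j y = β (A i) (A j) · y ⊕ β y (A j) · A i ⊕ β y (A i) · A j

  β-π : ∀ u i j y → β u (π i j y) ≡ β (A i) (A j) * β u y + β y (A j) * β u (A i) + β y (A i) * β u (A j)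
  β-π u i j y = trans (β-shift u _ (β y (A i)) (A j))
    (cong (_+ β y (A i) * β u (A j)) (trans (β-shift u _ (β y (A j)) (A i))
      (cong (_+ β y (A j) * β u (A i)) (β-· u _ y))))

  -- This supplies slicing directions: if `β (π i j y) w` is nonzero, then `π i j w` is orthogonal
  -- to `A i` and `A j` but not to `y`.
  π-selfAdjoint : ∀ i j u y → β u (π i j y) ≡ β (π i j u) y
  π-selfAdjoint i j u y = begin
    β u (π i j y)     ≡⟨ β-π u i j y ⟩
    β (A i) (A j) * β u y + β y (A j) * β u (A i) + β y (A i) * β u (A j)
      ≡⟨ cong (λ x → β (A i) (A j) * x + β y (A j) * β u (A i) + β y (A i) * β u (A j)) (β-comm u y) ⟩
    β (A i) (A j) * β y u + β y (A j) * β u (A i) + β y (A i) * β u (A j)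
      ≡⟨ solve 6 (λ b x p r s t → b :* x :+ p :* r :+ s :* t := b :* x :+ t :* s :+ r :* p) refl
           (β (A i) (A j)) (β y u) (β y (A j)) (β u (A i)) (β y (A i)) (β u (A j)) ⟩
    β (A i) (A j) * β y u + β u (A j) * β y (A i) + β u (A i) * β y (A j) ≡⟨ β-π y i j u ⟨
    β y (π i j u)     ≡⟨ β-comm y _ ⟩
    β (π i j u) y     ∎
    where open ≡-Reasoning

  π-⊥ˡ : ∀ i j y → β (A i) (π i j y) ≡ 0#
  π-⊥ˡ i j y = begin
    β (A i) (π i j y)  ≡⟨ β-π (A i) i j y ⟩
    β (A i) (A j) * β (A i) y + β y (A j) * β (A i) (A i) + β y (A i) * β (A i) (A j)
      ≡⟨ cong₂ (λ p r → β (A i) (A j) * p + β y (A j) * r + β y (A i) * β (A i) (A j)) (β-comm (A i) y) (β-self (A i)) ⟩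
    β (A i) (A j) * β y (A i) + β y (A j) * 0# + β y (A i) * β (A i) (A j)
      ≡⟨ solve 3 (λ b p r → b :* p :+ r :* con false :+ p :* b := con false) refl (β (A i) (A j)) (β y (A i)) (β y (A j)) ⟩
    0# ∎
    where open ≡-Reasoning

  π-⊥ʳ : ∀ i j y → β (A j) (π i j y) ≡ 0#
  π-⊥ʳ i j y = begin
    β (A j) (π i j y)  ≡⟨ β-π (A j) i j y ⟩
    β (A i) (A j) * β (A j) y + β y (A j) * β (A j) (A i) + β y (A i) * β (A j) (A j)
      ≡⟨ cong₂ (λ p r → β (A i) (A j) * p + β y (A j) * β (A j) (A i) + β y (A i) * r) (β-comm (A j) y) (β-self (A j)) ⟩
    β (A i) (A j) * β y (A j) + β y (A j) * β (A j) (A i) + β y (A i) * 0#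
      ≡⟨ cong (λ p → β (A i) (A j) * β y (A j) + β y (A j) * p + β y (A i) * 0#) (β-comm (A j) (A i)) ⟩
    β (A i) (A j) * β y (A j) + β y (A j) * β (A i) (A j) + β y (A i) * 0#
      ≡⟨ solve 3 (λ b p r → b :* p :+ p :* b :+ r :* con false := con false) refl (β (A i) (A j)) (β y (A j)) (β y (A i)) ⟩
    0# ∎
    where open ≡-Reasoning

  Q-π : ∀ i j y → let b = β (A i) (A j) in Q (π i j y) ≡ b * (b * Q y + β y (A i) * β y (A j))
  Q-π i j y = begin
    Q (X ⊕ α · A i ⊕ γ · A j)
      ≡⟨ Q-⊕ (X ⊕ α · A i) (γ · A j) ⟩
    Q (X ⊕ α · A i) + Q (γ · A j) + β (X ⊕ α · A i) (γ · A j)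
      ≡⟨ cong₂ _+_ (cong₂ _+_ (Q-⊕ X (α · A i)) (QkA γ j)) (trans (β-· _ γ (A j)) (cong (γ *_) βXα)) ⟩
    Q X + Q (α · A i) + β X (α · A i) + 0# + γ * (b * α + α * b)
      ≡⟨ cong (λ x → x + 0# + γ * (b * α + α * b)) (cong₂ _+_ (cong₂ _+_ (Q-· b y) (QkA α i))
           (trans (β-· X α (A i)) (cong (α *_) (trans (β-comm X (A i)) (trans (β-· (A i) b y) (cong (b *_) (β-comm (A i) y))))))) ⟩
    b * b * Q y + 0# + α * (b * γ) + 0# + γ * (b * α + α * b)
      ≡⟨ solve 4 (λ b Qy α γ → b :* b :* Qy :+ con false :+ α :* (b :* γ) :+ con false :+ γ :* (b :* α :+ α :* b) := b :* (b :* Qy :+ γ :* α))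
           refl b (Q y) α γ ⟩
    b * (b * Q y + γ * α) ∎
    where
    open ≡-Reasoning
    b α γ : K
    b = β (A i) (A j)
    α = β y (A j)
    γ = β y (A i)
    X : V
    X = b · y
    QkA : ∀ k i → Q (k · A i) ≡ 0#
    QkA k i = trans (Q-· k (A i)) (*0 _ (Q-A i))
    βXα : β (X ⊕ α · A i) (A j) ≡ b * α + α * b
    βXα = trans (β-comm (X ⊕ α · A i) (A j)) (trans (β-shift (A j) X α (A i))
      (cong₂ _+_ (trans (β-· (A j) b y) (cong (b *_) (β-comm (A j) y))) (cong (α *_) (β-comm (A j) (A i)))))

  π-diagonal : ∀ i y → π i i y ≡ 𝟎
  π-diagonal i y = trans (⊕-cancel (β (A i) (A i) · y) (β y (A i) · A i))
    (trans (cong (_· y) (β-self (A i))) (0· y))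

  π-sym : ∀ i j y → π i j y ≡ π j i y
  π-sym i j y = trans (⊕-swap (β (A i) (A j) · y) _ _) (cong (λ b → b · y ⊕ β y (A i) · A j ⊕ β y (A j) · A i) (β-comm (A i) (A j)))
    where
    ⊕-swap : ∀ x u v → x ⊕ u ⊕ v ≡ x ⊕ v ⊕ u
    ⊕-swap (a , b , c , d) (a₁ , b₁ , c₁ , d₁) (a₂ , b₂ , c₂ , d₂) = tuple≡ (swap a a₁ a₂) (swap b b₁ b₂) (swap c c₁ c₂) (swap d d₁ d₂)
      where
      swap : ∀ x u v → x + u + v ≡ x + v + u
      swap = solve 3 (λ x u v → x :+ u :+ v := x :+ v :+ u) refl

  -- `π i j y ≡ 𝟎` puts `y` on the chord through `A i` and `A j`. There its `A j` coefficient is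
  -- proportional to `β y (A i)`, so a root at `i` leaves only a multiple of `A i`.
  chord-root : ∀ {i j y} → i ≢ j → π i j y ≡ 𝟎 → Root y i → ¬ Off y
  chord-root {i} {j} {y} i≢j πy≡𝟎 root off = off i (inv b * β y (A j)) (begin
    y                               ≡⟨ inv-·-· y b≢0 ⟨
    inv b · b · y                   ≡⟨ cong (inv b ·_) b·y≡ ⟩
    inv b · β y (A j) · A i         ≡⟨ ·-assoc (inv b) _ (A i) ⟩
    (inv b * β y (A j)) · A i       ∎)
    where
    open ≡-Reasoning
    b = β (A i) (A j)
    b≢0 = β-A≢ i≢j
    b·y≡ : b · y ≡ β y (A j) · A i
    b·y≡ = x⊕y≡𝟎⇒x≡y (begin
      b · y ⊕ β y (A j) · A i                       ≡⟨ ⊕-cancel _ (0# · A j) ⟨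
      b · y ⊕ β y (A j) · A i ⊕ 0# · A j ⊕ 0# · A j ≡⟨ cong₂ _⊕_ (cong (λ x → b · y ⊕ β y (A j) · A i ⊕ x · A j) (trans (sym root) (β-comm (A i) y))) (0· (A j)) ⟩
      π i j y ⊕ 𝟎                                   ≡⟨ cong (_⊕ 𝟎) πy≡𝟎 ⟩
      𝟎 ⊕ 𝟎                                         ≡⟨ ⊕-identityˡ 𝟎 ⟩
      𝟎                                             ∎)

  other : ∀ i j k → ∃ λ (l : I) → ¬ (i ≡ l ⊎ j ≡ l ⊎ k ≡ l)
  other i j k = case any? finiteI (λ l → ¬? ((i ≟ᴵ l) ⊎-dec ((j ≟ᴵ l) ⊎-dec (k ≟ᴵ l)))) of λ
    { (yes p) → p ; (no ¬p) → contradiction (bound ¬p) (ℕ.<⇒≱ (s≤s 3≤q)) }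
    where
    open ℕ.≤-Reasoning
    bound : ¬ (∃ λ l → ¬ (i ≡ l ⊎ j ≡ l ⊎ k ≡ l)) → suc q ℕ.≤ 3
    bound ¬p = begin
      suc q                      ≡⟨ ℕ.*-identityʳ (suc q) ⟨
      suc q ℕ.* 1                ≡⟨ ∑ᴵ-const 1 ⟨
      ∑ finiteI (λ _ → 1)        ≤⟨ ∑-≤ finiteI pointwise ⟩
      ∑ finiteI (λ l → ⟦ i ≟ᴵ l ⟧ ℕ.+ (⟦ j ≟ᴵ l ⟧ ℕ.+ ⟦ k ≟ᴵ l ⟧))
        ≡⟨ trans (∑-+ finiteI (λ l → ⟦ i ≟ᴵ l ⟧) _) (cong₂ ℕ._+_ (#≡ finiteI i)
             (trans (∑-+ finiteI (λ l → ⟦ j ≟ᴵ l ⟧) (λ l → ⟦ k ≟ᴵ l ⟧)) (cong₂ ℕ._+_ (#≡ finiteI j) (#≡ finiteI k)))) ⟩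
      3                          ∎
      where
      pointwise : ∀ l → 1 ℕ.≤ ⟦ i ≟ᴵ l ⟧ ℕ.+ (⟦ j ≟ᴵ l ⟧ ℕ.+ ⟦ k ≟ᴵ l ⟧)
      pointwise l with i ≟ᴵ l | j ≟ᴵ l | k ≟ᴵ l
      ... | yes _ | _     | _     = s≤s z≤n
      ... | no _  | yes _ | _     = s≤s z≤n
      ... | no _  | no _  | yes _ = s≤s z≤n
      ... | no i≢ | no j≢ | no k≢ = contradiction (l , λ { (inj₁ e) → i≢ e ; (inj₂ (inj₁ e)) → j≢ e ; (inj₂ (inj₂ e)) → k≢ e }) ¬p

  another : ∀ i → ∃ λ (j : I) → i ≢ j
  another i = let j , ≢j = other i i i in j , ≢j ∘ inj₁

  #⊥ : ∀ {u} → u ≢ 𝟎 → # finiteV (u ⊥?_) ≡ q ℕ.* (q ℕ.* q)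
  #⊥ {u} u≢𝟎 = let w , βuw≢0 = nondegenerate u≢𝟎 in ℕ.*-cancelˡ-≡ _ _ q (trans
    (cong (q ℕ.*_) (#-cong finiteV (u ⊥?_) (λ y → yes tt ×-dec (u ⊥? y)) (λ y → tt ,_) (λ y → proj₂)))
    (trans (sym (#-cut-⊥ (λ _ → yes tt) {u} {w} βuw≢0 (λ _ _ → id))) #V))

  #⊥⊥ : ∀ {u v w} → u ≢ 𝟎 → β u w ≡ 0# → β v w ≢ 0# →
        # finiteV (λ y → (u ⊥? y) ×-dec (v ⊥? y)) ≡ q ℕ.* q
  #⊥⊥ {u} u≢𝟎 u⊥w v⊥̸w = ℕ.*-cancelˡ-≡ _ _ q (trans (sym (#-cut-⊥ (u ⊥?_) v⊥̸w (⊥-shift u⊥w))) (#⊥ u≢𝟎))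

  #⊥AA : ∀ {i j} → i ≢ j → # finiteV (λ y → (A i ⊥? y) ×-dec (A j ⊥? y)) ≡ q ℕ.* q
  #⊥AA {i} {j} i≢j = #⊥⊥ (A≢𝟎 i) (β-self (A i)) (β-A≢ (i≢j ∘ sym))

  -- Slicing needs a vector orthogonal to `A i` but not to `y`. If `y` is not in the osculating
  -- plane at `A i`, then `A i` itself serves; otherwise a projection along a chord through `A i`
  -- does, as `y` is not on that chord.
  #⊥A : ∀ {y} → Off y → ∀ i → # finiteV (λ x → (A i ⊥? x) ×-dec (y ⊥? x)) ≡ q ℕ.* q
  #⊥A {y} off i = case root? y i of λ
    { (no ¬root)  → #⊥⊥ (A≢𝟎 i) (β-self (A i)) (¬root ∘ trans (β-comm (A i) y))
    ; (yes root) → let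
        j , i≢j = another i
        w , ≢0  = nondegenerate {π i j y} (λ πy≡𝟎 → chord-root i≢j πy≡𝟎 root off)
      in #⊥⊥ {v = y} (A≢𝟎 i) (π-⊥ˡ i j w) (≢0 ∘ trans (sym (π-selfAdjoint i j y w))) }

  #⊥AA-chord : ∀ {i j y} → i ≢ j → π i j y ≡ 𝟎 →
               # finiteV (λ x → ((A i ⊥? x) ×-dec (A j ⊥? x)) ×-dec (y ⊥? x)) ≡ q ℕ.* q
  #⊥AA-chord {i} {j} {y} i≢j πy≡𝟎 = trans (#-cong finiteV _ _ (λ _ → proj₁) λ x ⊥x → ⊥x , perp x ⊥x) (#⊥AA i≢j)
    where
    open ≡-Reasoning
    b = β (A i) (A j)
    perp : ∀ x → β (A i) x ≡ 0# × β (A j) x ≡ 0# → β y x ≡ 0#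
    perp x (i⊥x , j⊥x) = x*y≡0⇒y≡0 (β-A≢ i≢j) (begin
      b * β y x                       ≡⟨ cong (b *_) (β-comm y x) ⟩
      b * β x y                       ≡⟨ solve 3 (λ p r s → p := p :+ r :* con false :+ s :* con false) refl _ (β y (A j)) (β y (A i)) ⟩
      b * β x y + β y (A j) * 0# + β y (A i) * 0#
        ≡⟨ cong₂ (λ p r → b * β x y + β y (A j) * p + β y (A i) * r) (trans (β-comm x (A i)) i⊥x) (trans (β-comm x (A j)) j⊥x) ⟨
      b * β x y + β y (A j) * β x (A i) + β y (A i) * β x (A j) ≡⟨ β-π x i j y ⟨
      β x (π i j y)                   ≡⟨ cong (β x) πy≡𝟎 ⟩
      β x 𝟎                           ≡⟨ β-𝟎 x ⟩
      0#                              ∎)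

  #⊥AA-general : ∀ {i j y} → i ≢ j → π i j y ≢ 𝟎 →
                 # finiteV (λ x → ((A i ⊥? x) ×-dec (A j ⊥? x)) ×-dec (y ⊥? x)) ≡ q
  #⊥AA-general {i} {j} {y} i≢j πy≢𝟎 = let w , ≢0 = nondegenerate πy≢𝟎 in ℕ.*-cancelˡ-≡ _ _ q (trans
    (sym (#-cut-⊥ (λ x → (A i ⊥? x) ×-dec (A j ⊥? x)) {y} {π i j w} (≢0 ∘ trans (sym (π-selfAdjoint i j y w)))
      λ k x (i⊥x , j⊥x) → ⊥-shift {A i} (π-⊥ˡ i j w) k x i⊥x , ⊥-shift {A j} (π-⊥ʳ i j w) k x j⊥x))
    (#⊥AA i≢j))

  -- `y` is the nucleus of the conic in its plane: it is orthogonal to itself, and along it the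
  -- quadric reads `Q x + k² Q y`, which has one zero because every element has exactly one square
  -- root.
  #⊥Q : ∀ {y} → Q y ≢ 0# → # finiteV (λ x → (y ⊥? x) ×-dec (Q x ≟ᴷ 0#)) ≡ q ℕ.* q
  #⊥Q {y} Qy≢0 = ℕ.*-cancelˡ-≡ _ _ q (trans
    (sym (#-cut (y ⊥?_) Q y (⊥-shift {y} (β-self y)) λ x y⊥x → let r , r²≡ = √ (inv (Q y) * Q x) in
      r , trans (Q-shift x r y⊥x) (x≡y⇒x+y≡0 (trans (sym (*-inv-* (Q x) Qy≢0)) (trans (cong (Q y *_) (sym r²≡)) (*-comm (Q y) _)))) ,
      λ l root → square-injective (*-cancelˡ Qy≢0 (trans (cong (Q y *_) r²≡) (trans (*-inv-* (Q x) Qy≢0)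
        (trans (x+y≡0⇒x≡y (trans (sym (Q-shift x l y⊥x)) root)) (*-comm _ (Q y))))))))
    (#⊥ (λ { refl → Qy≢0 (trans (cong Q (sym (0· y))) (trans (Q-· 0# y) (solve 1 (λ x → con false :* con false :* x := con false) refl (Q y)))) })))
    where
    Q-shift : ∀ x k → β y x ≡ 0# → Q (x ⊕ k · y) ≡ Q x + k * k * Q y
    Q-shift x k y⊥x = trans (Q-⊕ x (k · y)) (trans (cong₂ _+_ (cong (Q x +_) (Q-· k y))
      (trans (β-· x k y) (*0 k (trans (β-comm x y) y⊥x)))) (+-identityʳ _))

    square-injective : ∀ {k l} → k * k ≡ l * l → k ≡ l
    square-injective {k} {l} eq = [ x+y≡0⇒x≡y , x+y≡0⇒x≡y ]′
      (x*y≡0 (trans (solve 2 (λ k l → (k :+ l) :* (k :+ l) := k :* k :+ l :* l) refl k l) (x≡y⇒x+y≡0 eq)))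

  -- The plane y^⊥ is tangent to the quadric at y and meets it in two lines, which
  -- lie in the osculating planes on y.
  module _ {y} (Qy≡0 : Q y ≡ 0#) (off : Off y) where

    -- By `Q-π`, a point of the quadric on the chord satisfies `β y (A i) * β y (A j) ≡ 0#`, which
    -- makes it an end of the chord.
    chord-off-quadric : ∀ {i j} → i ≢ j → π i j y ≢ 𝟎
    chord-off-quadric {i} {j} i≢j πy≡𝟎 = [ (λ γ≡0 → chord-root i≢j πy≡𝟎 (trans (β-comm (A i) y) γ≡0) off)
                                         , (λ α≡0 → chord-root (i≢j ∘ sym) (trans (π-sym j i y) πy≡𝟎) (trans (β-comm (A j) y) α≡0) off) ]′
      (x*y≡0 {β y (A i)} {β y (A j)} (begin
        β y (A i) * β y (A j)               ≡⟨ solve 2 (λ b x → x := b :* con false :+ x) refl b _ ⟩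
        b * 0# + β y (A i) * β y (A j)      ≡⟨ cong (λ x → b * x + β y (A i) * β y (A j)) Qy≡0 ⟨
        b * Q y + β y (A i) * β y (A j)
          ≡⟨ x*y≡0⇒y≡0 (β-A≢ i≢j) (trans (sym (Q-π i j y)) (trans (cong Q πy≡𝟎) (trans (cong₂ _+_ (zeroʳ 0#) (zeroʳ 0#)) (x+x≡0 0#)))) ⟩
        0#                                  ∎))
      where
      open ≡-Reasoning
      b = β (A i) (A j)

    -- The `q` multiples of `y` satisfy the three conditions, and `#⊥AA-general` allows only `q`
    -- vectors.
    ⊥AA-span : ∀ {i j} → i ≢ j → Root y i → Root y j → ∀ x →
               (β (A i) x ≡ 0# × β (A j) x ≡ 0#) × β y x ≡ 0# → ∃ λ k → x ≡ k · y
    ⊥AA-span {i} {j} i≢j i⊥y j⊥y = #-⊆ finiteV span? _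
      (λ { x (k , refl) → (⊥-· i⊥y k , ⊥-· j⊥y k) , ⊥-· (β-self y) k })
      (trans #span (sym (#⊥AA-general {y = y} i≢j (chord-off-quadric i≢j))))
      where
      open ≡-Reasoning
      ⊥-· : ∀ {u} → β u y ≡ 0# → ∀ k → β u (k · y) ≡ 0#
      ⊥-· {u} u⊥y k = trans (β-· u k y) (*0 k u⊥y)

      span? : Decidable (λ x → ∃ λ k → x ≡ k · y)
      span? x = any? finite λ k → x ≟ⱽ (k · y)

      ·-injective : ∀ k l → k · y ≡ l · y → k ≡ l
      ·-injective k l eq = let w , βyw≢0 = nondegenerate (Off⇒≢𝟎 off) in *-cancelˡ βyw≢0 (begin
        β y w * k     ≡⟨ *-comm _ k ⟩
        k * β y w     ≡⟨ cong (k *_) (β-comm y w) ⟩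
        k * β w y     ≡⟨ β-· w k y ⟨
        β w (k · y)   ≡⟨ cong (β w) eq ⟩
        β w (l · y)   ≡⟨ β-· w l y ⟩
        l * β w y     ≡⟨ cong (l *_) (β-comm w y) ⟩
        l * β y w     ≡⟨ *-comm l _ ⟩
        β y w * l     ∎)

      fibre : ∀ x → ⟦ span? x ⟧ ≡ # finite (λ k → x ≟ⱽ (k · y))
      fibre x with span? x
      ... | yes (k , refl) = sym (#-unique finite _ refl λ l eq → ·-injective k l eq)
      ... | no ¬span       = sym (#-empty finite _ λ k eq → ¬span (k , eq))

      #span : # finiteV span? ≡ q
      #span = begin
        # finiteV span?                                       ≡⟨ ∑-cong finiteV fibre ⟩
        ∑ finiteV (λ x → # finite λ k → x ≟ⱽ (k · y))         ≡⟨ ∑-comm finiteV finite _ ⟩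
        ∑ finite (λ k → # finiteV λ x → x ≟ⱽ (k · y))         ≡⟨ ∑-cong finite (λ k → #-unique finiteV _ refl λ x → sym) ⟩
        ∑ finite (λ k → 1)                                    ≡⟨ ∑ᴷ-const 1 ⟩
        q ℕ.* 1                                               ≡⟨ ℕ.*-identityʳ q ⟩
        q                                                     ∎

    -- The projection `π i j x` is orthogonal to `A i`, `A j` and `y`, hence a multiple of `y` and
    -- on the quadric. With `Q-π` this splits the quadric on the tangent plane into two linear
    -- factors.
    tangent-quadric : ∀ {i j} → i ≢ j → Root y i → Root y j → ∀ x → β y x ≡ 0# →
                      β (A i) (A j) * Q x ≡ β x (A i) * β x (A j)
    tangent-quadric {i} {j} i≢j i⊥y j⊥y x y⊥x =
      let k , πx≡ = ⊥AA-span i≢j i⊥y j⊥y (π i j x) ((π-⊥ˡ i j x , π-⊥ʳ i j x) , y⊥π)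
      in x+y≡0⇒x≡y (x*y≡0⇒y≡0 (β-A≢ i≢j) (trans (sym (Q-π i j x)) (trans (cong Q πx≡) (trans (Q-· k y) (*0 _ Qy≡0)))))
      where
      y⊥π : β y (π i j x) ≡ 0#
      y⊥π = begin
        β y (π i j x)  ≡⟨ β-π y i j x ⟩
        β (A i) (A j) * β y x + β x (A j) * β y (A i) + β x (A i) * β y (A j)
          ≡⟨ cong₂ _+_ (cong₂ _+_ (*0 _ y⊥x) (*0 _ (trans (β-comm y (A i)) i⊥y))) (*0 _ (trans (β-comm y (A j)) j⊥y)) ⟩
        0# + 0# + 0#   ≡⟨ trans (+-identityʳ _) (x+x≡0 0#) ⟩
        0#             ∎
        where open ≡-Reasoning

    #⊥Q-tangent : ∀ {i j} → i ≢ j → Root y i → Root y j →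
                  # finiteV (λ x → (y ⊥? x) ×-dec (Q x ≟ᴷ 0#)) ℕ.+ q ≡ q ℕ.* q ℕ.+ q ℕ.* q
    #⊥Q-tangent {i} {j} i≢j i⊥y j⊥y = begin
      # finiteV (λ x → (y ⊥? x) ×-dec (Q x ≟ᴷ 0#)) ℕ.+ q
        ≡⟨ cong₂ ℕ._+_ (#-cong finiteV _ _ to from) (trans (sym (#⊥AA-general {y = y} i≢j (chord-off-quadric i≢j)))
             (#-cong finiteV _ _ (λ x ((i⊥x , j⊥x) , y⊥x) → (i⊥x , y⊥x) , (j⊥x , y⊥x)) (λ x ((i⊥x , y⊥x) , (j⊥x , _)) → (i⊥x , j⊥x) , y⊥x))) ⟩
      # finiteV (λ x → on? i x ⊎-dec on? j x) ℕ.+ # finiteV (λ x → on? i x ×-dec on? j x)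
        ≡⟨ #-⊎ finiteV (on? i) (on? j) ⟩
      # finiteV (on? i) ℕ.+ # finiteV (on? j)  ≡⟨ cong₂ ℕ._+_ (#⊥A off i) (#⊥A off j) ⟩
      q ℕ.* q ℕ.+ q ℕ.* q                      ∎
      where
      open ≡-Reasoning
      on? : ∀ i x → Dec (β (A i) x ≡ 0# × β y x ≡ 0#)
      on? i x = (A i ⊥? x) ×-dec (y ⊥? x)

      to : ∀ x → β y x ≡ 0# × Q x ≡ 0# → (β (A i) x ≡ 0# × β y x ≡ 0#) ⊎ (β (A j) x ≡ 0# × β y x ≡ 0#)
      to x (y⊥x , Qx≡0) = Sum.map
        (λ x⊥i → trans (β-comm (A i) x) x⊥i , y⊥x) (λ x⊥j → trans (β-comm (A j) x) x⊥j , y⊥x)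
        (x*y≡0 (trans (sym (tangent-quadric i≢j i⊥y j⊥y x y⊥x)) (*0 _ Qx≡0)))

      from : ∀ x → (β (A i) x ≡ 0# × β y x ≡ 0#) ⊎ (β (A j) x ≡ 0# × β y x ≡ 0#) → β y x ≡ 0# × Q x ≡ 0#
      from x (inj₁ (i⊥x , y⊥x)) = y⊥x , x*y≡0⇒y≡0 (β-A≢ i≢j) (trans (tangent-quadric i≢j i⊥y j⊥y x y⊥x)
        (trans (cong (_* β x (A j)) (trans (β-comm x (A i)) i⊥x)) (zeroˡ _)))
      from x (inj₂ (j⊥x , y⊥x)) = y⊥x , x*y≡0⇒y≡0 (β-A≢ i≢j) (trans (tangent-quadric i≢j i⊥y j⊥y x y⊥x)
        (*0 _ (trans (β-comm x (A j)) j⊥x)))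

-- Numbers of points

module Classes (S : FieldWithAutomorphism) (3≤q : 3 ℕ.≤ Finite.card (FieldWithAutomorphism.finite S)) where

  open Geometry S
  open Counts S 3≤q

  private
    first : K → K → K
    first a x with a ≟ᴷ 0#
    ... | yes _ = x
    ... | no _  = a

    first-* : ∀ {k} a x → k ≢ 0# → first (k * a) (k * x) ≡ k * first a x
    first-* {k} a x k≢0 with a ≟ᴷ 0# | (k * a) ≟ᴷ 0#
    ... | yes _   | yes _    = refl
    ... | yes a≡0 | no ka≢0  = contradiction (*0 k a≡0) ka≢0
    ... | no a≢0  | yes ka≡0 = contradiction ka≡0 (x*y≢0 k≢0 a≢0)
    ... | no _    | no _     = refl

    first-≡0 : ∀ a x → first a x ≡ 0# → a ≡ 0# × x ≡ 0#
    first-≡0 a x eq with a ≟ᴷ 0#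
    ... | yes a≡0 = a≡0 , eq
    ... | no a≢0  = contradiction eq a≢0

    first-0 : ∀ x → first 0# x ≡ x
    first-0 x with 0# ≟ᴷ 0#
    ... | yes _  = refl
    ... | no 0≢0 = contradiction refl 0≢0

    first-1 : ∀ x → first 1# x ≡ 1#
    first-1 x with 1# ≟ᴷ 0#
    ... | yes 1≡0 = contradiction 1≡0 1≢0
    ... | no _    = refl

  lead : V → K
  lead (a , b , c , d) = first a (first b (first c d))

  lead-· : ∀ {k} y → k ≢ 0# → lead (k · y) ≡ k * lead y
  lead-· {k} (a , b , c , d) k≢0 = begin
    first (k * a) (first (k * b) (first (k * c) (k * d)))
      ≡⟨ cong (λ x → first (k * a) (first (k * b) x)) (first-* c d k≢0) ⟩
    first (k * a) (first (k * b) (k * first c d))   ≡⟨ cong (first (k * a)) (first-* b _ k≢0) ⟩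
    first (k * a) (k * first b (first c d))         ≡⟨ first-* a _ k≢0 ⟩
    k * lead (a , b , c , d)                        ∎
    where open ≡-Reasoning

  lead≡0⇒≡𝟎 : ∀ {y} → lead y ≡ 0# → y ≡ 𝟎
  lead≡0⇒≡𝟎 {a , b , c , d} eq =
    let a≡0 , eq₁ = first-≡0 a _ eq
        b≡0 , eq₂ = first-≡0 b _ eq₁
        c≡0 , d≡0 = first-≡0 c d eq₂
    in tuple≡ a≡0 b≡0 c≡0 d≡0

  lead-𝟎 : lead 𝟎 ≡ 0#
  lead-𝟎 = trans (first-0 _) (trans (first-0 _) (first-0 _))

  lead-A : ∀ i → lead (A i) ≡ 1#
  lead-A nothing  = trans (first-0 _) (trans (first-0 _) (first-0 _))
  lead-A (just t) = first-1 _

  -- The points of PG(3, q) are represented by the vectors whose first nonzero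
  -- coordinate is 1.
  Normal : V → Set
  Normal y = lead y ≡ 1#

  normal? : Decidable Normal
  normal? y = lead y ≟ᴷ 1#

  Normal⇒≢𝟎 : ∀ {y} → Normal y → y ≢ 𝟎
  Normal⇒≢𝟎 normal refl = 1≢0 (trans (sym normal) lead-𝟎)

  normal-· : ∀ {k x y} → Normal x → Normal y → x ≡ k · y → x ≡ y
  normal-· {k} {x} {y} normal-x normal-y x≡ky = case k ≟ᴷ 0# of λ
    { (yes refl) → contradiction (trans x≡ky (0· y)) (Normal⇒≢𝟎 normal-x)
    ; (no k≢0)   → trans x≡ky (trans (cong (_· y) (begin
        k              ≡⟨ *-identityʳ k ⟨
        k * 1#         ≡⟨ cong (k *_) normal-y ⟨
        k * lead y     ≡⟨ lead-· y k≢0 ⟨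
        lead (k · y)   ≡⟨ cong lead x≡ky ⟨
        lead x         ≡⟨ normal-x ⟩
        1#             ∎)) (1· y)) }
    where open ≡-Reasoning

  normalize : ∀ {y} → y ≢ 𝟎 → ∃ λ k → k ≢ 0# × Normal (k · y)
  normalize {y} y≢𝟎 = inv (lead y) , inv≢0 lead≢0 , trans (lead-· y (inv≢0 lead≢0)) (inv-* lead≢0)
    where
    lead≢0 : lead y ≢ 0#
    lead≢0 = y≢𝟎 ∘ lead≡0⇒≡𝟎

  #ᴾ : ∀ {W : V → Set} → Decidable W → ℕ
  #ᴾ W? = # finiteV λ y → normal? y ×-dec W? y

  -- Every nonzero vector has exactly one normal multiple, so `N` points account for `1 + (q - 1) N`
  -- vectors; the equation is written free of subtraction.
  #-projective : ∀ {W : V → Set} (W? : Decidable W) → W 𝟎 → (∀ k y → W y → W (k · y)) →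
                 # finiteV W? ℕ.+ #ᴾ W? ≡ 1 ℕ.+ q ℕ.* #ᴾ W?
  #-projective {W} W? W𝟎 W-· = begin
    # finiteV W? ℕ.+ #ᴾ W?
      ≡⟨ cong (ℕ._+ #ᴾ W?) (trans (∑-cong finiteV fibre) (∑-+ finiteV (λ y → ⟦ 𝟎 ≟ⱽ y ⟧) _)) ⟩
    # finiteV (𝟎 ≟ⱽ_) ℕ.+ ∑ finiteV (λ y → # finite λ k → point? k y) ℕ.+ #ᴾ W?
      ≡⟨ cong₂ (λ m n → m ℕ.+ n ℕ.+ #ᴾ W?) (#≡ finiteV 𝟎) (∑-comm finiteV finite _) ⟩
    1 ℕ.+ ∑ finite (λ k → # finiteV (point? k)) ℕ.+ #ᴾ W?
      -- The scalar 0 contributes no vector. The extra copy of `#ᴾ W?` is assigned to it, which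
      -- makes all `q` terms equal.
      ≡⟨ cong suc (cong (∑ finite (λ k → # finiteV (point? k)) ℕ.+_) (sym (∑-δ finite (λ _ → #ᴾ W?) 0#))) ⟩
    1 ℕ.+ (∑ finite (λ k → # finiteV (point? k)) ℕ.+ ∑ finite (λ k → ⟦ 0# ≟ᴷ k ⟧ ℕ.* #ᴾ W?))
      ≡⟨ cong suc (trans (sym (∑-+ finite (λ k → # finiteV (point? k)) _)) (∑-cong finite scaled)) ⟩
    1 ℕ.+ ∑ finite (λ _ → #ᴾ W?)   ≡⟨ cong suc (∑ᴷ-const _) ⟩
    1 ℕ.+ q ℕ.* #ᴾ W?              ∎
    where
    open ≡-Reasoning
    point? : ∀ k y → Dec (k ≢ 0# × (Normal (k · y) × W (k · y)))
    point? k y = ¬? (k ≟ᴷ 0#) ×-dec (normal? (k · y) ×-dec W? (k · y))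

    fibre : ∀ y → ⟦ W? y ⟧ ≡ ⟦ 𝟎 ≟ⱽ y ⟧ ℕ.+ # finite λ k → point? k y
    fibre y = case 𝟎 ≟ⱽ y of λ
      { (yes refl) → trans (⟦⟧-yes (W? 𝟎) W𝟎) (sym (cong₂ ℕ._+_ (⟦⟧-yes (𝟎 ≟ⱽ 𝟎) refl)
          (#-empty finite _ λ k (_ , normal , _) → Normal⇒≢𝟎 normal (·𝟎 k))))
      ; (no 𝟎≢y)   → trans (nonzero 𝟎≢y (W? y)) (cong (ℕ._+ # finite (λ k → point? k y)) (sym (⟦⟧-no (𝟎 ≟ⱽ y) 𝟎≢y))) }
      where
      nonzero : 𝟎 ≢ y → (Wy? : Dec (W y)) → ⟦ Wy? ⟧ ≡ # finite λ k → point? k y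
      nonzero 𝟎≢y (no ¬Wy) = sym (#-empty finite _ λ k (k≢0 , _ , Wky) → ¬Wy (subst W (inv-·-· y k≢0) (W-· (inv k) _ Wky)))
      nonzero 𝟎≢y (yes Wy) = let k , k≢0 , normal = normalize (𝟎≢y ∘ sym) in
        sym (#-unique finite _ (k≢0 , normal , W-· k y Wy) λ l (l≢0 , normal-l , _) →
          *-cancelˡ (𝟎≢y ∘ sym ∘ lead≡0⇒≡𝟎) (trans (*-comm (lead y) k) (trans (sym (lead-· y k≢0))
            (trans (trans normal (sym normal-l)) (trans (lead-· y l≢0) (*-comm l _))))))

    scaled : ∀ k → # finiteV (point? k) ℕ.+ ⟦ 0# ≟ᴷ k ⟧ ℕ.* #ᴾ W? ≡ #ᴾ W?
    scaled k = case 0# ≟ᴷ k of λ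
      { (yes refl) → cong₂ ℕ._+_ (#-empty finiteV (point? 0#) λ y (0≢0 , _) → 0≢0 refl)
          (trans (cong (ℕ._* #ᴾ W?) (⟦⟧-yes (0# ≟ᴷ 0#) refl)) (ℕ.+-identityʳ _))
      ; (no 0≢k)   → trans (cong₂ ℕ._+_ (unit (0≢k ∘ sym)) (cong (ℕ._* #ᴾ W?) (⟦⟧-no (0# ≟ᴷ k) 0≢k))) (ℕ.+-identityʳ _) }
      where
      unit : k ≢ 0# → # finiteV (point? k) ≡ #ᴾ W?
      unit k≢0 = trans (#-cong finiteV (point? k) (λ y → normal? (k · y) ×-dec W? (k · y)) (λ y → proj₂) (λ y → k≢0 ,_))
        (∑-reindex finiteV finiteV (k ·_) (inv k ·_)
          (λ y → trans (·-assoc k (inv k) y) (trans (cong (_· y) (trans (*-comm k (inv k)) (inv-* k≢0))) (1· y)))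
          (λ y → inv-·-· y k≢0) _)

  -- The equation is linear in `N` with coefficient `q - 1`, which is not 0, so it suffices to check
  -- a candidate.
  #-projective-unique : ∀ {W : V → Set} (W? : Decidable W) → W 𝟎 → (∀ k y → W y → W (k · y)) →
                        ∀ {w} N → # finiteV W? ≡ w → w ℕ.+ N ≡ 1 ℕ.+ q ℕ.* N → #ᴾ W? ≡ N
  #-projective-unique W? W𝟎 W-· {w} N refl eq = cancel q (#ᴾ W?) N (proj₁ q≡3+) (proj₂ q≡3+) (ℕ.suc-injective (begin
    1 ℕ.+ (q ℕ.* #ᴾ W? ℕ.+ N)    ≡⟨ cong (ℕ._+ N) (#-projective W? W𝟎 W-·) ⟨
    w ℕ.+ #ᴾ W? ℕ.+ N            ≡⟨ swap w (#ᴾ W?) N ⟩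
    w ℕ.+ N ℕ.+ #ᴾ W?            ≡⟨ cong (ℕ._+ #ᴾ W?) eq ⟩
    1 ℕ.+ (q ℕ.* N ℕ.+ #ᴾ W?)    ∎))
    where
    open ≡-Reasoning
    swap : ∀ a b c → a ℕ.+ b ℕ.+ c ≡ a ℕ.+ c ℕ.+ b
    swap = solve-∀
    cancel : ∀ q M N r → q ≡ 3 ℕ.+ r → q ℕ.* M ℕ.+ N ≡ q ℕ.* N ℕ.+ M → M ≡ N
    cancel q M N r refl eq = ℕ.*-cancelˡ-≡ M N (2 ℕ.+ r) (ℕ.+-cancelʳ-≡ (M ℕ.+ N) _ _
      (trans (expand r M N) (trans eq (trans (sym (expand r N M)) (cong ((2 ℕ.+ r) ℕ.* N ℕ.+_) (ℕ.+-comm N M))))))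
      where
      expand : ∀ r M N → (2 ℕ.+ r) ℕ.* M ℕ.+ (M ℕ.+ N) ≡ (3 ℕ.+ r) ℕ.* M ℕ.+ N
      expand = solve-∀

  ⊥-· : ∀ u k y → β u y ≡ 0# → β u (k · y) ≡ 0#
  ⊥-· u k y u⊥y = trans (β-· u k y) (*0 k u⊥y)

  #ᴾ⊥ : ∀ {u} → u ≢ 𝟎 → #ᴾ (u ⊥?_) ≡ 1 ℕ.+ q ℕ.+ q ℕ.* q
  #ᴾ⊥ {u} u≢𝟎 = #-projective-unique (u ⊥?_) (β-𝟎 u) (⊥-· u) _ (#⊥ u≢𝟎) (identity q)
    where
    identity : ∀ q → q ℕ.* (q ℕ.* q) ℕ.+ (1 ℕ.+ q ℕ.+ q ℕ.* q) ≡ 1 ℕ.+ q ℕ.* (1 ℕ.+ q ℕ.+ q ℕ.* q)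
    identity = solve-∀

  private
    line : ∀ q → q ℕ.* q ℕ.+ (1 ℕ.+ q) ≡ 1 ℕ.+ q ℕ.* (1 ℕ.+ q)
    line = solve-∀

  #ᴾ⊥A : ∀ {y} → Off y → ∀ i → #ᴾ (λ x → (A i ⊥? x) ×-dec (y ⊥? x)) ≡ 1 ℕ.+ q
  #ᴾ⊥A {y} off i = #-projective-unique (λ x → (A i ⊥? x) ×-dec (y ⊥? x)) (β-𝟎 (A i) , β-𝟎 y)
    (λ k x (i⊥x , y⊥x) → ⊥-· (A i) k x i⊥x , ⊥-· y k x y⊥x) _ (#⊥A off i) (line q)

  -- One formula for three cases: equal parameters and a chord through `y` both give a line of
  -- `1 + q` points, every other pair a single point. The sum over all ordered pairs then needs no
  -- separate diagonal.
  #ᴾ⊥AA : ∀ {y} → Off y → ∀ i j → #ᴾ (λ x → ((A i ⊥? x) ×-dec (A j ⊥? x)) ×-dec (y ⊥? x)) ≡ 1 ℕ.+ q ℕ.* ⟦ π i j y ≟ⱽ 𝟎 ⟧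
  #ᴾ⊥AA {y} off i j = case i ≟ᴵ j of λ
    { (yes refl) → trans (#-cong finiteV _ (λ x → normal? x ×-dec ((A i ⊥? x) ×-dec (y ⊥? x)))
        (λ x (n , (i⊥x , _) , y⊥x) → n , i⊥x , y⊥x) (λ x (n , i⊥x , y⊥x) → n , (i⊥x , i⊥x) , y⊥x))
        (trans (#ᴾ⊥A off i) (sym (chord (π-diagonal i y))))
    ; (no i≢j)   → case π i j y ≟ⱽ 𝟎 of λ
      { (yes πy≡𝟎) → trans (points (1 ℕ.+ q) (#⊥AA-chord i≢j πy≡𝟎) (line q)) (sym (chord πy≡𝟎))
      ; (no πy≢𝟎)  → trans (points 1 (#⊥AA-general i≢j πy≢𝟎) (trans (ℕ.+-comm q 1) (cong suc (sym (ℕ.*-identityʳ q)))))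
          (sym (cong suc (trans (cong (q ℕ.*_) (⟦⟧-no (π i j y ≟ⱽ 𝟎) πy≢𝟎)) (ℕ.*-zeroʳ q)))) } }
    where
    W? : ∀ x → Dec ((β (A i) x ≡ 0# × β (A j) x ≡ 0#) × β y x ≡ 0#)
    W? x = ((A i ⊥? x) ×-dec (A j ⊥? x)) ×-dec (y ⊥? x)

    points : ∀ N {w} → # finiteV W? ≡ w → w ℕ.+ N ≡ 1 ℕ.+ q ℕ.* N → #ᴾ W? ≡ N
    points N = #-projective-unique W? ((β-𝟎 (A i) , β-𝟎 (A j)) , β-𝟎 y)
      (λ k x ((i⊥x , j⊥x) , y⊥x) → (⊥-· (A i) k x i⊥x , ⊥-· (A j) k x j⊥x) , ⊥-· y k x y⊥x) N

    chord : π i j y ≡ 𝟎 → 1 ℕ.+ q ℕ.* ⟦ π i j y ≟ⱽ 𝟎 ⟧ ≡ 1 ℕ.+ q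
    chord πy≡𝟎 = cong suc (trans (cong (q ℕ.*_) (⟦⟧-yes (π i j y ≟ⱽ 𝟎) πy≡𝟎)) (ℕ.*-identityʳ q))

  private
    #ᴾ⊥Q-unique : ∀ y N {w} → # finiteV (λ x → (y ⊥? x) ×-dec (Q x ≟ᴷ 0#)) ≡ w → w ℕ.+ N ≡ 1 ℕ.+ q ℕ.* N →
                  #ᴾ (λ x → (y ⊥? x) ×-dec (Q x ≟ᴷ 0#)) ≡ N
    #ᴾ⊥Q-unique y N = #-projective-unique (λ x → (y ⊥? x) ×-dec (Q x ≟ᴷ 0#))
      (β-𝟎 y , trans (cong₂ _+_ (zeroʳ 0#) (zeroʳ 0#)) (x+x≡0 0#))
      (λ k x (y⊥x , Qx≡0) → ⊥-· y k x y⊥x , trans (Q-· k x) (*0 _ Qx≡0)) N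

  #ᴾ⊥Q : ∀ {y} → Q y ≢ 0# → #ᴾ (λ x → (y ⊥? x) ×-dec (Q x ≟ᴷ 0#)) ≡ 1 ℕ.+ q
  #ᴾ⊥Q {y} Qy≢0 = #ᴾ⊥Q-unique y _ (#⊥Q Qy≢0) (line q)

  #ᴾ⊥Q-tangent : ∀ {y} → Q y ≡ 0# → Off y → ∀ {i j} → i ≢ j → Root y i → Root y j →
                 #ᴾ (λ x → (y ⊥? x) ×-dec (Q x ≟ᴷ 0#)) ≡ 1 ℕ.+ 2 ℕ.* q
  #ᴾ⊥Q-tangent {y} Qy≡0 off i≢j i⊥y j⊥y = #ᴾ⊥Q-unique y _ refl (ℕ.+-cancelʳ-≡ q _ _ (begin
    W ℕ.+ (1 ℕ.+ 2 ℕ.* q) ℕ.+ q       ≡⟨ swap W (1 ℕ.+ 2 ℕ.* q) q ⟩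
    W ℕ.+ q ℕ.+ (1 ℕ.+ 2 ℕ.* q)       ≡⟨ cong (ℕ._+ (1 ℕ.+ 2 ℕ.* q)) (#⊥Q-tangent Qy≡0 off i≢j i⊥y j⊥y) ⟩
    q ℕ.* q ℕ.+ q ℕ.* q ℕ.+ (1 ℕ.+ 2 ℕ.* q)  ≡⟨ identity q ⟩
    1 ℕ.+ q ℕ.* (1 ℕ.+ 2 ℕ.* q) ℕ.+ q ∎))
    where
    open ≡-Reasoning
    W = # finiteV (λ x → (y ⊥? x) ×-dec (Q x ≟ᴷ 0#))
    swap : ∀ a b c → a ℕ.+ b ℕ.+ c ≡ a ℕ.+ c ℕ.+ b
    swap = solve-∀
    identity : ∀ q → q ℕ.* q ℕ.+ q ℕ.* q ℕ.+ (1 ℕ.+ 2 ℕ.* q) ≡ 1 ℕ.+ q ℕ.* (1 ℕ.+ 2 ℕ.* q) ℕ.+ q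
    identity = solve-∀

  z≤3 : ∀ {y} → y ≢ 𝟎 → z y ℕ.≤ 3
  z≤3 {y} y≢𝟎 = case Q y ≟ᴷ 0# of λ
    { (no Qy≢0) → case z-nonquadric Qy≢0 of λ
      { (inj₁ z≡0)        → subst (ℕ._≤ 3) (sym z≡0) z≤n
      ; (inj₂ (inj₁ z≡1)) → subst (ℕ._≤ 3) (sym z≡1) (s≤s z≤n)
      ; (inj₂ (inj₂ z≡3)) → ℕ.≤-reflexive z≡3 }
    ; (yes Qy≡0) → case off-or-on y of λ
      { (inj₁ off)            → subst (ℕ._≤ 3) (sym (z-quadric Qy≡0 off)) (s≤s (s≤s z≤n))
      ; (inj₂ (i , k , y≡kA)) → subst (ℕ._≤ 3) (sym (trans (cong z y≡kA) (trans
          (z-· (A i) λ { refl → y≢𝟎 (trans y≡kA (0· (A i))) }) (z-A i)))) (s≤s z≤n) } }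

  -- No four points of the curve are coplanar.
  four-roots : ∀ {y i j k l} → Root y i → Root y j → Root y k → Root y l →
               i ≢ j → ¬ (i ≡ k ⊎ j ≡ k) → ¬ (i ≡ l ⊎ j ≡ l ⊎ k ≡ l) → y ≡ 𝟎
  four-roots {y} {i} {j} {k} {l} ri rj rk rl i≢j ≢k ≢l = case y ≟ⱽ 𝟎 of λ
    { (yes y≡𝟎) → y≡𝟎
    ; (no y≢𝟎)  → contradiction (ℕ.≤-trans four (z≤3 y≢𝟎)) (ℕ.<⇒≱ (s≤s (s≤s (s≤s (s≤s z≤n))))) }
    where
    open ℕ.≤-Reasoning
    i∨j? : ∀ x → Dec (i ≡ x ⊎ j ≡ x)
    i∨j? x = (i ≟ᴵ x) ⊎-dec (j ≟ᴵ x)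
    i∨j∨k? : ∀ x → Dec ((i ≡ x ⊎ j ≡ x) ⊎ k ≡ x)
    i∨j∨k? x = i∨j? x ⊎-dec (k ≟ᴵ x)
    any-of? : ∀ x → Dec (((i ≡ x ⊎ j ≡ x) ⊎ k ≡ x) ⊎ l ≡ x)
    any-of? x = i∨j∨k? x ⊎-dec (l ≟ᴵ x)
    four : 4 ℕ.≤ z y
    four = begin
      4  ≡⟨ cong₂ ℕ._+_ (cong₂ ℕ._+_ (cong₂ ℕ._+_ (#≡ finiteI i) (#≡ finiteI j)) (#≡ finiteI k)) (#≡ finiteI l) ⟨
      # finiteI (i ≟ᴵ_) ℕ.+ # finiteI (j ≟ᴵ_) ℕ.+ # finiteI (k ≟ᴵ_) ℕ.+ # finiteI (l ≟ᴵ_)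
         ≡⟨ cong (λ m → m ℕ.+ # finiteI (k ≟ᴵ_) ℕ.+ # finiteI (l ≟ᴵ_))
              (#-⊎-disjoint finiteI (i ≟ᴵ_) (j ≟ᴵ_) λ x i≡x j≡x → i≢j (trans i≡x (sym j≡x))) ⟨
      # finiteI i∨j? ℕ.+ # finiteI (k ≟ᴵ_) ℕ.+ # finiteI (l ≟ᴵ_)
         ≡⟨ cong (ℕ._+ # finiteI (l ≟ᴵ_)) (#-⊎-disjoint finiteI i∨j? (k ≟ᴵ_) λ { x p refl → ≢k p }) ⟨
      # finiteI i∨j∨k? ℕ.+ # finiteI (l ≟ᴵ_)
         ≡⟨ #-⊎-disjoint finiteI i∨j∨k? (l ≟ᴵ_) (λ { x p refl → ≢l (Sum.assocʳ p) }) ⟨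
      # finiteI any-of?
         ≤⟨ #-≤ finiteI any-of? (root? y) (λ { x (inj₁ (inj₁ (inj₁ refl))) → ri ; x (inj₁ (inj₁ (inj₂ refl))) → rj
              ; x (inj₁ (inj₂ refl)) → rk ; x (inj₂ refl) → rl }) ⟩
      z y ∎

  -- At least `q` vectors are orthogonal to the three curve vectors, so one of them is not `𝟎`.
  plane-through : ∀ i j k → i ≢ j → ∃ λ y → y ≢ 𝟎 × Root y i × Root y j × Root y k
  plane-through i j k i≢j = case any? finiteV (λ y → ¬? (y ≟ⱽ 𝟎) ×-dec W? y) of λ
    { (yes (y , y≢𝟎 , (ri , rj) , rk)) → y , y≢𝟎 , ri , rj , rk
    ; (no ¬∃) → contradiction (ℕ.≤-trans size (ℕ.≤-trans (#-≤ finiteV W? (𝟎 ≟ⱽ_) (λ y Wy → case y ≟ⱽ 𝟎 of λ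
        { (yes y≡𝟎) → sym y≡𝟎 ; (no y≢𝟎) → contradiction (y , y≢𝟎 , Wy) ¬∃ })) (ℕ.≤-reflexive (#≡ finiteV 𝟎))))
        (ℕ.<⇒≱ (ℕ.≤-trans (s≤s (s≤s z≤n)) 3≤q)) }
    where
    W? : ∀ x → Dec ((β (A i) x ≡ 0# × β (A j) x ≡ 0#) × β (A k) x ≡ 0#)
    W? x = ((A i ⊥? x) ×-dec (A j ⊥? x)) ×-dec (A k ⊥? x)
    size : q ℕ.≤ # finiteV W?
    size = case π i j (A k) ≟ⱽ 𝟎 of λ
      { (yes π≡𝟎) → subst (q ℕ.≤_) (sym (#⊥AA-chord i≢j π≡𝟎)) (ℕ.m≤m*n q q {{ℕ.>-nonZero (ℕ.≤-trans (s≤s z≤n) 3≤q)}})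
      ; (no π≢𝟎)  → ℕ.≤-reflexive (sym (#⊥AA-general i≢j π≢𝟎)) }

  -- Chords of the curve through a point

  module _ {y} (off : Off y) where

    private
      -- A point of the chord off the curve has a nonzero `A j` coefficient, so a plane through it
      -- and `A i` contains `A j`.
      chord-⊥ : ∀ {i j x} → i ≢ j → π i j y ≡ 𝟎 → Root x i → β x y ≡ 0# → Root x j
      chord-⊥ {i} {j} {x} i≢j πy≡𝟎 i⊥x x⊥y = trans (β-comm (A j) x)
        (x*y≡0⇒y≡0 (λ yi≡0 → chord-root i≢j πy≡𝟎 (trans (β-comm (A i) y) yi≡0) off) (begin
          β y (A i) * β x (A j)  ≡⟨ solve 3 (λ p r s → s := p :* con false :+ r :* con false :+ s) refl (β (A i) (A j)) (β y (A j)) _ ⟩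
          β (A i) (A j) * 0# + β y (A j) * 0# + β y (A i) * β x (A j)
            ≡⟨ cong₂ (λ p r → β (A i) (A j) * p + β y (A j) * r + β y (A i) * β x (A j)) x⊥y (trans (β-comm x (A i)) i⊥x) ⟨
          β (A i) (A j) * β x y + β y (A j) * β x (A i) + β y (A i) * β x (A j) ≡⟨ β-π x i j y ⟨
          β x (π i j y)          ≡⟨ trans (cong (β x) πy≡𝟎) (β-𝟎 x) ⟩
          0#                     ∎))
        where open ≡-Reasoning

      ⊥-chord : ∀ {i j x} → i ≢ j → π i j y ≡ 𝟎 → Root x i → Root x j → β x y ≡ 0#
      ⊥-chord {i} {j} {x} i≢j πy≡𝟎 i⊥x j⊥x = x*y≡0⇒y≡0 (β-A≢ i≢j) (begin
        b * β x y                       ≡⟨ solve 3 (λ p r s → p := p :+ r :* con false :+ s :* con false) refl _ (β y (A j)) (β y (A i)) ⟩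
        b * β x y + β y (A j) * 0# + β y (A i) * 0#
          ≡⟨ cong₂ (λ p r → b * β x y + β y (A j) * p + β y (A i) * r) (trans (β-comm x (A i)) i⊥x) (trans (β-comm x (A j)) j⊥x) ⟨
        b * β x y + β y (A j) * β x (A i) + β y (A i) * β x (A j) ≡⟨ β-π x i j y ⟨
        β x (π i j y)                   ≡⟨ trans (cong (β x) πy≡𝟎) (β-𝟎 x) ⟩
        0#                              ∎)
        where
        open ≡-Reasoning
        b = β (A i) (A j)

      -- Otherwise the plane through both chords, or through the chord kl and a
      -- further point of the curve if the chords meet on the curve, has four roots.
      chord-meets : ∀ {i j k l} → i ≢ j → k ≢ l → π i j y ≡ 𝟎 → π k l y ≡ 𝟎 → k ≡ j ⊎ l ≡ j
      chord-meets {i} {j} {k} {l} i≢j k≢l πij πkl = case (k ≟ᴵ j) ⊎-dec (l ≟ᴵ j) of λ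
        { (yes p) → p
        ; (no ≢j) → case (k ≟ᴵ i) ⊎-dec (l ≟ᴵ i) of λ
          { (no ≢i) → let x , x≢𝟎 , rk , rl , ri = plane-through k l i k≢l in contradiction
              (four-roots rk rl ri (chord-⊥ i≢j πij ri (⊥-chord k≢l πkl rk rl)) k≢l ≢i
                λ { (inj₁ k≡j) → ≢j (inj₁ k≡j) ; (inj₂ (inj₁ l≡j)) → ≢j (inj₂ l≡j) ; (inj₂ (inj₂ i≡j)) → i≢j i≡j }) x≢𝟎
          ; (yes i∈kl) → let
              m , ≢m = other k l j
              x , x≢𝟎 , rk , rl , rm = plane-through k l m k≢l
              ri = [ (λ { refl → rk }) , (λ { refl → rl }) ]′ i∈kl
            in contradiction (four-roots rk rl (chord-⊥ i≢j πij ri (⊥-chord k≢l πkl rk rl)) rm k≢l ≢j ≢m) x≢𝟎 } }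

    -- `chord-meets`, applied to the first chord and to its reversal, shows that the second chord
    -- contains both of its ends.
    chord-unique : ∀ {i j k l} → i ≢ j → k ≢ l → π i j y ≡ 𝟎 → π k l y ≡ 𝟎 → (k , l) ≡ (i , j) ⊎ (k , l) ≡ (j , i)
    chord-unique {i} {j} {k} {l} i≢j k≢l πij πkl = case chord-meets i≢j k≢l πij πkl of λ
      { (inj₁ k≡j) → inj₂ (cong₂ _,_ k≡j ([ (λ k≡i → contradiction (trans (sym k≡i) k≡j) i≢j) , id ]′ meets-i))
      ; (inj₂ l≡j) → inj₁ (cong₂ _,_ ([ id , (λ l≡i → contradiction (trans (sym l≡i) l≡j) i≢j) ]′ meets-i) l≡j) }
      where
      meets-i : k ≡ i ⊎ l ≡ i
      meets-i = chord-meets (i≢j ∘ sym) k≢l (trans (π-sym j i y) πij) πkl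

  finiteI² : Finite (I × I)
  finiteI² = finite× finiteI finiteI

  private
    #diagonal : # finiteI² (λ (i , j) → i ≟ᴵ j) ≡ 1 ℕ.+ q
    #diagonal = trans (∑-× finiteI finiteI (λ (i , j) → ⟦ i ≟ᴵ j ⟧)) (trans (∑-cong finiteI λ i → #≡ finiteI i) (trans (∑ᴵ-const 1) (ℕ.*-identityʳ _)))

  -- Diagonal pairs always satisfy π i i y ≡ 𝟎.
  #chords : V → ℕ
  #chords y = # finiteI² λ (i , j) → π i j y ≟ⱽ 𝟎

  #chords-quadric : ∀ {y} → Q y ≡ 0# → Off y → #chords y ≡ 1 ℕ.+ q
  #chords-quadric {y} Qy≡0 off = trans (#-cong finiteI² (λ (i , j) → π i j y ≟ⱽ 𝟎) (λ (i , j) → i ≟ᴵ j)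
    (λ (i , j) π≡𝟎 → case i ≟ᴵ j of λ { (yes i≡j) → i≡j ; (no i≢j) → contradiction π≡𝟎 (chord-off-quadric Qy≡0 off i≢j) })
    (λ { (i , _) refl → π-diagonal i y })) #diagonal

  -- The diagonal gives `1 + q` ordered pairs, and the chord, if there is one, adds its two
  -- orderings.
  #chords-off : ∀ {y} → Off y → #chords y ≡ 1 ℕ.+ q ⊎ #chords y ≡ 3 ℕ.+ q
  #chords-off {y} off = case any? finiteI² (λ (i , j) → ¬? (i ≟ᴵ j) ×-dec (π i j y ≟ⱽ 𝟎)) of λ
    { (no ¬∃) → inj₁ (trans (#-cong finiteI² (λ (i , j) → π i j y ≟ⱽ 𝟎) (λ (i , j) → i ≟ᴵ j)
        (λ (i , j) π≡𝟎 → case i ≟ᴵ j of λ { (yes i≡j) → i≡j ; (no i≢j) → contradiction ((i , j) , i≢j , π≡𝟎) ¬∃ })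
        (λ { (i , _) refl → π-diagonal i y })) #diagonal)
    ; (yes ((i , j) , i≢j , π≡𝟎)) → inj₂ (one i≢j π≡𝟎) }
    where
    one : ∀ {i j} → i ≢ j → π i j y ≡ 𝟎 → #chords y ≡ 3 ℕ.+ q
    one {i} {j} i≢j πij = begin
      #chords y  ≡⟨ #-cong finiteI² (λ (k , l) → π k l y ≟ⱽ 𝟎) (λ p → diagonal? p ⊎-dec chord? p) to from ⟩
      # finiteI² (λ p → diagonal? p ⊎-dec chord? p)
        ≡⟨ #-⊎-disjoint finiteI² diagonal? chord? (λ { _ refl (inj₁ refl) → i≢j refl ; _ refl (inj₂ refl) → i≢j refl }) ⟩
      # finiteI² diagonal? ℕ.+ # finiteI² chord?
        ≡⟨ cong₂ ℕ._+_ #diagonal (trans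
             (#-⊎-disjoint finiteI² ((i , j) ≟_) ((j , i) ≟_) (λ { _ refl refl → i≢j refl }))
             (cong₂ ℕ._+_ (#≡ finiteI² (i , j)) (#≡ finiteI² (j , i)))) ⟩
      1 ℕ.+ q ℕ.+ 2  ≡⟨ ℕ.+-comm (1 ℕ.+ q) 2 ⟩
      3 ℕ.+ q        ∎
      where
      open ≡-Reasoning
      open Finite finiteI² using (_≟_)
      diagonal? : ∀ p → Dec (proj₁ p ≡ proj₂ p)
      diagonal? (k , l) = k ≟ᴵ l
      chord? : ∀ p → Dec ((i , j) ≡ p ⊎ (j , i) ≡ p)
      chord? p = ((i , j) ≟ p) ⊎-dec ((j , i) ≟ p)
      to : ∀ p → π (proj₁ p) (proj₂ p) y ≡ 𝟎 → proj₁ p ≡ proj₂ p ⊎ ((i , j) ≡ p ⊎ (j , i) ≡ p)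
      to (k , l) πkl = case k ≟ᴵ l of λ
        { (yes k≡l) → inj₁ k≡l
        ; (no k≢l)  → inj₂ (Sum.map sym sym (chord-unique off i≢j k≢l πij πkl)) }
      from : ∀ p → proj₁ p ≡ proj₂ p ⊎ ((i , j) ≡ p ⊎ (j , i) ≡ p) → π (proj₁ p) (proj₂ p) y ≡ 𝟎
      from (k , _) (inj₁ refl) = π-diagonal k y
      from _ (inj₂ (inj₁ refl)) = πij
      from _ (inj₂ (inj₂ refl)) = trans (π-sym j i y) πij

  -- nothing is the class of the curve itself.
  Index : Set
  Index = Maybe (Fin 4)

  finiteIndex : Finite Index
  finiteIndex = finiteMaybe (finiteFin 4)

  OnCurve : V → Set
  OnCurve y = ∃ λ i → y ≡ A i

  onCurve? : Decidable OnCurve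
  onCurve? y = any? finiteI λ i → y ≟ⱽ A i

  Class : Index → V → Set
  Class nothing  y = OnCurve y
  Class (just k) y = ¬ OnCurve y × z y ≡ toℕ k

  class? : ∀ d → Decidable (Class d)
  class? nothing  y = onCurve? y
  class? (just k) y = ¬? (onCurve? y) ×-dec (z y ℕ.≟ toℕ k)

  class-unique : ∀ {d e y} → Class d y → Class e y → d ≡ e
  class-unique {nothing} {nothing} _         _         = refl
  class-unique {nothing} {just l}  on        (off , _) = contradiction on off
  class-unique {just k}  {nothing} (off , _) on        = contradiction on off
  class-unique {just k}  {just l}  (_ , z≡k) (_ , z≡l) = cong just (Fin.toℕ-injective (trans (sym z≡k) z≡l))

  roots : Index → ℕ
  roots nothing  = 1
  roots (just k) = toℕ k

  -- The weight at `2F` records that a point off the curve is on the quadric exactly when two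
  -- osculating planes contain it.
  inQuadric : Index → ℕ
  inQuadric nothing   = 1
  inQuadric (just 2F) = 1
  inQuadric (just _)  = 0

  off-curve : ∀ {y} → Normal y → ¬ OnCurve y → Off y
  off-curve normal ¬on i k y≡kA = ¬on (i , normal-· normal (lead-A i) y≡kA)

  classify : ∀ y → Normal y → ∃ λ d → Class d y × z y ≡ roots d × ⟦ Q y ≟ᴷ 0# ⟧ ≡ inQuadric d
  classify y normal = case onCurve? y of λ
    { (yes on) → nothing , on , trans (cong z (proj₂ on)) (z-A (proj₁ on)) ,
        ⟦⟧-yes (Q y ≟ᴷ 0#) (trans (cong Q (proj₂ on)) (Q-A (proj₁ on)))
    ; (no ¬on) → case Q y ≟ᴷ 0# of λ
      { (yes Qy≡0) → off-class ¬on 2F (z-quadric Qy≡0 (off-curve normal ¬on)) (⟦⟧-yes (Q y ≟ᴷ 0#) Qy≡0)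
      ; (no Qy≢0) → case z-nonquadric Qy≢0 of λ
        { (inj₁ z≡0)        → off-class ¬on 0F z≡0 (⟦⟧-no (Q y ≟ᴷ 0#) Qy≢0)
        ; (inj₂ (inj₁ z≡1)) → off-class ¬on 1F z≡1 (⟦⟧-no (Q y ≟ᴷ 0#) Qy≢0)
        ; (inj₂ (inj₂ z≡3)) → off-class ¬on 3F z≡3 (⟦⟧-no (Q y ≟ᴷ 0#) Qy≢0) } } }
    where
    off-class : ¬ OnCurve y → ∀ k → z y ≡ toℕ k → ⟦ Q y ≟ᴷ 0# ⟧ ≡ inQuadric (just k) →
                ∃ λ d → Class d y × z y ≡ roots d × ⟦ Q y ≟ᴷ 0# ⟧ ≡ inQuadric d
    off-class ¬on k z≡k Q≡ = just k , (¬on , z≡k) , z≡k , Q≡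

  -- Class sizes in the plane of a point

  module Plane {p : V} (off : Off p) where

    point? : ∀ y → Dec (Normal y × β p y ≡ 0#)
    point? y = normal? y ×-dec (p ⊥? y)

    -- The number of points of class d in the plane p^⊥.
    N : Index → ℕ
    N d = # finiteV λ y → point? y ×-dec class? d y

    -- A weight that depends only on the class is summed class by class, since each normal vector is
    -- in exactly one class.
    ∑-classes : ∀ (f : V → ℕ) (w : Index → ℕ) → (∀ y → Normal y → ∃ λ d → Class d y × f y ≡ w d) →
                ∑ finiteV (λ y → ⟦ point? y ⟧ ℕ.* f y) ≡ ∑ finiteIndex (λ d → w d ℕ.* N d)
    ∑-classes f w f≡w = begin
      ∑ finiteV (λ y → ⟦ point? y ⟧ ℕ.* f y)   ≡⟨ ∑-cong finiteV pointwise ⟩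
      ∑ finiteV (λ y → ∑ finiteIndex λ d → w d ℕ.* ⟦ point? y ×-dec class? d y ⟧)  ≡⟨ ∑-comm finiteV finiteIndex (λ y d → w d ℕ.* ⟦ point? y ×-dec class? d y ⟧) ⟩
      ∑ finiteIndex (λ d → ∑ finiteV λ y → w d ℕ.* ⟦ point? y ×-dec class? d y ⟧)
        ≡⟨ ∑-cong finiteIndex (λ d → ∑-* finiteV (w d) (λ y → ⟦ point? y ×-dec class? d y ⟧)) ⟩
      ∑ finiteIndex (λ d → w d ℕ.* N d)        ∎
      where
      open ≡-Reasoning
      open Finite finiteIndex using (_≟_)
      pointwise : ∀ y → ⟦ point? y ⟧ ℕ.* f y ≡ ∑ finiteIndex λ d → w d ℕ.* ⟦ point? y ×-dec class? d y ⟧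
      pointwise y = case point? y of λ
        { (no ¬p) → trans (cong (ℕ._* f y) (⟦⟧-no (point? y) ¬p)) (sym (∑-zero finiteIndex λ d →
            trans (cong (w d ℕ.*_) (⟦⟧-no (point? y ×-dec class? d y) (¬p ∘ proj₁))) (ℕ.*-zeroʳ (w d))))
        ; (yes p@(normal , _)) → let e , class , fy≡we = f≡w y normal in begin
            ⟦ point? y ⟧ ℕ.* f y                ≡⟨ cong (ℕ._* f y) (⟦⟧-yes (point? y) p) ⟩
            1 ℕ.* f y                           ≡⟨ trans (ℕ.*-identityˡ _) fy≡we ⟩
            w e                                 ≡⟨ ∑-δ finiteIndex w e ⟨
            ∑ finiteIndex (λ d → ⟦ e ≟ d ⟧ ℕ.* w d)
              ≡⟨ ∑-cong finiteIndex (λ d → trans (ℕ.*-comm _ (w d)) (cong (w d ℕ.*_)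
                   (⟦⟧-cong (e ≟ d) (point? y ×-dec class? d y) (λ { refl → p , class }) (λ (_ , class′) → class-unique class class′)))) ⟩
            ∑ finiteIndex (λ d → w d ℕ.* ⟦ point? y ×-dec class? d y ⟧) ∎ }

    private
      ∑ᶜ : (Index → ℕ) → ℕ
      ∑ᶜ w = ∑ finiteIndex (λ d → w d ℕ.* N d)

    ∑-one : ∑ᶜ (λ _ → 1) ≡ 1 ℕ.+ q ℕ.+ q ℕ.* q
    ∑-one = trans (sym (∑-classes (λ _ → 1) (λ _ → 1) λ y normal → let d , class , _ = classify y normal in d , class , refl))
      (trans (∑-cong finiteV λ y → ℕ.*-identityʳ _) (#ᴾ⊥ (Off⇒≢𝟎 off)))

    ∑-quadric : ∑ᶜ inQuadric ≡ #ᴾ (λ x → (p ⊥? x) ×-dec (Q x ≟ᴷ 0#))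
    ∑-quadric = trans (sym (∑-classes (λ y → ⟦ Q y ≟ᴷ 0# ⟧) inQuadric λ y normal → let d , class , _ , Q≡ = classify y normal in d , class , Q≡))
      (∑-cong finiteV λ y → trans (sym (⟦⟧-× (point? y) (Q y ≟ᴷ 0#)))
        (⟦⟧-cong (point? y ×-dec (Q y ≟ᴷ 0#)) (normal? y ×-dec ((p ⊥? y) ×-dec (Q y ≟ᴷ 0#)))
          (λ ((n , ⊥) , Q≡) → n , ⊥ , Q≡) (λ (n , ⊥ , Q≡) → (n , ⊥) , Q≡)))

    -- Incidences of points of the plane with osculating planes, counted by plane: each of the
    -- `1 + q` osculating planes cuts out a line.
    ∑-roots : ∑ᶜ roots ≡ (1 ℕ.+ q) ℕ.* (1 ℕ.+ q)
    ∑-roots = begin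
      ∑ᶜ roots  ≡⟨ ∑-classes z roots (λ y normal → let d , class , z≡ , _ = classify y normal in d , class , z≡) ⟨
      ∑ finiteV (λ y → ⟦ point? y ⟧ ℕ.* z y)   ≡⟨ ∑-*-# finiteV finiteI point? root? ⟩
      ∑ finiteI (λ i → # finiteV λ y → point? y ×-dec root? y i)
        ≡⟨ ∑-cong finiteI (λ i → trans (#-cong finiteV (λ y → point? y ×-dec root? y i) (λ y → normal? y ×-dec (root? y i ×-dec (p ⊥? y)))
             (λ y ((n , ⊥) , r) → n , r , ⊥) (λ y (n , r , ⊥) → (n , ⊥) , r)) (#ᴾ⊥A off i)) ⟩
      ∑ finiteI (λ _ → 1 ℕ.+ q)                ≡⟨ ∑ᴵ-const _ ⟩
      (1 ℕ.+ q) ℕ.* (1 ℕ.+ q)                  ∎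
      where open ≡-Reasoning

    -- `z y * z y` counts ordered pairs of osculating planes on `y`. Each pair has one point of the
    -- plane in common, and `q` more if the corresponding `π i j p` vanishes.
    ∑-roots² : ∑ᶜ (λ d → roots d ℕ.* roots d) ≡ (1 ℕ.+ q) ℕ.* (1 ℕ.+ q) ℕ.+ q ℕ.* #chords p
    ∑-roots² = begin
      ∑ᶜ (λ d → roots d ℕ.* roots d)
        ≡⟨ ∑-classes (λ y → z y ℕ.* z y) (λ d → roots d ℕ.* roots d)
             (λ y normal → let d , class , z≡ , _ = classify y normal in d , class , cong₂ ℕ._*_ z≡ z≡) ⟨
      ∑ finiteV (λ y → ⟦ point? y ⟧ ℕ.* (z y ℕ.* z y))   ≡⟨ ∑-cong finiteV (λ y → cong (⟦ point? y ⟧ ℕ.*_) (square y)) ⟩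
      ∑ finiteV (λ y → ⟦ point? y ⟧ ℕ.* # finiteI² (roots? y))  ≡⟨ ∑-*-# finiteV finiteI² point? roots? ⟩
      ∑ finiteI² (λ ij → # finiteV λ y → point? y ×-dec roots? y ij)
        ≡⟨ ∑-cong finiteI² (λ (i , j) → trans (#-cong finiteV (λ y → point? y ×-dec roots? y (i , j)) (λ y → normal? y ×-dec (roots? y (i , j) ×-dec (p ⊥? y)))
             (λ y ((n , ⊥) , r) → n , r , ⊥) (λ y (n , r , ⊥) → (n , ⊥) , r)) (#ᴾ⊥AA off i j)) ⟩
      ∑ finiteI² (λ (i , j) → 1 ℕ.+ q ℕ.* ⟦ π i j p ≟ⱽ 𝟎 ⟧)
        ≡⟨ trans (∑-+ finiteI² (λ _ → 1) _) (cong₂ ℕ._+_ size (∑-* finiteI² q _)) ⟩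
      (1 ℕ.+ q) ℕ.* (1 ℕ.+ q) ℕ.+ q ℕ.* #chords p  ∎
      where
      open ≡-Reasoning
      roots? : ∀ y ij → Dec (Root y (proj₁ ij) × Root y (proj₂ ij))
      roots? y (i , j) = root? y i ×-dec root? y j

      square : ∀ y → z y ℕ.* z y ≡ # finiteI² (roots? y)
      square y = begin
        z y ℕ.* z y                             ≡⟨ ∑-* finiteI (z y) _ ⟨
        ∑ finiteI (λ i → z y ℕ.* ⟦ root? y i ⟧) ≡⟨ ∑-cong finiteI (λ i → ℕ.*-comm (z y) _) ⟩
        ∑ finiteI (λ i → ⟦ root? y i ⟧ ℕ.* z y) ≡⟨ ∑-cong finiteI (λ i → trans (sym (∑-* finiteI ⟦ root? y i ⟧ _))
                                                     (∑-cong finiteI λ j → sym (⟦⟧-× (root? y i) (root? y j)))) ⟩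
        ∑ finiteI (λ i → ∑ finiteI λ j → ⟦ roots? y (i , j) ⟧) ≡⟨ ∑-× finiteI finiteI _ ⟨
        # finiteI² (roots? y)                   ∎

      size : ∑ finiteI² (λ _ → 1) ≡ (1 ℕ.+ q) ℕ.* (1 ℕ.+ q)
      size = trans (∑-× finiteI finiteI (λ _ → 1)) (trans (∑-cong finiteI λ _ → trans (∑ᴵ-const 1) (ℕ.*-identityʳ _)) (∑ᴵ-const _))

    -- By symmetry of `β`, the plane of `p` contains `A i` exactly when the osculating plane at
    -- `A i` contains `p`.
    N-curve : N nothing ≡ z p
    N-curve = begin
      # finiteV (λ y → point? y ×-dec onCurve? y)               ≡⟨ ∑-cong finiteV fibre ⟩
      ∑ finiteV (λ y → # finiteI λ i → (A i ≟ⱽ y) ×-dec (root? p i))  ≡⟨ ∑-comm finiteV finiteI _ ⟩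
      ∑ finiteI (λ i → # finiteV λ y → (A i ≟ⱽ y) ×-dec (root? p i))
        ≡⟨ ∑-cong finiteI (λ i → trans (∑-cong finiteV λ y → ⟦⟧-× (A i ≟ⱽ y) (root? p i)) (∑-δ finiteV (λ _ → ⟦ root? p i ⟧) (A i))) ⟩
      z p                                                       ∎
      where
      open ≡-Reasoning
      A-injective : ∀ i j → A i ≡ A j → i ≡ j
      A-injective i j eq = β-AA i j (trans (cong (β (A i)) (sym eq)) (β-self (A i)))

      fibre : ∀ y → ⟦ point? y ×-dec onCurve? y ⟧ ≡ # finiteI λ i → (A i ≟ⱽ y) ×-dec (root? p i)
      fibre y = case point? y ×-dec onCurve? y of λ
        { (yes p∧on@((_ , p⊥y) , i , refl)) → trans (⟦⟧-yes (point? y ×-dec onCurve? y) p∧on)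
            (sym (#-unique finiteI _ (refl , trans (β-comm (A i) p) p⊥y) λ j (Aj≡Ai , _) → A-injective i j (sym Aj≡Ai)))
        ; (no ¬p∧on) → trans (⟦⟧-no (point? y ×-dec onCurve? y) ¬p∧on)
            (sym (#-empty finiteI _ λ { i (refl , root) → ¬p∧on ((lead-A i , trans (β-comm p (A i)) root) , i , refl) })) }

-- Planes and points over F

-- The field structure on Fin q transported from F, so that equality is propositional.
module Transport {c ℓ} (F : Field c ℓ) {q : ℕ} (order : HasOrder F q) where

  private
    module F = Field F
    open F using (_≈_; 0#; 1#; -_; _+_; _*_)

  open Inverse order public using (to; from; to-cong; from-cong)

  to-from : ∀ x → to (from x) ≈ x
  to-from x = Inverse.inverseˡ order refl

  from-to : ∀ i → from (to i) ≡ i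
  from-to i = Inverse.inverseʳ order F.refl

  to-≢0 : ∀ {i} → i ≢ from 0# → ¬ (to i ≈ 0#)
  to-≢0 {i} i≢0 to-i≈0 = i≢0 (trans (sym (from-to i)) (from-cong to-i≈0))

  private
    add mul : Fin q → Fin q → Fin q
    add i j = from (to i + to j)
    mul i j = from (to i * to j)

    neg : Fin q → Fin q
    neg i = from (- to i)

    rawRing : RawRing 0ℓ 0ℓ
    rawRing = record { Carrier = Fin q ; _≈_ = _≡_ ; _+_ = add ; _*_ = mul ; -_ = neg ; 0# = from 0# ; 1# = from 1# }

    -- An injective homomorphism reflects equations, so the ring laws of `F` hold on `Fin q` for
    -- `_≡_`.
    isRingMonomorphism : IsRingMonomorphism rawRing (CommutativeRing.rawRing F.commutativeRing) to
    isRingMonomorphism = record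
      { isRingHomomorphism = record
        { isSemiringHomomorphism = record
          { isNearSemiringHomomorphism = record
            { +-isMonoidHomomorphism = record
              { isMagmaHomomorphism = record
                { isRelHomomorphism = record { cong = to-cong }
                ; homo = λ _ _ → to-from _ }
              ; ε-homo = to-from 0# }
            ; *-homo = λ _ _ → to-from _ }
          ; 1#-homo = to-from 1# }
        ; -‿homo = λ _ → to-from _ }
      ; injective = λ {i} {j} eq → trans (sym (from-to i)) (trans (from-cong eq) (from-to j))
      }

    isCommutativeRing : IsCommutativeRing _≡_ add mul neg (from 0#) (from 1#)
    isCommutativeRing = RingMonomorphism.isCommutativeRing isRingMonomorphism
      (CommutativeRing.isCommutativeRing F.commutativeRing)

    1≢0 : from 1# ≢ from 0#
    1≢0 eq = F.1≉0 (F.trans (F.sym (to-from 1#)) (F.trans (to-cong eq) (to-from 0#)))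

    inverse : ∀ i → i ≢ from 0# → ∃ λ j → mul j i ≡ from 1#
    inverse i i≢0 = let y , yi≈1 , _ = F.invertible (to i) (to-≢0 i≢0) in
      from y , from-cong (F.trans (F.*-congʳ (to-from y)) yi≈1)

  module Power = RawSemiringDefinitions (Semiring.rawSemiring F.semiring) using (_^_)
  open Power using (_^_)

  module _ (n h : ℕ) (q≡2^n : q ≡ 2 ℕ.^ n) (gcd≡1 : gcd n h ≡ 1) where

    private
      module K = FiniteField isCommutativeRing 1≢0 inverse
      module R = IntegralDomain isCommutativeRing inverse
      module KExp = Exp (CommutativeRing.commutativeSemiring R.ring)

    fieldWithAutomorphism : FieldWithAutomorphism
    fieldWithAutomorphism = record
      { K                 = Fin q
      ; finite            = finiteFin q
      ; _+_               = add
      ; _*_               = mul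
      ; neg               = neg
      ; 0#                = from 0#
      ; 1#                = from 1#
      ; isCommutativeRing = isCommutativeRing
      ; 1≢0               = 1≢0
      ; inverse           = inverse
      ; x+x≡0             = K.x+x≡0 n q≡2^n
      -- Square roots are Frobenius preimages for exponent 1; the power `y ^ 2` unfolds to
      -- `y * (y * 1#)`.
      ; √                 = λ x → let y , y²≡x = K.frobenius-surjective n q≡2^n 1 x in
                              y , trans (cong (mul y) (sym (CommutativeRing.*-identityʳ R.ring y))) y²≡x
      ; σ                 = KExp._^ (2 ℕ.^ h)
      ; σ-+               = K.frobenius-+ n q≡2^n h
      ; σ-*               = λ x y → KExp.^-distrib-* x y (2 ℕ.^ h)
      ; σ-1               = one^ (2 ℕ.^ h)
      ; σ-surjective      = K.frobenius-surjective n q≡2^n h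
      ; σ-fixed           = K.frobenius-fixed n q≡2^n h gcd≡1
      }
      where
      one^ : ∀ m → from 1# KExp.^ m ≡ from 1#
      one^ ℕ.zero  = refl
      one^ (suc m) = trans (CommutativeRing.*-identityˡ R.ring _) (one^ m)

    open FieldWithAutomorphism fieldWithAutomorphism using (σ)

    to-σ : ∀ i → to (σ i) ≈ to i ^ (2 ℕ.^ h)
    to-σ i = power (2 ℕ.^ h)
      where
      power : ∀ m → to (i KExp.^ m) ≈ to i ^ m
      power ℕ.zero  = to-from 1#
      power (suc m) = F.trans (to-from _) (F.*-congˡ (power m))

module Projective {c ℓ} (F : Field c ℓ) {q : ℕ} (n h : ℕ) (q≡2^n : q ≡ 2 ℕ.^ n) (gcd≡1 : gcd n h ≡ 1)
  (order : HasOrder F q) (3≤q : 3 ℕ.≤ q) where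

  private
    module F = Field F
    open F using (_≈_)
    module PG = PG3 F

  open Transport F order
  open PG using (coord; nonzero; Point; _∼_; _on_; _^𝔰; U₄; Osculating; 𝒜; 𝒪; 𝒪^𝔰; planeSetoid)
  open Power using (_^_)

  S : FieldWithAutomorphism
  S = fieldWithAutomorphism n h q≡2^n gcd≡1

  card≡q : Finite.card (FieldWithAutomorphism.finite S) ≡ q
  card≡q = length-tabulate id

  3≤card : 3 ℕ.≤ Finite.card (FieldWithAutomorphism.finite S)
  3≤card = subst (3 ℕ.≤_) (sym card≡q) 3≤q

  open Geometry S
  open Counts S 3≤card using (_⊥?_)
  open Classes S 3≤card

  private
    module ∼ = Setoid planeSetoid

    ∼-sym : ∀ {x y} → x ∼ y → y ∼ x
    ∼-sym {x} {y} = ∼.sym {x} {y}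

    ∼-trans : ∀ {x y z} → x ∼ y → y ∼ z → x ∼ z
    ∼-trans {x} {y} {z} = ∼.trans {x} {y} {z}

  code : Point → V
  code P = from (coord P 0F) , from (coord P 1F) , from (coord P 2F) , from (coord P 3F)

  vector : V → Fin 4 → F.Carrier
  vector (a , b , c , d) 0F = to a
  vector (a , b , c , d) 1F = to b
  vector (a , b , c , d) 2F = to c
  vector (a , b , c , d) 3F = to d

  vector-code : ∀ P i → vector (code P) i ≈ coord P i
  vector-code P 0F = to-from _
  vector-code P 1F = to-from _
  vector-code P 2F = to-from _
  vector-code P 3F = to-from _

  vector-· : ∀ k y i → vector (k · y) i ≈ to k F.* vector y i
  vector-· k y 0F = to-from _
  vector-· k y 1F = to-from _
  vector-· k y 2F = to-from _
  vector-· k y 3F = to-from _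

  code-unique : ∀ P y → (∀ i → coord P i ≈ vector y i) → code P ≡ y
  code-unique P (a , b , c , d) eq = tuple≡ (lemma (eq 0F)) (lemma (eq 1F)) (lemma (eq 2F)) (lemma (eq 3F))
    where
    lemma : ∀ {x i} → x ≈ to i → from x ≡ i
    lemma x≈ = trans (from-cong x≈) (from-to _)

  code≢𝟎 : ∀ P → code P ≢ 𝟎
  code≢𝟎 P eq = nonzero P λ i → F.trans (F.sym (vector-code P i)) (F.trans (F.reflexive (cong (λ y → vector y i) eq)) (zeros i))
    where
    zeros : ∀ i → vector 𝟎 i ≈ F.0#
    zeros 0F = to-from _
    zeros 1F = to-from _
    zeros 2F = to-from _
    zeros 3F = to-from _

  ∼⇒· : ∀ P R → P ∼ R → ∃ λ k → k ≢ 0# × code P ≡ k · code R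
  ∼⇒· P R (k , k≉0 , P≈kR) = from k ,
    (λ k≡0 → k≉0 (F.trans (F.sym (to-from k)) (F.trans (to-cong k≡0) (to-from F.0#)))) ,
    code-unique P (from k · code R) λ i → F.trans (P≈kR i) (F.sym (F.trans (vector-· (from k) (code R) i)
      (F.*-cong (to-from k) (vector-code R i))))

  ·⇒∼ : ∀ P R {k} → code P ≡ k · code R → P ∼ R
  ·⇒∼ P R {k} eq = to k , to-≢0 (λ { refl → code≢𝟎 P (trans eq (0· (code R))) }) , λ i →
    F.trans (F.sym (vector-code P i)) (F.trans (F.reflexive (cong (λ y → vector y i) eq))
      (F.trans (vector-· k (code R) i) (F.*-congˡ (vector-code R i))))

  -- The value at 𝟎 is junk.
  point : V → Point
  point y with y ≟ⱽ 𝟎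
  ... | yes _  = U₄
  ... | no y≢𝟎 = record { coord = vector y ; nonzero = λ y≈0 → y≢𝟎 (begin
      y                       ≡⟨ tuple≡ (from-to _) (from-to _) (from-to _) (from-to _) ⟨
      from (vector y 0F) , from (vector y 1F) , from (vector y 2F) , from (vector y 3F)
        ≡⟨ tuple≡ (from-cong (y≈0 0F)) (from-cong (y≈0 1F)) (from-cong (y≈0 2F)) (from-cong (y≈0 3F)) ⟩
      𝟎                       ∎) }
    where open ≡-Reasoning

  code-point : ∀ {y} → y ≢ 𝟎 → code (point y) ≡ y
  code-point {y} y≢𝟎 with y ≟ⱽ 𝟎
  ... | yes y≡𝟎 = contradiction y≡𝟎 y≢𝟎
  ... | no _    = tuple≡ (from-to _) (from-to _) (from-to _) (from-to _)

  curvePoint : I → Point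
  curvePoint nothing  = U₄
  curvePoint (just t) = PG.P[_] h (to t)

  code-curvePoint : ∀ i → code (curvePoint i) ≡ A i
  code-curvePoint nothing  = refl
  code-curvePoint (just t) = code-unique (curvePoint (just t)) (A (just t)) λ
    { 0F → F.sym (to-from _)
    ; 1F → F.refl
    ; 2F → F.sym (to-σ n h q≡2^n gcd≡1 t)
    ; 3F → F.trans (^-homo-* (to t) (2 ℕ.^ h) 1) (F.trans (F.*-congˡ (F.*-identityʳ (to t)))
             (F.sym (F.trans (to-from _) (F.*-congʳ (to-σ n h q≡2^n gcd≡1 t)))))
    }
    where open Exp F.commutativeSemiring using (^-homo-*)

  P-cong : ∀ {s t} → s ≈ t → PG.P[_] h s ∼ PG.P[_] h t
  P-cong {s} {t} s≈t = F.1# , F.1≉0 , λ i → F.trans (coordinates i) (F.sym (F.*-identityˡ _))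
    where
    open Exp F.commutativeSemiring using (^-congˡ)
    coordinates : ∀ i → coord (PG.P[_] h s) i ≈ coord (PG.P[_] h t) i
    coordinates 0F = F.refl
    coordinates 1F = s≈t
    coordinates 2F = ^-congˡ (2 ℕ.^ h) s≈t
    coordinates 3F = ^-congˡ (2 ℕ.^ h ℕ.+ 1) s≈t

  𝒜⇒curvePoint : ∀ P → 𝒜 h P → ∃ λ i → P ∼ curvePoint i
  𝒜⇒curvePoint P (inj₁ (t , P∼)) = just (from t) , ∼-trans {P} {PG.P[_] h t} {curvePoint (just (from t))} P∼ (P-cong (F.sym (to-from t)))
  𝒜⇒curvePoint P (inj₂ P∼)       = nothing , P∼

  curvePoint⇒𝒜 : ∀ P i → P ∼ curvePoint i → 𝒜 h P
  curvePoint⇒𝒜 P nothing  P∼ = inj₂ P∼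
  curvePoint⇒𝒜 P (just t) P∼ = inj₁ (to t , P∼)

  𝒜⇒A : ∀ P → 𝒜 h P → ∃₂ λ i k → code P ≡ k · A i
  𝒜⇒A P P∈𝒜 = let i , P∼ = 𝒜⇒curvePoint P P∈𝒜
                  k , _ , eq = ∼⇒· P (curvePoint i) P∼
              in i , k , trans eq (cong (k ·_) (code-curvePoint i))

  A⇒𝒜 : ∀ P i {k} → code P ≡ k · A i → 𝒜 h P
  A⇒𝒜 P i {k} eq = curvePoint⇒𝒜 P i (·⇒∼ P (curvePoint i) (trans eq (cong (k ·_) (sym (code-curvePoint i)))))

  β-unit : ∀ R i → PG.β (coord R) (PG.unit i) ≈ coord R (Fin.opposite i)
  β-unit R = PG.β-unit (coord R)

  𝔰-cong : ∀ P R → P ∼ R → P ^𝔰 ∼ R ^𝔰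
  𝔰-cong P R (k , k≉0 , P≈kR) = k , k≉0 , λ i →
    F.trans (β-unit P i) (F.trans (P≈kR _) (F.*-congˡ (F.sym (β-unit R i))))

  𝔰-injective : ∀ P R → P ^𝔰 ∼ R ^𝔰 → P ∼ R
  𝔰-injective P R (k , k≉0 , P≈kR) = k , k≉0 , λ
    { 0F → coordinate 3F ; 1F → coordinate 2F ; 2F → coordinate 1F ; 3F → coordinate 0F }
    where
    coordinate : ∀ i → coord P (Fin.opposite i) ≈ k F.* coord R (Fin.opposite i)
    coordinate i = F.trans (F.sym (β-unit P i)) (F.trans (P≈kR i) (F.*-congˡ (β-unit R i)))

  private
    -- The common form of both incidence conditions: `sum` nests to the right and ends in `0#`, and
    -- the coordinates of `R ^𝔰` are those of `R` in reverse order.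
    value : Point → Point → F.Carrier
    value P R = coord R 3F F.* coord P 0F F.+ (coord R 2F F.* coord P 1F F.+ (coord R 1F F.* coord P 2F F.+ (coord R 0F F.* coord P 3F F.+ F.0#)))

    to-β : ∀ P R → to (β (code P) (code R)) ≈ value P R
    to-β P R = begin
      to (β (code P) (code R))
        ≈⟨ F.trans (to-from _) (F.+-cong (F.trans (to-from _) (F.+-cong (F.trans (to-from _) (F.+-cong (term 0F 3F) (term 1F 2F))) (term 2F 1F))) (term 3F 0F)) ⟩
      R₃P₀ F.+ R₂P₁ F.+ R₁P₂ F.+ R₀P₃
        ≈⟨ F.+-congˡ (F.+-identityʳ R₀P₃) ⟨
      R₃P₀ F.+ R₂P₁ F.+ R₁P₂ F.+ (R₀P₃ F.+ F.0#)    ≈⟨ F.+-assoc _ _ _ ⟩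
      R₃P₀ F.+ R₂P₁ F.+ (R₁P₂ F.+ (R₀P₃ F.+ F.0#))  ≈⟨ F.+-assoc _ _ _ ⟩
      value P R ∎
      where
      open SetoidReasoning F.setoid
      R₃P₀ R₂P₁ R₁P₂ R₀P₃ : F.Carrier
      R₃P₀ = coord R 3F F.* coord P 0F
      R₂P₁ = coord R 2F F.* coord P 1F
      R₁P₂ = coord R 1F F.* coord P 2F
      R₀P₃ = coord R 0F F.* coord P 3F
      term : ∀ i j → to (from (coord P i) * from (coord R j)) ≈ coord R j F.* coord P i
      term i j = F.trans (to-from _) (F.trans (F.*-cong (to-from _) (to-from _)) (F.*-comm _ _))

    on-value : ∀ P R → Semiring.Carrier F.semiring
    on-value P R = RawSemiringDefinitions.sum (Semiring.rawSemiring F.semiring) (λ i → coord (R ^𝔰) i F.* coord P i)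

    on-value≈ : ∀ P R → on-value P R ≈ value P R
    on-value≈ P R = F.+-cong (F.*-congʳ (β-unit R 0F)) (F.+-cong (F.*-congʳ (β-unit R 1F))
      (F.+-cong (F.*-congʳ (β-unit R 2F)) (F.+-congʳ (F.*-congʳ (β-unit R 3F)))))

  on⇒⊥ : ∀ P R → P on R ^𝔰 → β (code P) (code R) ≡ 0#
  on⇒⊥ P R on = trans (sym (from-to _)) (from-cong (F.trans (to-β P R) (F.trans (F.sym (on-value≈ P R)) on)))

  ⊥⇒on : ∀ P R → β (code P) (code R) ≡ 0# → P on R ^𝔰
  ⊥⇒on P R ⊥ = F.trans (on-value≈ P R) (F.trans (F.sym (to-β P R)) (F.trans (to-cong ⊥) (to-from F.0#)))

  on-cong : ∀ P π ρ → π ∼ ρ → P on ρ → P on π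
  on-cong P π ρ (k , _ , π≈kρ) on = begin
    π₀ F.* p₀ F.+ (π₁ F.* p₁ F.+ (π₂ F.* p₂ F.+ (π₃ F.* p₃ F.+ F.0#)))
      ≈⟨ F.+-cong (term 0F) (F.+-cong (term 1F) (F.+-cong (term 2F) (F.+-cong (term 3F) (F.sym (F.zeroʳ k))))) ⟩
    k F.* (coord ρ 0F F.* p₀) F.+ (k F.* (coord ρ 1F F.* p₁) F.+ (k F.* (coord ρ 2F F.* p₂) F.+ (k F.* (coord ρ 3F F.* p₃) F.+ k F.* F.0#)))
      ≈⟨ F.+-congˡ (F.+-congˡ (F.+-congˡ (F.distribˡ k _ _))) ⟨
    k F.* (coord ρ 0F F.* p₀) F.+ (k F.* (coord ρ 1F F.* p₁) F.+ (k F.* (coord ρ 2F F.* p₂) F.+ k F.* (coord ρ 3F F.* p₃ F.+ F.0#)))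
      ≈⟨ F.+-congˡ (F.+-congˡ (F.distribˡ k _ _)) ⟨
    k F.* (coord ρ 0F F.* p₀) F.+ (k F.* (coord ρ 1F F.* p₁) F.+ k F.* (coord ρ 2F F.* p₂ F.+ (coord ρ 3F F.* p₃ F.+ F.0#)))
      ≈⟨ F.+-congˡ (F.distribˡ k _ _) ⟨
    k F.* (coord ρ 0F F.* p₀) F.+ k F.* (coord ρ 1F F.* p₁ F.+ (coord ρ 2F F.* p₂ F.+ (coord ρ 3F F.* p₃ F.+ F.0#)))
      ≈⟨ F.distribˡ k _ _ ⟨
    k F.* (coord ρ 0F F.* p₀ F.+ (coord ρ 1F F.* p₁ F.+ (coord ρ 2F F.* p₂ F.+ (coord ρ 3F F.* p₃ F.+ F.0#))))
      ≈⟨ F.*-congˡ on ⟩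
    k F.* F.0#   ≈⟨ F.zeroʳ k ⟩
    F.0#         ∎
    where
    open SetoidReasoning F.setoid
    p₀ p₁ p₂ p₃ π₀ π₁ π₂ π₃ : F.Carrier
    p₀ = coord P 0F
    p₁ = coord P 1F
    p₂ = coord P 2F
    p₃ = coord P 3F
    π₀ = coord π 0F
    π₁ = coord π 1F
    π₂ = coord π 2F
    π₃ = coord π 3F
    term : ∀ i → coord π i F.* coord P i ≈ k F.* (coord ρ i F.* coord P i)
    term i = F.trans (F.*-congʳ (π≈kρ i)) (F.*-assoc k _ _)

  -- Distinct parameters give distinct planes: if `A i` and `A j` were proportional they would be
  -- orthogonal, since each `A j` is orthogonal to itself.
  osculating-count : ∀ P → HasCardinality (subsetoid planeSetoid λ π → Osculating h π × P on π) (z (code P))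
  osculating-count P = #-hasCardinality finiteI (root? (code P)) planeSetoid (λ π → Osculating h π × P on π)
    (λ i → curvePoint i ^𝔰)
    (λ i root → (curvePoint i , curvePoint⇒𝒜 (curvePoint i) i (∼.refl {curvePoint i}) , ∼.refl {curvePoint i ^𝔰}) ,
      ⊥⇒on P (curvePoint i) (trans (β-comm (code P) _) (trans (cong (λ y → β y (code P)) (code-curvePoint i)) root)))
    (λ i j _ _ eq → let k , _ , i≡kj = ∼⇒· (curvePoint i) (curvePoint j) (𝔰-injective (curvePoint i) (curvePoint j) eq) in
      sym (β-AA j i (trans (cong (β (A j)) (trans (sym (code-curvePoint i)) (trans i≡kj (cong (k ·_) (code-curvePoint j)))))
        (trans (β-· (A j) k (A j)) (*0 k (β-self (A j)))))))
    λ { π ((R , R∈𝒜 , π∼) , on) → let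
          i , R∼ = 𝒜⇒curvePoint R R∈𝒜
          π∼i = ∼-trans {π} {R ^𝔰} {curvePoint i ^𝔰} π∼ (𝔰-cong R (curvePoint i) R∼)
        in i , trans (cong (λ y → β y (code P)) (sym (code-curvePoint i))) (trans (β-comm _ (code P))
             (on⇒⊥ P (curvePoint i) (on-cong P (curvePoint i ^𝔰) π (∼-sym {π} {curvePoint i ^𝔰} π∼i) on))) , π∼i }

  𝒪⇒z : ∀ {P k} → 𝒪 h ⟨ k ⟩ P → z (code P) ≡ toℕ k
  𝒪⇒z {P} (_ , count) = hasCardinality-unique (subsetoid planeSetoid λ π → Osculating h π × P on π) (osculating-count P) count

  𝒪⇒Off : ∀ {P k} → 𝒪 h ⟨ k ⟩ P → Off (code P)
  𝒪⇒Off {P} (P∉𝒜 , _) i k eq = P∉𝒜 (A⇒𝒜 P i eq)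

  index : ClassIndex → Index
  index q+1   = nothing
  index ⟨ k ⟩ = just k

  class⇒𝒪 : ∀ d {y} → Normal y → Class (index d) y → 𝒪 h d (point y)
  class⇒𝒪 q+1   {y} normal (i , y≡A) = A⇒𝒜 (point y) i {1#} (trans (code-point (Normal⇒≢𝟎 normal)) (trans y≡A (sym (1· (A i)))))
  class⇒𝒪 ⟨ k ⟩ {y} normal (¬on , z≡k) =
    (λ ∈𝒜 → let i , l , eq = 𝒜⇒A (point y) ∈𝒜 in ¬on (i , normal-· normal (lead-A i) (trans (sym y≡) eq))) ,
    subst (HasCardinality _) (trans (cong z y≡) z≡k) (osculating-count (point y))
    where
    y≡ = code-point (Normal⇒≢𝟎 normal)

  𝒪⇒class : ∀ d R {k} → k ≢ 0# → Normal (k · code R) → 𝒪 h d R → Class (index d) (k · code R)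
  𝒪⇒class q+1 R {k} k≢0 normal R∈𝒜 = let i , l , eq = 𝒜⇒A R R∈𝒜 in
    i , normal-· normal (lead-A i) (trans (cong (k ·_) eq) (·-assoc k l (A i)))
  𝒪⇒class ⟨ j ⟩ R {k} k≢0 normal R∈𝒪@(R∉𝒜 , _) =
    (λ { (i , eq) → R∉𝒜 (A⇒𝒜 R i (trans (sym (inv-·-· (code R) k≢0)) (cong (inv k ·_) eq))) }) ,
    trans (z-· (code R) k≢0) (𝒪⇒z {R} R∈𝒪)

  module _ {P} (off : Off (code P)) where

    open Plane off using (N; point?)

    -- A plane determines its pole up to a scalar, hence a unique normal vector; incidence with `P`
    -- becomes orthogonality to `code P`.
    planes-count : ∀ d → HasCardinality (subsetoid planeSetoid λ π → 𝒪^𝔰 h d π × P on π) (N (index d))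
    planes-count d = #-hasCardinality finiteV (λ y → point? y ×-dec class? (index d) y) planeSetoid (λ π → 𝒪^𝔰 h d π × P on π)
      (λ y → point y ^𝔰)
      (λ y ((normal , ⊥) , class) → (point y , class⇒𝒪 d normal class , ∼.refl {point y ^𝔰}) ,
        ⊥⇒on P (point y) (trans (cong (β (code P)) (code-point (Normal⇒≢𝟎 normal))) ⊥))
      (λ x y ((normal-x , _) , _) ((normal-y , _) , _) eq →
        let k , _ , x≡ky = ∼⇒· (point x) (point y) (𝔰-injective (point x) (point y) eq)
        in normal-· normal-x normal-y (trans (sym (code-point (Normal⇒≢𝟎 normal-x))) (trans x≡ky (cong (k ·_) (code-point (Normal⇒≢𝟎 normal-y))))))
      λ { π ((R , R∈𝒪 , π∼) , on) → let
            k , k≢0 , normal = normalize (code≢𝟎 R)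
            y = k · code R
            y≡ = code-point (Normal⇒≢𝟎 normal)
            R∼y = ∼-sym {point y} {R} (·⇒∼ (point y) R y≡)
            ⊥R = on⇒⊥ P R (on-cong P (R ^𝔰) π (∼-sym {π} {R ^𝔰} π∼) on)
          in y , ((normal , ⊥-· (code P) k (code R) ⊥R) , 𝒪⇒class d R k≢0 normal R∈𝒪) ,
             ∼-trans {π} {R ^𝔰} {point y ^𝔰} π∼ (𝔰-cong R (point y) R∼y) }

-- The incidence numbers

open import Data.Integer as ℤ using (ℤ; +_; -_; _-_)
open import Data.Integer.Divisibility using (_∣_)
import Data.Integer.Divisibility.Signed as Signed
import Data.Integer.Properties as ℤ
import Data.Integer.Tactic.RingSolver as ℤ-Solver
open import Data.Nat using (_^_; _≤_)
open import Data.Rational.Unnormalised using (_/_; _≃_; *≡*)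

module ClassCounts (q a b c d e C : ℕ) where

  open Data.Nat using (_+_; _*_)

  -- a, b, c, d, e are the numbers of points of a plane in 𝒪_{q+1}, 𝒪₀, 𝒪₁, 𝒪₂, 𝒪₃.
  module Equations
    -- The left sides are the sums over `Index` exactly as they unfold, zero weights included.
    (∑1    : 1 * a + (1 * b + (1 * c + (1 * d + (1 * e + 0)))) ≡ 1 + q + q * q)
    (∑z    : 1 * a + (0 * b + (1 * c + (2 * d + (3 * e + 0)))) ≡ (1 + q) * (1 + q))
    (∑z²   : 1 * a + (0 * b + (1 * c + (4 * d + (9 * e + 0)))) ≡ (1 + q) * (1 + q) + q * C)
    where

    open ≡-Reasoning

    -- The difference of `∑z²` and `∑z` has weight `z (z - 1)`, with values 0, 0, 2, 6 at z = 0, 1,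
    -- 2, 3.
    6e : e * 6 + 2 * d ≡ q * C
    6e = ℕ.+-cancelˡ-≡ ((1 + q) * (1 + q)) _ _ (begin
      (1 + q) * (1 + q) + (e * 6 + 2 * d)  ≡⟨ cong (_+ (e * 6 + 2 * d)) ∑z ⟨
      1 * a + (0 * b + (1 * c + (2 * d + (3 * e + 0)))) + (e * 6 + 2 * d)  ≡⟨ identity a b c d e ⟩
      1 * a + (0 * b + (1 * c + (4 * d + (9 * e + 0))))  ≡⟨ ∑z² ⟩
      (1 + q) * (1 + q) + q * C ∎)
      where
      identity : ∀ a b c d e → 1 * a + (0 * b + (1 * c + (2 * d + (3 * e + 0)))) + (e * 6 + 2 * d) ≡ 1 * a + (0 * b + (1 * c + (4 * d + (9 * e + 0))))
      identity = solve-∀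

    -- The weight `(z - 1) (z - 3)` is 3 at 0, -1 at 2, and 0 at 1 and 3, which leaves `3 b - d`.
    3b : b * 3 + 3 * q ≡ d + q * C
    3b = ℕ.+-cancelʳ-≡ (3 * ((1 + q) * (1 + q))) _ _ (begin
      b * 3 + 3 * q + 3 * ((1 + q) * (1 + q))                               ≡⟨ cong (λ x → b * 3 + 3 * q + 3 * x) ∑z ⟨
      b * 3 + 3 * q + 3 * (1 * a + (0 * b + (1 * c + (2 * d + (3 * e + 0)))))  ≡⟨ identity₁ q a b c d e ⟩
      3 * (1 * a + (1 * b + (1 * c + (1 * d + (1 * e + 0))))) + d + (e * 6 + 2 * d) + 3 * q
        ≡⟨ cong₂ (λ x y → 3 * x + d + y + 3 * q) ∑1 6e ⟩
      3 * (1 + q + q * q) + d + q * C + 3 * q                               ≡⟨ identity₂ q d (q * C) ⟩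
      d + q * C + 3 * ((1 + q) * (1 + q))                                   ∎)
      where
      identity₁ : ∀ q a b c d e → b * 3 + 3 * q + 3 * (1 * a + (0 * b + (1 * c + (2 * d + (3 * e + 0))))) ≡
                  3 * (1 * a + (1 * b + (1 * c + (1 * d + (1 * e + 0))))) + d + (e * 6 + 2 * d) + 3 * q
      identity₁ = solve-∀
      identity₂ : ∀ q d x → 3 * (1 + q + q * q) + d + x + 3 * q ≡ d + x + 3 * ((1 + q) * (1 + q))
      identity₂ = solve-∀

    -- The weight `z (3 - z)` is 2 at 1 and 2, and 0 at 0 and 3.
    2c : c * 2 + 2 * a + 2 * d + q * C ≡ 2 * ((1 + q) * (1 + q))
    2c = begin
      c * 2 + 2 * a + 2 * d + q * C             ≡⟨ cong (λ x → c * 2 + 2 * a + 2 * d + x) 6e ⟨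
      c * 2 + 2 * a + 2 * d + (e * 6 + 2 * d)   ≡⟨ identity a b c d e ⟩
      2 * (1 * a + (0 * b + (1 * c + (2 * d + (3 * e + 0)))))  ≡⟨ cong (2 *_) ∑z ⟩
      2 * ((1 + q) * (1 + q))                   ∎
      where
      identity : ∀ a b c d e → c * 2 + 2 * a + 2 * d + (e * 6 + 2 * d) ≡ 2 * (1 * a + (0 * b + (1 * c + (2 * d + (3 * e + 0)))))
      identity = solve-∀

  private
    cancel : ∀ k {x y} → x + k ≡ y + k → x ≡ y
    cancel k = ℕ.+-cancelʳ-≡ k _ _

  module _ (6e : e * 6 + 2 * d ≡ q * C) (3b : b * 3 + 3 * q ≡ d + q * C)
           (2c : c * 2 + 2 * a + 2 * d + q * C ≡ 2 * ((1 + q) * (1 + q))) where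

    type1-no-chord : a ≡ 1 → d ≡ q → C ≡ 1 + q → e * 6 + q ≡ q * q × b * 3 + q ≡ q * q × c * 2 ≡ q * q + q
    type1-no-chord refl refl refl =
      cancel q (trans (i₁ e q) (trans 6e (i₂ q))) ,
      cancel (2 * q) (trans (i₃ b q) (trans 3b (i₄ q))) ,
      cancel (2 + 3 * q + q * q) (trans (i₅ c q) (trans 2c (i₆ q)))
      where
      i₁ : ∀ e q → e * 6 + q + q ≡ e * 6 + 2 * q
      i₁ = solve-∀
      i₂ : ∀ q → q * (1 + q) ≡ q * q + q
      i₂ = solve-∀
      i₃ : ∀ b q → b * 3 + q + 2 * q ≡ b * 3 + 3 * q
      i₃ = solve-∀
      i₄ : ∀ q → q + q * (1 + q) ≡ q * q + 2 * q
      i₄ = solve-∀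
      i₅ : ∀ c q → c * 2 + (2 + 3 * q + q * q) ≡ c * 2 + 2 + 2 * q + q * (1 + q)
      i₅ = solve-∀
      i₆ : ∀ q → 2 * ((1 + q) * (1 + q)) ≡ q * q + q + (2 + 3 * q + q * q)
      i₆ = solve-∀

    type1-chord : a ≡ 1 → d ≡ q → C ≡ 3 + q → e * 6 ≡ q * q + q × b * 3 ≡ q * q + q × c * 2 + q ≡ q * q
    type1-chord refl refl refl =
      cancel (2 * q) (trans 6e (i₁ q)) ,
      cancel (3 * q) (trans 3b (i₂ q)) ,
      cancel (2 + 4 * q + q * q) (trans (i₃ c q) (trans 2c (i₄ q)))
      where
      i₁ : ∀ q → q * (3 + q) ≡ q * q + q + 2 * q
      i₁ = solve-∀
      i₂ : ∀ q → q + q * (3 + q) ≡ q * q + q + 3 * q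
      i₂ = solve-∀
      i₃ : ∀ c q → c * 2 + q + (2 + 4 * q + q * q) ≡ c * 2 + 2 + 2 * q + q * (3 + q)
      i₃ = solve-∀
      i₄ : ∀ q → 2 * ((1 + q) * (1 + q)) ≡ q * q + (2 + 4 * q + q * q)
      i₄ = solve-∀

    type2 : a ≡ 2 → d + 1 ≡ 2 * q → C ≡ 1 + q → e * 6 + 3 * q ≡ q * q + 2 × b * 3 + 1 ≡ q * q × c * 2 + q ≡ q * q
    type2 refl d≡ refl =
      cancel q (trans (i₁ e q) (trans (cong (λ x → e * 6 + x) (trans (cong (2 *_) (sym d≡)) (i₂ d))) (trans (i₃ (e * 6) d) (trans (cong (_+ 2) 6e) (i₄ q))))) ,
      cancel (3 * q) (trans (i₅ b q) (trans (cong suc 3b) (trans (i₆ d q) (trans (cong (_+ q * (1 + q)) d≡) (i₇ q))))) ,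
      cancel (2 + 4 * q + q * q) (trans (i₈ c q) (trans (cong (λ x → c * 2 + 2 + 2 * x + q * (1 + q)) (sym d≡)) (trans (i₉ c d q) (trans 2c (i₀ q)))))
      where
      i₁ : ∀ e q → e * 6 + 3 * q + q ≡ e * 6 + 2 * (2 * q)
      i₁ = solve-∀
      i₂ : ∀ d → 2 * (d + 1) ≡ 2 * d + 2
      i₂ = solve-∀
      i₃ : ∀ x d → x + (2 * d + 2) ≡ x + 2 * d + 2
      i₃ = solve-∀
      i₄ : ∀ q → q * (1 + q) + 2 ≡ q * q + 2 + q
      i₄ = solve-∀
      i₅ : ∀ b q → b * 3 + 1 + 3 * q ≡ 1 + (b * 3 + 3 * q)
      i₅ = solve-∀
      i₆ : ∀ d q → 1 + (d + q * (1 + q)) ≡ d + 1 + q * (1 + q)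
      i₆ = solve-∀
      i₇ : ∀ q → 2 * q + q * (1 + q) ≡ q * q + 3 * q
      i₇ = solve-∀
      i₈ : ∀ c q → c * 2 + q + (2 + 4 * q + q * q) ≡ c * 2 + 2 + 2 * (2 * q) + q * (1 + q)
      i₈ = solve-∀
      i₉ : ∀ c d q → c * 2 + 2 + 2 * (d + 1) + q * (1 + q) ≡ c * 2 + 4 + 2 * d + q * (1 + q)
      i₉ = solve-∀
      i₀ : ∀ q → 2 * ((1 + q) * (1 + q)) ≡ q * q + (2 + 4 * q + q * q)
      i₀ = solve-∀

-- From natural numbers to the stated fractions, and divisibility by 3

private
  pos-square : ∀ q → + (q ℕ.* q) ≡ + q ℤ.* + q
  pos-square q = ℤ.pos-* q q

  moved : ∀ {m n k : ℕ} → m ℕ.+ k ≡ n → + m ≡ + n ℤ.+ - + k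
  moved {m} {n} {k} eq = trans (lemma (+ m) (+ k)) (cong (λ x → + x ℤ.+ - + k) eq)
    where
    lemma : ∀ m k → m ≡ m ℤ.+ k ℤ.+ - k
    lemma = ℤ-Solver.solve-∀

  x+q≡q² : ∀ m k q → m ℕ.* k ℕ.+ q ≡ q ℕ.* q → + m ℤ.* + k ≡ + q ℤ.* (+ q ℤ.+ - + 1) ℤ.* + 1
  x+q≡q² m k q eq = trans (sym (ℤ.pos-* m k)) (trans (moved {m ℕ.* k} eq) (trans (cong (ℤ._+ - + q) (pos-square q)) (lemma (+ q))))
    where
    lemma : ∀ q → q ℤ.* q ℤ.+ - q ≡ q ℤ.* (q ℤ.+ - + 1) ℤ.* + 1
    lemma = ℤ-Solver.solve-∀

  x≡q²+q : ∀ m k q → m ℕ.* k ≡ q ℕ.* q ℕ.+ q → + m ℤ.* + k ≡ + q ℤ.* (+ q ℤ.+ + 1) ℤ.* + 1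
  x≡q²+q m k q eq = trans (sym (ℤ.pos-* m k)) (trans (cong +_ eq) (trans (cong (ℤ._+ + q) (pos-square q)) (lemma (+ q))))
    where
    lemma : ∀ q → q ℤ.* q ℤ.+ q ≡ q ℤ.* (q ℤ.+ + 1) ℤ.* + 1
    lemma = ℤ-Solver.solve-∀

  x+1≡q² : ∀ m k q → m ℕ.* k ℕ.+ 1 ≡ q ℕ.* q → + m ℤ.* + k ≡ (+ q ℤ.* + q ℤ.+ - + 1) ℤ.* + 1
  x+1≡q² m k q eq = trans (sym (ℤ.pos-* m k)) (trans (moved {m ℕ.* k} eq) (trans (cong (ℤ._+ - + 1) (pos-square q)) (sym (ℤ.*-identityʳ _))))

  x+3q≡q²+2 : ∀ m k q → m ℕ.* k ℕ.+ 3 ℕ.* q ≡ q ℕ.* q ℕ.+ 2 → + m ℤ.* + k ≡ (+ q ℤ.* + q ℤ.+ - (+ 3 ℤ.* + q) ℤ.+ + 2) ℤ.* + 1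
  x+3q≡q²+2 m k q eq = trans (sym (ℤ.pos-* m k)) (trans (moved {m ℕ.* k} eq)
    (trans (cong₂ (λ x y → x ℤ.+ + 2 ℤ.+ - y) (pos-square q) (ℤ.pos-* 3 q)) (lemma (+ q))))
    where
    lemma : ∀ q → q ℤ.* q ℤ.+ + 2 ℤ.+ - (+ 3 ℤ.* q) ≡ (q ℤ.* q ℤ.+ - (+ 3 ℤ.* q) ℤ.+ + 2) ℤ.* + 1
    lemma = ℤ-Solver.solve-∀

  x+1≡2q : ∀ m q → m ℕ.+ 1 ≡ 2 ℕ.* q → + m ℤ.* + 1 ≡ (+ 2 ℤ.* + q ℤ.+ - + 1) ℤ.* + 1
  x+1≡2q m q eq = cong (ℤ._* + 1) (trans (moved {m} eq) (cong (ℤ._+ - + 1) (ℤ.pos-* 2 q)))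

  3∤2 : ∀ k → + 2 ≢ k ℤ.* + 3
  3∤2 k eq = from-no (3 ℕ.∣? 2) (Signed.∣⇒∣ᵤ (Signed.divides k eq))

  -- q(q + 1) ≡ 2 (mod 3) for q ≡ 1 (mod 3).
  6∤q²+q : ∀ e q → + 3 ∣ + q - + 1 → e ℕ.* 6 ≢ q ℕ.* q ℕ.+ q
  6∤q²+q e q 3∣q-1 eq with Signed.∣ᵤ⇒∣ {+ 3} {+ q - + 1} 3∣q-1
  -- The quotient comes from `q² + q - 2 = (q - 1) (q + 2)`.
  ... | Signed.divides k q-1≡3k = 3∤2 (+ e ℤ.* + 2 ℤ.+ - (k ℤ.* (+ q ℤ.+ + 2))) (begin
    + 2  ≡⟨ lemma₁ (+ q) ⟩
    (+ q ℤ.* + q ℤ.+ + q) ℤ.+ - ((+ q ℤ.+ - + 1) ℤ.* (+ q ℤ.+ + 2))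
      ≡⟨ cong₂ (λ x y → x ℤ.+ - (y ℤ.* (+ q ℤ.+ + 2))) (trans (cong (ℤ._+ + q) (sym (pos-square q))) (trans (cong +_ (sym eq)) (ℤ.pos-* e 6))) q-1≡3k ⟩
    + e ℤ.* + 6 ℤ.+ - (k ℤ.* + 3 ℤ.* (+ q ℤ.+ + 2)) ≡⟨ lemma₂ (+ e) k (+ q) ⟩
    (+ e ℤ.* + 2 ℤ.+ - (k ℤ.* (+ q ℤ.+ + 2))) ℤ.* + 3 ∎)
    where
    open ≡-Reasoning
    lemma₁ : ∀ q → + 2 ≡ (q ℤ.* q ℤ.+ q) ℤ.+ - ((q ℤ.+ - + 1) ℤ.* (q ℤ.+ + 2))
    lemma₁ = ℤ-Solver.solve-∀
    lemma₂ : ∀ e k q → e ℤ.* + 6 ℤ.+ - (k ℤ.* + 3 ℤ.* (q ℤ.+ + 2)) ≡ (e ℤ.* + 2 ℤ.+ - (k ℤ.* (q ℤ.+ + 2))) ℤ.* + 3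
    lemma₂ = ℤ-Solver.solve-∀

  -- q(q - 1) ≡ 2 (mod 3) for q ≡ -1 (mod 3).
  6∤q²-q : ∀ e q → + 3 ∣ + q - - + 1 → e ℕ.* 6 ℕ.+ q ≢ q ℕ.* q
  6∤q²-q e q 3∣q+1 eq with Signed.∣ᵤ⇒∣ {+ 3} {+ q - - + 1} 3∣q+1
  -- The quotient comes from `q² - q - 2 = (q + 1) (q - 2)`.
  ... | Signed.divides k q+1≡3k = 3∤2 (+ e ℤ.* + 2 ℤ.+ - (k ℤ.* (+ q ℤ.+ - + 2))) (begin
    + 2  ≡⟨ lemma₁ (+ q) ⟩
    (+ q ℤ.* + q ℤ.+ - + q) ℤ.+ - ((+ q ℤ.+ + 1) ℤ.* (+ q ℤ.+ - + 2))
      ≡⟨ cong₂ (λ x y → x ℤ.+ - (y ℤ.* (+ q ℤ.+ - + 2))) (trans (cong (ℤ._+ - + q) (sym (pos-square q))) (trans (sym (moved {e ℕ.* 6} eq)) (ℤ.pos-* e 6))) q+1≡3k ⟩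
    + e ℤ.* + 6 ℤ.+ - (k ℤ.* + 3 ℤ.* (+ q ℤ.+ - + 2)) ≡⟨ lemma₂ (+ e) k (+ q) ⟩
    (+ e ℤ.* + 2 ℤ.+ - (k ℤ.* (+ q ℤ.+ - + 2))) ℤ.* + 3 ∎)
    where
    open ≡-Reasoning
    lemma₁ : ∀ q → + 2 ≡ (q ℤ.* q ℤ.+ - q) ℤ.+ - ((q ℤ.+ + 1) ℤ.* (q ℤ.+ - + 2))
    lemma₁ = ℤ-Solver.solve-∀
    lemma₂ : ∀ e k q → e ℤ.* + 6 ℤ.+ - (k ℤ.* + 3 ℤ.* (q ℤ.+ - + 2)) ≡ (e ℤ.* + 2 ℤ.+ - (k ℤ.* (q ℤ.+ - + 2))) ℤ.* + 3
    lemma₂ = ℤ-Solver.solve-∀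

module _ {c ℓ} (F : Field c ℓ) (q n h : ℕ) (ξ : ℤ)
  (q≡2^n : q ≡ 2 ^ n) (3≤n : 3 ≤ n) (order : HasOrder F q) (gcd≡1 : gcd n h ≡ 1)
  (ξ≡±1 : ξ ≡ + 1 ⊎ ξ ≡ - (+ 1)) (3∣q-ξ : + 3 ∣ + q - ξ) where

  private
    3≤q : 3 ≤ q
    3≤q = subst (3 ≤_) (sym q≡2^n) (ℕ.≤-trans (ℕ.m≤m+n 3 5) (ℕ.^-monoʳ-≤ 2 3≤n))

  open Projective F n h q≡2^n gcd≡1 order 3≤q
  open PG3 F using (𝒪; ExactlyPlanesThrough)
  open Geometry S using (V; Off; root?; Q; z; 0#; _≟ᴷ_; z-quadric; z-nonquadric; finiteI; Root)
  open Classes S 3≤card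
  open Counts S 3≤card using (_⊥?_)
  open Data.Nat using (_+_; _*_)

  private
    module _ {p : V} (off : Off p) where

      open Plane off

      open ClassCounts q (N nothing) (N (just 0F)) (N (just 1F)) (N (just 2F)) (N (just 3F)) (#chords p)

      open Equations
        (trans ∑-one (cong (λ q → 1 + q + q * q) card≡q))
        (trans ∑-roots (cong (λ q → (1 + q) * (1 + q)) card≡q))
        (trans ∑-roots² (cong (λ q → (1 + q) * (1 + q) + q * #chords p) card≡q))

      -- This determines the class of index 2: in the plane, the points of the quadric are those of
      -- the curve and of that class.
      quadric-sum : N nothing + N (just 2F) ≡ #ᴾ (λ x → (p ⊥? x) ×-dec (Q x ≟ᴷ 0#))
      quadric-sum = trans (identity (N nothing) (N (just 0F)) (N (just 1F)) (N (just 2F)) (N (just 3F))) ∑-quadric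
        where
        identity : ∀ a b c d e → a + d ≡ 1 * a + (0 * b + (0 * c + (1 * d + (0 * e + 0))))
        identity = solve-∀

      module _ (z≡1 : z p ≡ 1) where

        private
          a≡1 : N nothing ≡ 1
          a≡1 = trans N-curve z≡1

          d≡q : N (just 2F) ≡ q
          -- The conic has `1 + q` points, one of which is on the curve.
          d≡q = ℕ.suc-injective (trans (cong (_+ N (just 2F)) (sym a≡1)) (trans quadric-sum (trans (#ᴾ⊥Q Q≢0) (cong suc card≡q))))
            where
            Q≢0 : Q p ≢ 0#
            Q≢0 Q≡0 = contradiction (trans (sym z≡1) (z-quadric Q≡0 off)) λ ()

        -- The divisibility of 6 N (just 3F) by 3 forces q ≡ 1 (mod 3) if p lies on no
        -- chord and q ≡ -1 (mod 3) if it lies on one.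
        r₁-count : ∀ d → + N (index d) / 1 ≃ r₁ (+ q) ξ d
        r₁-count = case #chords-off off , ξ≡±1 of λ
          { (inj₁ C≡ , inj₁ ξ≡1) → let e , b , c = type1-no-chord 6e 3b 2c a≡1 d≡q (trans C≡ (cong suc card≡q)) in
              subst (λ ξ → ∀ d → + N (index d) / 1 ≃ r₁ (+ q) ξ d) (sym ξ≡1) λ
              { q+1    → *≡* (cong (λ a → + a ℤ.* + 1) a≡1)
              ; ⟨ 0F ⟩ → *≡* (x+q≡q² (N (just 0F)) 3 q b)
              ; ⟨ 1F ⟩ → *≡* (x≡q²+q (N (just 1F)) 2 q c)
              ; ⟨ 2F ⟩ → *≡* (cong (λ d → + d ℤ.* + 1) d≡q)
              ; ⟨ 3F ⟩ → *≡* (x+q≡q² (N (just 3F)) 6 q e) }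
          ; (inj₂ C≡ , inj₂ ξ≡-1) → let e , b , c = type1-chord 6e 3b 2c a≡1 d≡q (trans C≡ (cong (λ q → 3 + q) card≡q)) in
              subst (λ ξ → ∀ d → + N (index d) / 1 ≃ r₁ (+ q) ξ d) (sym ξ≡-1) λ
              { q+1    → *≡* (cong (λ a → + a ℤ.* + 1) a≡1)
              ; ⟨ 0F ⟩ → *≡* (x≡q²+q (N (just 0F)) 3 q b)
              ; ⟨ 1F ⟩ → *≡* (x+q≡q² (N (just 1F)) 2 q c)
              ; ⟨ 2F ⟩ → *≡* (cong (λ d → + d ℤ.* + 1) d≡q)
              ; ⟨ 3F ⟩ → *≡* (x≡q²+q (N (just 3F)) 6 q e) }
          ; (inj₁ C≡ , inj₂ ξ≡-1) → let e , _ = type1-no-chord 6e 3b 2c a≡1 d≡q (trans C≡ (cong suc card≡q)) in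
              contradiction e (6∤q²-q (N (just 3F)) q (subst (λ ξ → + 3 ∣ + q - ξ) ξ≡-1 3∣q-ξ))
          ; (inj₂ C≡ , inj₁ ξ≡1) → let e , _ = type1-chord 6e 3b 2c a≡1 d≡q (trans C≡ (cong (λ q → 3 + q) card≡q)) in
              contradiction e (6∤q²+q (N (just 3F)) q (subst (λ ξ → + 3 ∣ + q - ξ) ξ≡1 3∣q-ξ)) }

      module _ (z≡2 : z p ≡ 2) where

        private
          Q≡0 : Q p ≡ 0#
          Q≡0 = case Q p ≟ᴷ 0# of λ
            { (yes Q≡0) → Q≡0
            ; (no Q≢0)  → contradiction z≡2 ([ (λ z≡0 → differ z≡0 λ ()) , [ (λ z≡1 → differ z≡1 λ ()) , (λ z≡3 → differ z≡3 λ ()) ]′ ]′ (z-nonquadric Q≢0)) }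
            where
            differ : ∀ {m} → z p ≡ m → m ≢ 2 → z p ≢ 2
            differ z≡m m≢2 z≡2 = m≢2 (trans (sym z≡m) z≡2)

          two-roots : ∃₂ λ i j → i ≢ j × Root p i × Root p j
          two-roots = #-two⁻ finiteI (root? p) z≡2

          a≡2 : N nothing ≡ 2
          a≡2 = trans N-curve z≡2

          d+1≡2q : N (just 2F) + 1 ≡ 2 * q
          -- Two lines with a common point have `1 + 2 q` points, of which two are on the curve.
          d+1≡2q = let i , j , i≢j , ri , rj = two-roots in
            ℕ.suc-injective (trans (cong suc (ℕ.+-comm _ 1)) (trans (cong (_+ N (just 2F)) (sym a≡2))
              (trans quadric-sum (trans (#ᴾ⊥Q-tangent Q≡0 off i≢j ri rj) (cong (λ q → 1 + 2 * q) card≡q)))))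

        r₂-count : ∀ d → + N (index d) / 1 ≃ r₂ (+ q) d
        r₂-count = let
            e , b , c = type2 6e 3b 2c a≡2 d+1≡2q (trans (#chords-quadric Q≡0 off) (cong suc card≡q))
          in λ
          { q+1    → *≡* (cong (λ a → + a ℤ.* + 1) a≡2)
          ; ⟨ 0F ⟩ → *≡* (x+1≡q² (N (just 0F)) 3 q b)
          ; ⟨ 1F ⟩ → *≡* (x+q≡q² (N (just 1F)) 2 q c)
          ; ⟨ 2F ⟩ → *≡* (x+1≡2q (N (just 2F)) q d+1≡2q)
          ; ⟨ 3F ⟩ → *≡* (x+3q≡q²+2 (N (just 3F)) 6 q e) }

  planes-through-𝒪₁ : ∀ P → 𝒪 h ⟨ 1F ⟩ P → ∀ d → ExactlyPlanesThrough h P d (r₁ (+ q) ξ d)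
  planes-through-𝒪₁ P P∈𝒪₁ d = let off = 𝒪⇒Off {P} P∈𝒪₁ in
    Plane.N off (index d) , r₁-count off (𝒪⇒z {P} P∈𝒪₁) d , planes-count {P} off d

  planes-through-𝒪₂ : ∀ P → 𝒪 h ⟨ 2F ⟩ P → ∀ d → ExactlyPlanesThrough h P d (r₂ (+ q) d)
  planes-through-𝒪₂ P P∈𝒪₂ d = let off = 𝒪⇒Off {P} P∈𝒪₂ in
    Plane.N off (index d) , r₂-count off (𝒪⇒z {P} P∈𝒪₂) d , planes-count {P} off d

proposition3p8 : ∀ {c ℓ} (F : Field c ℓ) (q n h : ℕ) (ξ : ℤ) →
    q ≡ 2 ^ n → 3 ≤ n → HasOrder F q →
    1 ≤ h → gcd n h ≡ 1 →
    ξ ≡ + 1 ⊎ ξ ≡ - (+ 1) → + 3 ∣ + q - ξ →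
    let open PG3 F in
    (∀ P → 𝒪 h ⟨ 1F ⟩ P → ∀ d → ExactlyPlanesThrough h P d (r₁ (+ q) ξ d)) ×
    (∀ P → 𝒪 h ⟨ 2F ⟩ P → ∀ d → ExactlyPlanesThrough h P d (r₂ (+ q) d))
proposition3p8 F q n h ξ q≡2^n 3≤n order 1≤h gcd≡1 ξ≡±1 3∣q-ξ =
  planes-through-𝒪₁ F q n h ξ q≡2^n 3≤n order gcd≡1 ξ≡±1 3∣q-ξ ,
  planes-through-𝒪₂ F q n h ξ q≡2^n 3≤n order gcd≡1 ξ≡±1 3∣q-ξ
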